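{- Let $\mathcal{A}$ be a hyperplane arrangement in $V$, let $H\in\mathcal{A}$, and let $$\Xi(\mathcal{A},H)=\{X\in L(\mathcal{A}^H)\mid J_{\mathcal{A}_X}^H\ne(1)\}.$$ For a subspace $X$ of $H$, let $P_X$ be the defining ideal of $X$ in $\overline S=S/(\alpha_H)$. Then: (1) $\sqrt{J_{\mathcal{A}}^H}=\bigcap_{X\in\Xi(\mathcal{A},H)}P_X$. (2) The set $\mathrm{Ass}(J_{\mathcal{A}}^H)$ of associated primes of $J_{\mathcal{A}}^H$ is contained in $\{P_X\mid X\in\Xi(\mathcal{A},H)\}$. (3) One has $$J_{\mathcal{A}}^H=\bigcap_{P_X\in\mathrm{Ass}(J_{\mathcal{A}}^H)}J_{\mathcal{A}_X}^H.$$ In particular, if $J_{\mathcal{A}}^H$ has no embedded primes, then this presentation is a primary decomposition of $J_{\mathcal{A}}^H$.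
   Context: Let $\mathbb{K}$ be a field, $V$ an $\ell$-dimensional $\mathbb{K}$-vector space, $x_1,\dots,x_\ell$ a basis of $V^*$ and $S=\mathrm{Sym}(V^*)=\mathbb{K}[x_1,\dots,x_\ell]$. An arrangement in $V$ is a finite set $\mathcal{A}$ of linear hyperplanes (through the origin) of $V$. For a hyperplane $H$, $\alpha_H\in V^*$ denotes a fixed defining linear form, and $Q(\mathcal{A})=\prod_{H\in\mathcal{A}}\alpha_H$. Let $\Omega_V^1=\bigoplus_i S\,dx_i$, $\Omega_V^2=\bigwedge^2\Omega_V^1$, and for $\alpha=\sum c_ix_i$ let $d\alpha=\sum c_i\,dx_i$. Define $$\Omega^1(\mathcal{A})=\{\omega\in \tfrac{1}{Q(\mathcal{A})}\Omega^1_V \mid Q(\mathcal{A})\,\omega\wedge d\alpha_L\in\alpha_L\Omega_V^2\ \text{for all } L\in\mathcal{A}\}.$$ For $H\in\mathcal{A}$, the restriction is $\mathcal{A}^H=\{H\cap L\mid L\in\mathcal{A},L\ne H\}$, an arrangement in $H$, whose coordinate ring is $\overline S=S/(\alpha_H)=\mathrm{Sym}(H^*)$; $\overline g$ denotes the image in $\overline S$ of $g\in S$. The residue map $\mathrm{res}^H_{\mathcal{A}}:\Omega^1(\mathcal{A})\to\overline S$ is $$\mathrm{res}^H_{\mathcal{A}}\big(f\,d\alpha_H+f_2\,d\alpha_2+\cdots+f_\ell\,d\alpha_\ell\big)=\frac{1}{Q(\mathcal{A}^H)}\,\overline{Q(\mathcal{A})f},$$ where $\alpha_H,\alpha_2,\dots,\alpha_\ell$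 is any basis of $V^*$ (this is well defined, independent of the choice of $\alpha_2,\dots,\alpha_\ell$, and takes values in $\overline S$). The residue ideal $J_{\mathcal{A}}^H\subset\overline S$ is the image of $\mathrm{res}^H_{\mathcal{A}}$. $L(\mathcal{A}^H)$ is the set of all subspaces of $H$ that are intersections of hyperplanes of $\mathcal{A}^H$ (including $H$ itself as the empty intersection). For a subspace $X\subset V$, $\mathcal{A}_X=\{L\in\mathcal{A}\mid X\subseteq L\}$; if $X\subset H$ then $H\in\mathcal{A}_X$, so $J_{\mathcal{A}_X}^H$ is an ideal of the same ring $\overline S$. Associated primes of an ideal $J\subset\overline S$ are those of $\overline S/J$; an embedded prime is an associated prime that is not minimal among the primes containing $J$. An empty intersection of ideals of $\overline S$ is $\overline S$. -}

module Defs where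

open import Level using (Level; _⊔_; Lift; lift; lower) renaming (suc to lsuc)
open import Algebra.Bundles using (CommutativeRing)
open import Algebra.Apartness.Bundles using (HeytingCommutativeRing; HeytingField)
import Algebra.Definitions.RawMagma as RawMagmaDefinitions
import Algebra.Definitions.RawMonoid as RawMonoidDefinitions
import Algebra.Properties.Semiring.Exp as SemiringExp
import Algebra.Properties.CommutativeSemigroup as CommutativeSemigroupProperties
import Algebra.Properties.Ring as RingProperties
open import Axiom.ExcludedMiddle using (ExcludedMiddle)
open import Data.Fin.Base using (Fin; zero; suc; _<_)
open import Data.List.Base using (List; []; _∷_; map; foldr; filter; deduplicate)
open import Data.List.Membership.Propositional using () renaming (_∈_ to _∈ˡ_)
open import Data.List.Relation.Unary.All using (All)
import Data.List.Relation.Unary.All.Properties as All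
open import Data.List.Relation.Unary.AllPairs using (AllPairs)
import Data.List.Relation.Unary.AllPairs.Properties as AllPairs
open import Data.List.Relation.Unary.Any using (Any)
open import Data.Nat.Base using (ℕ; zero; suc)
open import Data.Product.Base using (Σ; ∃-syntax; _×_; _,_)
open import Data.Sum.Base using (_⊎_)
open import Data.Vec.Functional using (Vector)
open import Relation.Binary.Bundles using (Setoid)
open import Relation.Binary.Structures using (IsEquivalence)
import Relation.Binary.Reasoning.Setoid as SetoidReasoning
open import Relation.Nullary.Decidable.Core using (Dec; map′)
open import Relation.Nullary.Negation.Core using (¬_)
open import Relation.Unary using (Pred; _∈_; _∉_; _⊆_; _≐_; _∩_; ⋂; U)

-- The polynomial ring R[X].  A polynomial is a list of coefficients,
-- constant term first, and trailing zeros are ignored by _≋_.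

module Polynomial {c ℓ : Level} (R : CommutativeRing c ℓ) where

  private module R = CommutativeRing R
  open R using (Carrier; _≈_; 0#; 1#)
  open RingProperties R.ring using (-0#≈0#)

  infix  4 _≋_
  infixl 6 _⊕_
  infixl 7 _⊗_
  infix  8 ⊝_

  coeff : List Carrier → ℕ → Carrier
  coeff []      _       = 0#
  coeff (a ∷ p) zero    = a
  coeff (a ∷ p) (suc k) = coeff p k

  record _≋_ (p q : List Carrier) : Set ℓ where
    constructor coeffs
    field coeff-≈ : ∀ k → coeff p k ≈ coeff q k
  open _≋_ public

  _⊕_ : List Carrier → List Carrier → List Carrier
  []      ⊕ q       = q
  (a ∷ p) ⊕ []      = a ∷ p
  (a ∷ p) ⊕ (b ∷ q) = (a R.+ b) ∷ (p ⊕ q)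

  ⊝_ : List Carrier → List Carrier
  ⊝_ = map (R.-_)

  scale : Carrier → List Carrier → List Carrier
  scale a = map (a R.*_)

  shift : List Carrier → List Carrier
  shift p = 0# ∷ p

  _⊗_ : List Carrier → List Carrier → List Carrier
  []      ⊗ q = []
  (a ∷ p) ⊗ q = scale a q ⊕ shift (p ⊗ q)

  private
    coeff-⊕ : ∀ p q k → coeff (p ⊕ q) k ≈ coeff p k R.+ coeff q k
    coeff-⊕ []      q       k       = R.sym (R.+-identityˡ _)
    coeff-⊕ (a ∷ p) []      k       = R.sym (R.+-identityʳ _)
    coeff-⊕ (a ∷ p) (b ∷ q) zero    = R.refl
    coeff-⊕ (a ∷ p) (b ∷ q) (suc k) = coeff-⊕ p q k

    coeff-⊝ : ∀ p k → coeff (⊝ p) k ≈ R.- coeff p k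
    coeff-⊝ []      k       = R.sym -0#≈0#
    coeff-⊝ (a ∷ p) zero    = R.refl
    coeff-⊝ (a ∷ p) (suc k) = coeff-⊝ p k

    coeff-scale : ∀ a p k → coeff (scale a p) k ≈ a R.* coeff p k
    coeff-scale a []      k       = R.sym (R.zeroʳ a)
    coeff-scale a (b ∷ p) zero    = R.refl
    coeff-scale a (b ∷ p) (suc k) = coeff-scale a p k

    ≋-refl : ∀ {p} → p ≋ p
    ≋-refl = coeffs λ _ → R.refl

    ≋-sym : ∀ {p q} → p ≋ q → q ≋ p
    ≋-sym e = coeffs λ k → R.sym (coeff-≈ e k)

    ≋-trans : ∀ {p q r} → p ≋ q → q ≋ r → p ≋ r
    ≋-trans e f = coeffs λ k → R.trans (coeff-≈ e k) (coeff-≈ f k)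

    ≋-isEquivalence : IsEquivalence _≋_
    ≋-isEquivalence = record { refl = ≋-refl ; sym = ≋-sym ; trans = ≋-trans }

    ≋-setoid : Setoid c ℓ
    ≋-setoid = record { isEquivalence = ≋-isEquivalence }

    open SetoidReasoning ≋-setoid

    ⊕-cong : ∀ {p p′ q q′} → p ≋ p′ → q ≋ q′ → p ⊕ q ≋ p′ ⊕ q′
    ⊕-cong {p} {p′} {q} {q′} e f = coeffs λ k →
      R.trans (coeff-⊕ p q k)
        (R.trans (R.+-cong (coeff-≈ e k) (coeff-≈ f k)) (R.sym (coeff-⊕ p′ q′ k)))

    ⊕-assoc : ∀ p q r → (p ⊕ q) ⊕ r ≋ p ⊕ (q ⊕ r)
    ⊕-assoc p q r = coeffs λ k →
      R.trans (coeff-⊕ (p ⊕ q) r k)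
        (R.trans (R.+-congʳ (coeff-⊕ p q k))
          (R.trans (R.+-assoc _ _ _)
            (R.sym (R.trans (coeff-⊕ p (q ⊕ r) k) (R.+-congˡ (coeff-⊕ q r k))))))

    ⊕-comm : ∀ p q → p ⊕ q ≋ q ⊕ p
    ⊕-comm p q = coeffs λ k →
      R.trans (coeff-⊕ p q k) (R.trans (R.+-comm _ _) (R.sym (coeff-⊕ q p k)))

    ⊕-identityʳ : ∀ p → p ⊕ [] ≋ p
    ⊕-identityʳ p = ⊕-comm p []

    ⊝-cong : ∀ {p q} → p ≋ q → ⊝ p ≋ ⊝ q
    ⊝-cong {p} {q} e = coeffs λ k →
      R.trans (coeff-⊝ p k) (R.trans (R.-‿cong (coeff-≈ e k)) (R.sym (coeff-⊝ q k)))

    ⊝-inverseˡ : ∀ p → ⊝ p ⊕ p ≋ []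
    ⊝-inverseˡ p = coeffs λ k →
      R.trans (coeff-⊕ (⊝ p) p k) (R.trans (R.+-congʳ (coeff-⊝ p k)) (R.-‿inverseˡ _))

    interchange : ∀ p q r s → (p ⊕ q) ⊕ (r ⊕ s) ≋ (p ⊕ r) ⊕ (q ⊕ s)
    interchange = CommutativeSemigroupProperties.interchange (record
      { isCommutativeSemigroup = record
        { isSemigroup = record
          { isMagma = record { isEquivalence = ≋-isEquivalence ; ∙-cong = ⊕-cong }
          ; assoc = ⊕-assoc }
        ; comm = ⊕-comm } })

    scale-cong : ∀ {a b p q} → a ≈ b → p ≋ q → scale a p ≋ scale b q
    scale-cong {a} {b} {p} {q} e f = coeffs λ k →
      R.trans (coeff-scale a p k)
        (R.trans (R.*-cong e (coeff-≈ f k)) (R.sym (coeff-scale b q k)))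

    scale-⊕ : ∀ a p q → scale a (p ⊕ q) ≋ scale a p ⊕ scale a q
    scale-⊕ a p q = coeffs λ k →
      R.trans (coeff-scale a (p ⊕ q) k)
        (R.trans (R.*-congˡ (coeff-⊕ p q k))
          (R.trans (R.distribˡ a _ _)
            (R.sym (R.trans (coeff-⊕ (scale a p) (scale a q) k)
              (R.+-cong (coeff-scale a p k) (coeff-scale a q k))))))

    scale-scale : ∀ a b p → scale (a R.* b) p ≋ scale a (scale b p)
    scale-scale a b p = coeffs λ k →
      R.trans (coeff-scale (a R.* b) p k)
        (R.trans (R.*-assoc a b _)
          (R.sym (R.trans (coeff-scale a (scale b p) k) (R.*-congˡ (coeff-scale b p k)))))

    scale-0# : ∀ p → scale 0# p ≋ []
    scale-0# p = coeffs λ k → R.trans (coeff-scale 0# p k) (R.zeroˡ _)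

    scale-1# : ∀ p → scale 1# p ≋ p
    scale-1# p = coeffs λ k → R.trans (coeff-scale 1# p k) (R.*-identityˡ _)

    ∷-cong : ∀ {a b p q} → a ≈ b → p ≋ q → a ∷ p ≋ b ∷ q
    ∷-cong e f = coeffs λ { zero → e ; (suc k) → coeff-≈ f k }

    shift-[] : shift [] ≋ []
    shift-[] = coeffs λ { zero → R.refl ; (suc k) → R.refl }

    shift-⊕ : ∀ p q → shift (p ⊕ q) ≋ shift p ⊕ shift q
    shift-⊕ p q = ∷-cong (R.sym (R.+-identityˡ 0#)) ≋-refl

    scale-shift : ∀ a p → scale a (shift p) ≋ shift (scale a p)
    scale-shift a p = ∷-cong (R.zeroʳ a) ≋-refl

    ⊗-congˡ : ∀ p {q r} → q ≋ r → p ⊗ q ≋ p ⊗ r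
    ⊗-congˡ []      e = ≋-refl
    ⊗-congˡ (a ∷ p) e = ⊕-cong (scale-cong R.refl e) (∷-cong R.refl (⊗-congˡ p e))

    ⊗-zeroʳ : ∀ p → p ⊗ [] ≋ []
    ⊗-zeroʳ []      = ≋-refl
    ⊗-zeroʳ (a ∷ p) = ≋-trans (∷-cong R.refl (⊗-zeroʳ p)) shift-[]

    ⊗-∷ : ∀ p b q → p ⊗ (b ∷ q) ≋ scale b p ⊕ shift (p ⊗ q)
    ⊗-∷ []      b q = ≋-sym shift-[]
    ⊗-∷ (a ∷ p) b q =
      ∷-cong (R.+-congʳ (R.*-comm a b)) (begin
        scale a q ⊕ p ⊗ (b ∷ q)                     ≈⟨ ⊕-cong ≋-refl (⊗-∷ p b q) ⟩
        scale a q ⊕ (scale b p ⊕ shift (p ⊗ q))     ≈⟨ ⊕-assoc (scale a q) (scale b p) _ ⟨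
        (scale a q ⊕ scale b p) ⊕ shift (p ⊗ q)     ≈⟨ ⊕-cong (⊕-comm (scale a q) (scale b p)) ≋-refl ⟩
        (scale b p ⊕ scale a q) ⊕ shift (p ⊗ q)     ≈⟨ ⊕-assoc (scale b p) (scale a q) _ ⟩
        scale b p ⊕ (scale a q ⊕ shift (p ⊗ q))     ∎)

    ⊗-comm : ∀ p q → p ⊗ q ≋ q ⊗ p
    ⊗-comm []      q = ≋-sym (⊗-zeroʳ q)
    ⊗-comm (a ∷ p) q = ≋-trans
      (⊕-cong ≋-refl (∷-cong R.refl (⊗-comm p q))) (≋-sym (⊗-∷ q a p))

    ⊗-cong : ∀ {p p′ q q′} → p ≋ p′ → q ≋ q′ → p ⊗ q ≋ p′ ⊗ q′
    ⊗-cong {p} {p′} {q} {q′} e f = begin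
      p ⊗ q    ≈⟨ ⊗-congˡ p f ⟩
      p ⊗ q′   ≈⟨ ⊗-comm p q′ ⟩
      q′ ⊗ p   ≈⟨ ⊗-congˡ q′ e ⟩
      q′ ⊗ p′  ≈⟨ ⊗-comm q′ p′ ⟩
      p′ ⊗ q′  ∎

    ⊗-distribˡ : ∀ p q r → p ⊗ (q ⊕ r) ≋ p ⊗ q ⊕ p ⊗ r
    ⊗-distribˡ []      q r = ≋-refl
    ⊗-distribˡ (a ∷ p) q r = begin
      scale a (q ⊕ r) ⊕ shift (p ⊗ (q ⊕ r))
        ≈⟨ ⊕-cong (scale-⊕ a q r)
             (≋-trans (∷-cong R.refl (⊗-distribˡ p q r)) (shift-⊕ (p ⊗ q) (p ⊗ r))) ⟩
      (scale a q ⊕ scale a r) ⊕ (shift (p ⊗ q) ⊕ shift (p ⊗ r))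
        ≈⟨ interchange (scale a q) (scale a r) _ _ ⟩
      (scale a q ⊕ shift (p ⊗ q)) ⊕ (scale a r ⊕ shift (p ⊗ r)) ∎

    ⊗-distribʳ : ∀ r p q → (p ⊕ q) ⊗ r ≋ p ⊗ r ⊕ q ⊗ r
    ⊗-distribʳ r p q = begin
      (p ⊕ q) ⊗ r    ≈⟨ ⊗-comm (p ⊕ q) r ⟩
      r ⊗ (p ⊕ q)    ≈⟨ ⊗-distribˡ r p q ⟩
      r ⊗ p ⊕ r ⊗ q  ≈⟨ ⊕-cong (⊗-comm r p) (⊗-comm r q) ⟩
      p ⊗ r ⊕ q ⊗ r  ∎

    scale-⊗ : ∀ a p q → scale a p ⊗ q ≋ scale a (p ⊗ q)
    scale-⊗ a []      q = ≋-refl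
    scale-⊗ a (b ∷ p) q = begin
      scale (a R.* b) q ⊕ shift (scale a p ⊗ q)
        ≈⟨ ⊕-cong (scale-scale a b q)
             (≋-trans (∷-cong R.refl (scale-⊗ a p q)) (≋-sym (scale-shift a (p ⊗ q)))) ⟩
      scale a (scale b q) ⊕ scale a (shift (p ⊗ q))
        ≈⟨ scale-⊕ a (scale b q) (shift (p ⊗ q)) ⟨
      scale a (scale b q ⊕ shift (p ⊗ q)) ∎

    ⊗-assoc : ∀ p q r → (p ⊗ q) ⊗ r ≋ p ⊗ (q ⊗ r)
    ⊗-assoc []      q r = ≋-refl
    ⊗-assoc (a ∷ p) q r = begin
      (scale a q ⊕ shift (p ⊗ q)) ⊗ r
        ≈⟨ ⊗-distribʳ r (scale a q) (shift (p ⊗ q)) ⟩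
      scale a q ⊗ r ⊕ (scale 0# r ⊕ shift ((p ⊗ q) ⊗ r))
        ≈⟨ ⊕-cong (scale-⊗ a q r)
             (⊕-cong (scale-0# r) (∷-cong R.refl (⊗-assoc p q r))) ⟩
      scale a (q ⊗ r) ⊕ shift (p ⊗ (q ⊗ r)) ∎

    ⊗-identityˡ : ∀ p → (1# ∷ []) ⊗ p ≋ p
    ⊗-identityˡ p = begin
      scale 1# p ⊕ shift []  ≈⟨ ⊕-cong (scale-1# p) shift-[] ⟩
      p ⊕ []                 ≈⟨ ⊕-identityʳ p ⟩
      p                      ∎

  commutativeRing : CommutativeRing c ℓ
  commutativeRing = record
    { Carrier = List Carrier
    ; _≈_     = _≋_
    ; _+_     = _⊕_
    ; _*_     = _⊗_
    ; -_      = ⊝_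
    ; 0#      = []
    ; 1#      = 1# ∷ []
    ; isCommutativeRing = record
      { isRing = record
        { +-isAbelianGroup = record
          { isGroup = record
            { isMonoid = record
              { isSemigroup = record
                { isMagma = record { isEquivalence = ≋-isEquivalence ; ∙-cong = ⊕-cong }
                ; assoc = ⊕-assoc }
              ; identity = (λ _ → ≋-refl) , ⊕-identityʳ }
            ; inverse = ⊝-inverseˡ
                      , λ p → ≋-trans (⊕-comm p (⊝ p)) (⊝-inverseˡ p)
            ; ⁻¹-cong = ⊝-cong }
          ; comm = ⊕-comm }
        ; *-cong = ⊗-cong
        ; *-assoc = ⊗-assoc
        ; *-identity = ⊗-identityˡ
                     , λ p → ≋-trans (⊗-comm p (1# ∷ [])) (⊗-identityˡ p)
        ; distrib = ⊗-distribˡ , ⊗-distribʳ }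
      ; *-comm = ⊗-comm } }

-- R[x₀,…,xₙ₋₁], built as R[x₁,…,xₙ₋₁][x₀].

module _ {c ℓ : Level} (R : CommutativeRing c ℓ) where

  polynomialRing : ℕ → CommutativeRing c ℓ
  polynomialRing zero    = R
  polynomialRing (suc n) = Polynomial.commutativeRing (polynomialRing n)

  constant : ∀ n → CommutativeRing.Carrier R → CommutativeRing.Carrier (polynomialRing n)
  constant zero    a = a
  constant (suc n) a = constant n a ∷ []

  var : ∀ n → Fin n → CommutativeRing.Carrier (polynomialRing n)
  var (suc n) zero    = CommutativeRing.0# (polynomialRing n)
                            ∷ CommutativeRing.1# (polynomialRing n) ∷ []
  var (suc n) (suc i) = var n i ∷ []

-- R/(a): the carrier is that of R, so that the class of g is g itself.

module Quotient {c ℓ : Level} (R : CommutativeRing c ℓ) (a : CommutativeRing.Carrier R) where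

  open CommutativeRing R
  open RawMagmaDefinitions *-rawMagma using (_∣_; _,_)
  open SetoidReasoning setoid
  open RingProperties ring using (-‿distribˡ-*; -‿distribʳ-*; -0#≈0#; -‿+-comm; -‿involutive)
  open CommutativeSemigroupProperties +-commutativeSemigroup using (interchange)

  infix 4 _≈ₐ_

  record _≈ₐ_ (x y : Carrier) : Set (c ⊔ ℓ) where
    constructor congruent
    field a∣x-y : a ∣ x - y
  open _≈ₐ_ public

  private
    reflexive′ : ∀ {x y} → x ≈ y → x ≈ₐ y
    reflexive′ {x} {y} e = congruent (0# , (begin
      0# * a  ≈⟨ zeroˡ a ⟩
      0#      ≈⟨ -‿inverseʳ y ⟨
      y - y   ≈⟨ +-congʳ e ⟨
      x - y   ∎))

    sym′ : ∀ {x y} → x ≈ₐ y → y ≈ₐ x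
    sym′ {x} {y} (congruent (q , e)) = congruent (- q , (begin
      - q * a      ≈⟨ -‿distribˡ-* q a ⟨
      - (q * a)    ≈⟨ -‿cong e ⟩
      - (x - y)    ≈⟨ -‿+-comm x (- y) ⟨
      - x - - y    ≈⟨ +-congˡ (-‿involutive y) ⟩
      - x + y      ≈⟨ +-comm (- x) y ⟩
      y - x        ∎))

    +-cong′ : ∀ {x y u v} → x ≈ₐ y → u ≈ₐ v → x + u ≈ₐ y + v
    +-cong′ {x} {y} {u} {v} (congruent (q , e)) (congruent (r , f)) =
      congruent (q + r , (begin
        (q + r) * a          ≈⟨ distribʳ a q r ⟩
        q * a + r * a        ≈⟨ +-cong e f ⟩
        (x - y) + (u - v)    ≈⟨ interchange x (- y) u (- v) ⟩
        (x + u) + (- y - v)  ≈⟨ +-congˡ (-‿+-comm y v) ⟩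
        (x + u) - (y + v)    ∎))

    cancel : ∀ x y z → (x - y) + (y - z) ≈ x - z
    cancel x y z = begin
      (x - y) + (y - z)      ≈⟨ +-assoc x (- y) (y - z) ⟩
      x + (- y + (y - z))    ≈⟨ +-congˡ (+-assoc (- y) y (- z)) ⟨
      x + ((- y + y) - z)    ≈⟨ +-congˡ (+-congʳ (-‿inverseˡ y)) ⟩
      x + (0# - z)           ≈⟨ +-congˡ (+-identityˡ (- z)) ⟩
      x - z                  ∎

    trans′ : ∀ {x y z} → x ≈ₐ y → y ≈ₐ z → x ≈ₐ z
    trans′ {x} {y} {z} (congruent (q , e)) (congruent (r , f)) =
      congruent (q + r , (begin
        (q + r) * a        ≈⟨ distribʳ a q r ⟩
        q * a + r * a      ≈⟨ +-cong e f ⟩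
        (x - y) + (y - z)  ≈⟨ cancel x y z ⟩
        x - z              ∎))

    *-congˡ′ : ∀ x {u v} → u ≈ₐ v → x * u ≈ₐ x * v
    *-congˡ′ x {u} {v} (congruent (q , e)) = congruent (x * q , (begin
      (x * q) * a      ≈⟨ *-assoc x q a ⟩
      x * (q * a)      ≈⟨ *-congˡ e ⟩
      x * (u - v)      ≈⟨ distribˡ x u (- v) ⟩
      x * u + x * - v  ≈⟨ +-congˡ (-‿distribʳ-* x v) ⟨
      x * u - x * v    ∎))

    *-cong′ : ∀ {x y u v} → x ≈ₐ y → u ≈ₐ v → x * u ≈ₐ y * v
    *-cong′ {x} {y} {u} {v} e f =
      trans′ (*-congˡ′ x f) (trans′ (reflexive′ (*-comm x v))
        (trans′ (*-congˡ′ v e) (reflexive′ (*-comm v y))))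

    -‿cong′ : ∀ {x y} → x ≈ₐ y → - x ≈ₐ - y
    -‿cong′ {x} {y} (congruent (q , e)) = congruent (- q , (begin
      - q * a    ≈⟨ -‿distribˡ-* q a ⟨
      - (q * a)  ≈⟨ -‿cong e ⟩
      - (x - y)  ≈⟨ -‿+-comm x (- y) ⟨
      - x - - y  ∎))

  quotientRing : CommutativeRing c (c ⊔ ℓ)
  quotientRing = record
    { Carrier = Carrier
    ; _≈_     = _≈ₐ_
    ; _+_     = _+_
    ; _*_     = _*_
    ; -_      = -_
    ; 0#      = 0#
    ; 1#      = 1#
    ; isCommutativeRing = record
      { isRing = record
        { +-isAbelianGroup = record
          { isGroup = record
            { isMonoid = record
              { isSemigroup = record
                { isMagma = record
                  { isEquivalence = record
                    { refl = reflexive′ refl ; sym = sym′ ; trans = trans′ }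
                  ; ∙-cong = +-cong′ }
                ; assoc = λ x y z → reflexive′ (+-assoc x y z) }
              ; identity = (λ x → reflexive′ (+-identityˡ x))
                         , λ x → reflexive′ (+-identityʳ x) }
            ; inverse = (λ x → reflexive′ (-‿inverseˡ x))
                      , λ x → reflexive′ (-‿inverseʳ x)
            ; ⁻¹-cong = -‿cong′ }
          ; comm = λ x y → reflexive′ (+-comm x y) }
        ; *-cong = *-cong′
        ; *-assoc = λ x y z → reflexive′ (*-assoc x y z)
        ; *-identity = (λ x → reflexive′ (*-identityˡ x))
                     , λ x → reflexive′ (*-identityʳ x)
        ; distrib = (λ x y z → reflexive′ (distribˡ x y z))
                  , λ x y z → reflexive′ (distribʳ x y z) }
      ; *-comm = λ x y → reflexive′ (*-comm x y) } }

module IdealTheory {c ℓ : Level} (R : CommutativeRing c ℓ) where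

  open CommutativeRing R
  open SemiringExp semiring using (_^_)

  record IsIdeal {p : Level} (I : Pred Carrier p) : Set (c ⊔ ℓ ⊔ p) where
    field
      resp     : ∀ {x y} → x ≈ y → x ∈ I → y ∈ I
      0∈       : 0# ∈ I
      +-closed : ∀ {x y} → x ∈ I → y ∈ I → x + y ∈ I
      *-closed : ∀ r {x} → x ∈ I → r * x ∈ I

  data Generated {p : Level} (G : Pred Carrier p) : Pred Carrier (c ⊔ ℓ ⊔ p) where
    generator : ∀ {x} → x ∈ G → Generated G x
    resp      : ∀ {x y} → x ≈ y → Generated G x → Generated G y
    0∈        : Generated G 0#
    +-closed  : ∀ {x y} → Generated G x → Generated G y → Generated G (x + y)
    *-closed  : ∀ r {x} → Generated G x → Generated G (r * x)

  √ : ∀ {p} → Pred Carrier p → Pred Carrier p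
  √ I x = ∃[ k ] x ^ k ∈ I

  _∶_ : ∀ {p} → Pred Carrier p → Carrier → Pred Carrier p
  (I ∶ f) g = g * f ∈ I

  record IsPrime {p : Level} (P : Pred Carrier p) : Set (c ⊔ ℓ ⊔ p) where
    field
      isIdeal : IsIdeal P
      proper  : 1# ∉ P
      prime   : ∀ {x y} → x * y ∈ P → x ∈ P ⊎ y ∈ P

  record IsPrimary {p : Level} (Q : Pred Carrier p) : Set (c ⊔ ℓ ⊔ p) where
    field
      isIdeal : IsIdeal Q
      proper  : 1# ∉ Q
      primary : ∀ {x y} → x * y ∈ Q → x ∈ Q ⊎ y ∈ √ Q

  -- I ∶ f is the annihilator of the class of f in R/I.
  Ass : ∀ {p} → Pred Carrier p → Pred (Pred Carrier p) (c ⊔ ℓ ⊔ p)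
  Ass I P = IsPrime P × ∃[ f ] P ≐ (I ∶ f)

  IsMinimalPrimeOver : ∀ {p} → Pred Carrier p → Pred Carrier p → Set (c ⊔ ℓ ⊔ lsuc p)
  IsMinimalPrimeOver {p} I P =
    IsPrime P × I ⊆ P × (∀ (Q : Pred Carrier p) → IsPrime Q → I ⊆ Q → Q ⊆ P → P ⊆ Q)

  IsEmbeddedPrime : ∀ {p} → Pred Carrier p → Pred Carrier p → Set (c ⊔ ℓ ⊔ lsuc p)
  IsEmbeddedPrime I P = Ass I P × ¬ IsMinimalPrimeOver I P

  -- The family may list a component repeatedly, so finiteness asks for a finite
  -- set of indices that reaches every component.
  record IsPrimaryDecomposition {i p : Level} (I : Pred Carrier p)
                                {Ix : Set i} (Q : Ix → Pred Carrier p) : Set (c ⊔ ℓ ⊔ i ⊔ p) where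
    field
      primary      : ∀ j → IsPrimary (Q j)
      finite       : Σ (List Ix) λ js → ∀ j → Any (λ j′ → Q j ≐ Q j′) js
      intersection : I ≐ ⋂ Ix Q

-- V = Kⁿ, and V* is identified with Kⁿ by the coordinate functions x₀,…,xₙ₋₁.
-- Excluded middle turns a Heyting field into a field in the classical sense, and
-- selects the members of the finite arrangements below.

module Arrangements {c ℓ₁ ℓ₂ : Level} (em : ExcludedMiddle (lsuc (c ⊔ ℓ₁)))
                    (K : HeytingField c ℓ₁ ℓ₂) (n : ℕ) where

  Kᴿ : CommutativeRing c ℓ₁
  Kᴿ = HeytingCommutativeRing.commutativeRing (HeytingField.heytingCommutativeRing K)

  module K = CommutativeRing Kᴿ

  decide : (P : Set (c ⊔ ℓ₁)) → Dec P
  decide P = map′ lower lift (em {Lift (lsuc (c ⊔ ℓ₁)) P})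

  V V* : Set c
  V  = Vector K.Carrier n
  V* = Vector K.Carrier n

  sumᴷ : ∀ {m} → Vector K.Carrier m → K.Carrier
  sumᴷ = RawMonoidDefinitions.sum K.+-rawMonoid

  ⟨_,_⟩ : V* → V → K.Carrier
  ⟨ α , v ⟩ = sumᴷ λ i → α i K.* v i

  Ker : V* → Pred V ℓ₁
  Ker α v = ⟨ α , v ⟩ K.≈ K.0#

  record IsBasis (β : Vector V* n) : Set (c ⊔ ℓ₁) where
    field
      independent : ∀ (a : Vector K.Carrier n) →
                    (∀ j → sumᴷ (λ i → a i K.* β i j) K.≈ K.0#) → ∀ i → a i K.≈ K.0#
      spanning    : ∀ (α : V*) →
                    Σ (Vector K.Carrier n) λ a → (∀ j → α j K.≈ sumᴷ (λ i → a i K.* β i j))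

  record Subspace : Set (lsuc (c ⊔ ℓ₁)) where
    field
      ∣_∣      : Pred V (c ⊔ ℓ₁)
      resp     : ∀ {u v} → (∀ i → u i K.≈ v i) → u ∈ ∣_∣ → v ∈ ∣_∣
      0∈       : (λ _ → K.0#) ∈ ∣_∣
      +-closed : ∀ {u v} → u ∈ ∣_∣ → v ∈ ∣_∣ → (λ i → u i K.+ v i) ∈ ∣_∣
      *-closed : ∀ a {v} → v ∈ ∣_∣ → (λ i → a K.* v i) ∈ ∣_∣
  open Subspace public using (∣_∣)

  S : CommutativeRing c ℓ₁
  S = polynomialRing Kᴿ n

  module S = CommutativeRing S

  sumˢ : ∀ {m} → Vector S.Carrier m → S.Carrier
  sumˢ = RawMonoidDefinitions.sum S.+-rawMonoid

  linear : V* → S.Carrier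
  linear α = sumˢ λ i → constant Kᴿ n (α i) S.* var Kᴿ n i

  Q : List V* → S.Carrier
  Q αs = foldr S._*_ S.1# (map linear αs)

  -- A hyperplane is listed by its chosen defining form; hyperplanes are compared
  -- as subsets of V.
  record Arrangement : Set (c ⊔ ℓ₁) where
    field
      forms    : List V*
      nonzero  : All (λ α → ¬ (∀ i → α i K.≈ K.0#)) forms
      distinct : AllPairs (λ α β → ¬ (Ker α ≐ Ker β)) forms
  open Arrangement public

  localization : Arrangement → Subspace → Arrangement
  localization 𝒜 X = record
    { forms    = filter containsX? (forms 𝒜)
    ; nonzero  = All.filter⁺ containsX? (nonzero 𝒜)
    ; distinct = AllPairs.filter⁺ containsX? (distinct 𝒜)
    }
    where
    containsX? : ∀ α → Dec (∣ X ∣ ⊆ Ker α)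
    containsX? α = decide _

  Ω¹ Ω² : Set c
  Ω¹ = Vector S.Carrier n
  Ω² = ∀ (i j : Fin n) → i < j → S.Carrier

  d : V* → Ω¹
  d α i = constant Kᴿ n (α i)

  _∧_ : Ω¹ → Ω¹ → Ω²
  (ω ∧ θ) i j _ = ω i S.* θ j S.- ω j S.* θ i

  _∈_·Ω² : Ω² → S.Carrier → Set (c ⊔ ℓ₁)
  ω ∈ g ·Ω² = Σ Ω² λ θ → ∀ i j (i<j : i < j) → ω i j i<j S.≈ g S.* θ i j i<j

  -- Every ω in (1/Q(𝒜))Ω¹ is η/Q(𝒜) for a unique η in Ω¹, and ω is represented
  -- throughout by this numerator η.
  LogForms : Arrangement → Pred Ω¹ (c ⊔ ℓ₁)
  LogForms 𝒜 η = All (λ α → (η ∧ d α) ∈ linear α ·Ω²) (forms 𝒜)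

  -- From here on H is the hyperplane defined by αᴴ.
  module AtHyperplane (αᴴ : V*) where

    open Quotient S (linear αᴴ) public using () renaming (quotientRing to S̄)

    module S̄ = CommutativeRing S̄

    open IdealTheory S̄ public

    -- The forms of the arrangement 𝒜ᴴ in H, as elements of V* restricting to them:
    -- one L for each of the distinct intersections H ∩ L.
    restriction : Arrangement → List V*
    restriction 𝒜 = deduplicate sameTrace? (filter notH? (forms 𝒜))
      where
      notH? : ∀ α → Dec (¬ (Ker α ≐ Ker αᴴ))
      notH? α = decide _
      sameTrace? : ∀ α β → Dec ((Ker αᴴ ∩ Ker α) ≐ (Ker αᴴ ∩ Ker β))
      sameTrace? α β = decide _

    -- X ∈ L(𝒜ᴴ)
    InLattice : Arrangement → Pred Subspace (c ⊔ ℓ₁)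
    InLattice 𝒜 X = Σ (List V*) λ βs →
      All (_∈ˡ restriction 𝒜) βs ×
      ∣ X ∣ ≐ (Ker αᴴ ∩ λ v → All (λ β → v ∈ Ker β) βs)

    -- The defining ideal of X is generated by the linear forms vanishing on X (over
    -- a finite field it is smaller than the ideal of all functions vanishing on X).
    P[_] : Subspace → Pred S̄.Carrier (c ⊔ ℓ₁)
    P[ X ] = Generated λ g → Σ V* λ α → ∣ X ∣ ⊆ Ker α × g S̄.≈ linear α

    -- g is the residue of ω = η/Q(𝒜).  If ω = Σᵢ fᵢ dβᵢ for a basis β of V* with
    -- β i₀ = αᴴ, then φ i = Q(𝒜) fᵢ.  The residue is independent of the basis, which
    -- is therefore existentially quantified, and (1/Q(𝒜ᴴ))·φ i₀ is the g with
    -- Q(𝒜ᴴ) g = φ i₀ in the domain S̄.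
    IsResidue : Arrangement → Ω¹ → Pred S̄.Carrier (c ⊔ ℓ₁)
    IsResidue 𝒜 η g =
      Σ (Vector V* n) λ β → Σ (Fin n) λ i₀ → Σ (Vector S.Carrier n) λ φ →
        IsBasis β ×
        (∀ j → β i₀ j K.≈ αᴴ j) ×
        (∀ j → η j S.≈ sumˢ (λ i → φ i S.* d (β i) j)) ×
        φ i₀ S̄.≈ Q (restriction 𝒜) S̄.* g

    J : Arrangement → Pred S̄.Carrier (c ⊔ ℓ₁)
    J 𝒜 g = Σ Ω¹ λ η → η ∈ LogForms 𝒜 × IsResidue 𝒜 η g

    Ξ : Arrangement → Pred Subspace (c ⊔ ℓ₁)
    Ξ 𝒜 X = InLattice 𝒜 X × ¬ (J (localization 𝒜 X) ≐ U)

    -- The X ⊆ H with P_X ∈ Ass(J).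
    AssociatedSubspace : Arrangement → Set (lsuc (c ⊔ ℓ₁))
    AssociatedSubspace 𝒜 = Σ Subspace λ X → ∣ X ∣ ⊆ Ker αᴴ × P[ X ] ∈ Ass (J 𝒜)

{-# OPTIONS --safe #-}
-- Modulo α_H every logarithmic form η is ψ dα_H, so J_𝒜 consists of the g with
-- η ≡ Q(𝒜ᴴ) g dα_H for some η. For X ⊆ H the ideals J_𝒜 and J_{𝒜_X} agree up to products of
-- linear forms that do not vanish on X. The main point is that every s ∉ P_X is a
-- non-zero-divisor modulo J_{𝒜_X}: the substitution that scales the coordinates transverse to
-- X by t and replaces those along X by new variables w maps J_{𝒜_X} into its extension to
-- S[w][t], and it maps s to a polynomial whose constant term in t is a non-zero element of
-- K[w]. Hence J_𝒜 ⊆ J_{𝒜_X}, and for an associated prime P = (J_𝒜 : f) and the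
-- intersection X of H with the hyperplanes whose forms lie in P, one gets P = P_X. The
-- remaining claims follow because S is Noetherian, which supplies for every g whose powers do
-- not multiply f into J_𝒜 an associated prime (J_𝒜 : hf) that avoids g.

module Submission where

open import Defs
open import Level using (Level; _⊔_; Lift; lift; lower) renaming (suc to lsuc)
open import Algebra.Apartness.Bundles using (HeytingField)
open import Algebra.Bundles using (CommutativeRing; Semiring)
import Algebra.Definitions.RawMagma as RawMagmaDefinitions
import Algebra.Morphism.Construct.Composition as Composition
open import Algebra.Morphism.Structures using (IsSemiringHomomorphism)
import Algebra.Properties.Ring as RingProperties
import Algebra.Properties.Semiring.Exp as SemiringExp
import Algebra.Properties.Semiring.Sum as Sum
import Algebra.Solver.Ring.NaturalCoefficients.Default as SemiringSolver
open import Axiom.ExcludedMiddle using (ExcludedMiddle)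
open import Data.Fin.Base using (Fin; zero; suc)
import Data.Fin.Properties as Fin
open import Data.List.Base using (List; []; _∷_; _++_; filter; deduplicate; length)
open import Data.List.Membership.Propositional using (find; lose) renaming (_∈_ to _∈ˡ_)
open import Data.List.Membership.Propositional.Properties using (∈-filter⁺; ∈-filter⁻)
open import Data.List.Properties using (filter-accept; filter-reject)
open import Data.List.Relation.Unary.All as All using (All; []; _∷_)
import Data.List.Relation.Unary.All.Properties as All
open import Data.List.Relation.Unary.Any as Any using (Any; here; there)
import Data.List.Relation.Unary.Any.Properties as Any
open import Data.Nat.Base using (ℕ; zero; suc; _≤_; _<_; s≤s; z≤n; _≤′_; ≤′-refl; ≤′-step) renaming (_+_ to _+ᴺ_)
import Data.Nat.Properties as ℕ
open import Data.Product.Base using (Σ; ∃; ∃-syntax; _×_; _,_; proj₁; proj₂)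
open import Data.Sum.Base as ⊎ using (_⊎_; inj₁; inj₂)
open import Data.Unit.Base using (⊤; tt)
open import Data.Vec.Base as Vec using (Vec; []; _∷_)
open import Data.Vec.Functional as Vector using (Vector; tail)
open import Function.Base using (_∘_)
open import Relation.Binary.Core using (Rel)
import Relation.Binary.Definitions as Binary
open import Relation.Binary.Definitions using (tri<; tri≈; tri>)
open import Relation.Binary.PropositionalEquality.Core as ≡ using (_≡_)
import Relation.Binary.Reasoning.Setoid as SetoidReasoning
open import Relation.Nullary.Decidable.Core using (Dec; yes; no; decidable-stable; map′; ¬?)
open import Relation.Nullary.Negation.Core using (¬_; contradiction)
open import Relation.Unary using (Pred; Decidable; U; ⋂; _∈_; _∉_; _⊆_; _≐_; _∩_)

-- Homomorphisms and polynomial rings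

-- The variables w play the part of a generic point of X. An actual point would not do: over a
-- finite field a polynomial outside P_X can vanish at every point of X. The parameter t links two
-- specialisations. At t = 0 the substitution restricts a polynomial to X; at t = 1 and w = x it is
-- the identity, which brings membership in the extended ideal back to membership in J_{𝒜_X}. In
-- between, a form that vanishes on X is only multiplied by t, so the conditions defining the
-- residue ideal of 𝒜_X hold for each coefficient in t and w separately, and the denominator merely
-- shifts the degree in t. Forms that do not vanish on X behave differently, which is why the
-- argument is run for 𝒜_X. The inclusion of J_𝒜 in J_{𝒜_X} cannot be read off from forms either: a
-- form for g ∈ J_𝒜 only exhibits a multiple of g by linear forms not vanishing on X, and these have
-- to be cancelled.

Hom : ∀ {a ℓa b ℓb} (A : CommutativeRing a ℓa) (B : CommutativeRing b ℓb) →
      (CommutativeRing.Carrier A → CommutativeRing.Carrier B) → Set (a ⊔ ℓa ⊔ ℓb)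
Hom A B = IsSemiringHomomorphism (rawSemiring A) (rawSemiring B)
  where rawSemiring = λ {a ℓ} (R : CommutativeRing a ℓ) → Semiring.rawSemiring (CommutativeRing.semiring R)

module _ {a ℓa b ℓb} (A : CommutativeRing a ℓa) (B : CommutativeRing b ℓb) where

  private
    module A = CommutativeRing A
    module B = CommutativeRing B

  mkHom : ∀ {f : A.Carrier → B.Carrier} →
          (∀ {x y} → x A.≈ y → f x B.≈ f y) →
          (∀ x y → f (x A.+ y) B.≈ f x B.+ f y) → f A.0# B.≈ B.0# →
          (∀ x y → f (x A.* y) B.≈ f x B.* f y) → f A.1# B.≈ B.1# → Hom A B f
  mkHom cong +-homo 0-homo *-homo 1-homo = record
    { isNearSemiringHomomorphism = record
      { +-isMonoidHomomorphism = record
        { isMagmaHomomorphism = record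
          { isRelHomomorphism = record { cong = cong }
          ; homo = +-homo }
        ; ε-homo = 0-homo }
      ; *-homo = *-homo }
    ; 1#-homo = 1-homo }

  module HomProperties {f : A.Carrier → B.Carrier} (hom : Hom A B f) where

    open IsSemiringHomomorphism hom public using (+-homo; *-homo; 0#-homo; 1#-homo)
      renaming (⟦⟧-cong to cong)

    -‿homo : ∀ x → f (A.- x) B.≈ B.- f x
    -‿homo x = inverseˡ-unique _ _
      (B.trans (B.sym (+-homo (A.- x) x)) (B.trans (cong (A.-‿inverseˡ x)) 0#-homo))
      where open RingProperties B.ring using () renaming (+-inverseˡ-unique to inverseˡ-unique)

idHom : ∀ {a ℓ} (A : CommutativeRing a ℓ) → Hom A A (λ x → x)
idHom A = mkHom A A (λ e → e) (λ _ _ → refl) refl (λ _ _ → refl) refl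
  where open CommutativeRing A using (refl)

compHom : ∀ {a ℓa b ℓb c ℓc} (A : CommutativeRing a ℓa) (B : CommutativeRing b ℓb)
            (C : CommutativeRing c ℓc) {f g} → Hom A B f → Hom B C g → Hom A C (g ∘ f)
compHom A B C = Composition.isSemiringHomomorphism (CommutativeRing.trans C)

module IdealProperties {c ℓ p} (R : CommutativeRing c ℓ)
                       {I : Pred (CommutativeRing.Carrier R) p}
                       (ideal : IdealTheory.IsIdeal R I) where

  open CommutativeRing R
  open IdealTheory.IsIdeal ideal
  open RingProperties ring using (-1*x≈-x)

  -‿closed : ∀ {x} → x ∈ I → - x ∈ I
  -‿closed x∈I = resp (-1*x≈-x _) (*-closed (- 1#) x∈I)

  *-closedʳ : ∀ r {x} → x ∈ I → x * r ∈ I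
  *-closedʳ r x∈I = resp (*-comm r _) (*-closed r x∈I)

  +-cancelˡ : ∀ {x y} → x + y ∈ I → x ∈ I → y ∈ I
  +-cancelˡ {x} {y} x+y∈I x∈I = resp (begin
    - x + (x + y)  ≈⟨ +-assoc (- x) x y ⟨
    (- x + x) + y  ≈⟨ +-congʳ (-‿inverseˡ x) ⟩
    0# + y         ≈⟨ +-identityˡ y ⟩
    y              ∎) (+-closed (-‿closed x∈I) x+y∈I)
    where open SetoidReasoning setoid

module PolynomialProperties {c ℓ} (R : CommutativeRing c ℓ) where

  private
    module R = CommutativeRing R
  open R using (_≈_; 0#; 1#)

  R[X] : CommutativeRing c ℓ
  R[X] = Polynomial.commutativeRing R

  open Polynomial R
  private module P = CommutativeRing R[X]

  coeff-⊕ : ∀ p q k → coeff (p ⊕ q) k ≈ coeff p k R.+ coeff q k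
  coeff-⊕ []      q       k       = R.sym (R.+-identityˡ _)
  coeff-⊕ (a ∷ p) []      k       = R.sym (R.+-identityʳ _)
  coeff-⊕ (a ∷ p) (b ∷ q) zero    = R.refl
  coeff-⊕ (a ∷ p) (b ∷ q) (suc k) = coeff-⊕ p q k

  coeff-scale : ∀ a p k → coeff (scale a p) k ≈ a R.* coeff p k
  coeff-scale a []      k       = R.sym (R.zeroʳ a)
  coeff-scale a (b ∷ p) zero    = R.refl
  coeff-scale a (b ∷ p) (suc k) = coeff-scale a p k

  coeff-shift[] : ∀ k → coeff (shift []) k ≈ 0#
  coeff-shift[] zero    = R.refl
  coeff-shift[] (suc k) = R.refl

  C : R.Carrier → P.Carrier
  C a = a ∷ []

  X : P.Carrier
  X = 0# ∷ 1# ∷ []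

  coeff-C⊗ : ∀ a p k → coeff (C a ⊗ p) k ≈ a R.* coeff p k
  coeff-C⊗ a p k = R.trans (coeff-⊕ (scale a p) (shift []) k)
    (R.trans (R.+-cong (coeff-scale a p k) (coeff-shift[] k)) (R.+-identityʳ _))

  X⊗ : ∀ p → X ⊗ p ≋ shift p
  X⊗ p = coeffs λ
    { zero    → R.trans (coeff-⊕ (scale 0# p) _ 0)
                  (R.trans (R.+-identityʳ _) (R.trans (coeff-scale 0# p 0) (R.zeroˡ _)))
    ; (suc k) → R.trans (coeff-⊕ (scale 0# p) _ (suc k))
                  (R.trans (R.+-cong (R.trans (coeff-scale 0# p _) (R.zeroˡ _)) (coeff-C⊗ 1# p k))
                    (R.trans (R.+-identityˡ _) (R.*-identityˡ _))) }

  ∷-cong : ∀ {a b p q} → a ≈ b → p ≋ q → a ∷ p ≋ b ∷ q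
  ∷-cong e f = coeffs λ { zero → e ; (suc k) → coeff-≈ f k }

  ∷-cong-[] : ∀ {a p} → a ≈ 0# → p ≋ [] → a ∷ p ≋ []
  ∷-cong-[] e f = coeffs λ { zero → e ; (suc k) → coeff-≈ f k }

  tail-≋ : ∀ {a b p q} → a ∷ p ≋ b ∷ q → p ≋ q
  tail-≋ e = coeffs λ k → coeff-≈ e (suc k)

  tail-≋-[] : ∀ {a p} → a ∷ p ≋ [] → p ≋ []
  tail-≋-[] e = coeffs λ k → coeff-≈ e (suc k)

  ∷≋C⊕X⊗ : ∀ a p → a ∷ p ≋ C a ⊕ X ⊗ p
  ∷≋C⊕X⊗ a p = P.sym (P.trans (P.+-congˡ {C a} (X⊗ p)) (∷-cong (R.+-identityʳ a) P.refl))

  ⊗-∷ : ∀ p b q → p ⊗ (b ∷ q) ≋ C b ⊗ p ⊕ shift (p ⊗ q)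
  ⊗-∷ p b q = begin
    p ⊗ (b ∷ q)              ≈⟨ P.*-congˡ {p} (∷≋C⊕X⊗ b q) ⟩
    p ⊗ (C b ⊕ X ⊗ q)        ≈⟨ solve 4 (λ p c x q → p :* (c :+ x :* q) := c :* p :+ x :* (p :* q))
                                  P.refl p (C b) X q ⟩
    C b ⊗ p ⊕ X ⊗ (p ⊗ q)    ≈⟨ P.+-congˡ {C b ⊗ p} (X⊗ (p ⊗ q)) ⟩
    C b ⊗ p ⊕ shift (p ⊗ q)  ∎
    where
    open SetoidReasoning P.setoid
    open SemiringSolver P.commutativeSemiring

  C-hom : Hom R R[X] C
  C-hom = mkHom R R[X] (λ e → ∷-cong e P.refl) (λ _ _ → P.refl) (∷-cong-[] R.refl P.refl)
    (λ a b → ∷-cong (R.sym (R.+-identityʳ _)) P.refl) P.refl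

  coeff₀-hom : Hom R[X] R (λ p → coeff p 0)
  coeff₀-hom = mkHom R[X] R (λ e → coeff-≈ e 0) (λ p q → coeff-⊕ p q 0) R.refl coeff₀-⊗ R.refl
    where
    coeff₀-⊗ : ∀ p q → coeff (p ⊗ q) 0 ≈ coeff p 0 R.* coeff q 0
    coeff₀-⊗ []      q = R.sym (R.zeroˡ _)
    coeff₀-⊗ (a ∷ p) q = R.trans (coeff-⊕ (scale a q) _ 0)
      (R.trans (R.+-identityʳ _) (coeff-scale a q 0))

  module _ {p} {I : Pred R.Carrier p} (ideal : IdealTheory.IsIdeal R I) where

    open IdealTheory.IsIdeal ideal
    open IdealProperties R ideal

    -- The extended ideal I R[X], given by a condition on coefficients: membership is tested in one
    -- degree at a time, and no expression in generators has to be chosen.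
    Coefficients : Pred P.Carrier p
    Coefficients f = ∀ k → coeff f k ∈ I

    coefficients-isIdeal : IdealTheory.IsIdeal R[X] Coefficients
    coefficients-isIdeal = record
      { resp     = λ e f∈ k → resp (coeff-≈ e k) (f∈ k)
      ; 0∈       = λ _ → 0∈
      ; +-closed = λ {f} {g} f∈ g∈ k → resp (R.sym (coeff-⊕ f g k)) (+-closed (f∈ k) (g∈ k))
      ; *-closed = closed }
      where
      closed : ∀ r {f} → f ∈ Coefficients → r ⊗ f ∈ Coefficients
      closed []      f∈ k = 0∈
      closed (a ∷ r) {f} f∈ k = resp (R.sym (coeff-⊕ (scale a f) _ k))
        (+-closed (resp (R.sym (coeff-scale a f k)) (*-closed a (f∈ k)))
          (shifted k))
        where
        shifted : ∀ k → coeff (shift (r ⊗ f)) k ∈ I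
        shifted zero    = 0∈
        shifted (suc k) = closed r f∈ k

NonZeroDivisorMod : ∀ {c ℓ p} (R : CommutativeRing c ℓ) →
                    Pred (CommutativeRing.Carrier R) p → Pred (CommutativeRing.Carrier R) (c ⊔ p)
NonZeroDivisorMod R I a = ∀ b → a * b ∈ I → b ∈ I
  where open CommutativeRing R using (_*_)

module _ {c ℓ p} (R : CommutativeRing c ℓ) {I : Pred (CommutativeRing.Carrier R) p}
         (ideal : IdealTheory.IsIdeal R I) where

  private module R = CommutativeRing R
  open PolynomialProperties R
  open Polynomial R
  open IdealTheory.IsIdeal ideal
  open IdealProperties R ideal

  -- The coefficients of b are put into I one after the other, from the constant term up.
  coeff₀-nonZeroDivisor : ∀ f → NonZeroDivisorMod R I (coeff f 0) →
                          NonZeroDivisorMod R[X] (Coefficients ideal) f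
  coeff₀-nonZeroDivisor f nzd []      fb∈ k = 0∈
  coeff₀-nonZeroDivisor f nzd (b ∷ q) fb∈ = λ { zero → b∈ ; (suc k) → q∈ k }
    where
    fb : ∀ k → coeff (f ⊗ (b ∷ q)) k R.≈ b R.* coeff f k R.+ coeff (shift (f ⊗ q)) k
    fb k = R.trans (coeff-≈ (⊗-∷ f b q) k)
      (R.trans (coeff-⊕ (C b ⊗ f) _ k) (R.+-congʳ (coeff-C⊗ b f k)))
    b∈ : b ∈ I
    b∈ = nzd b (resp (R.trans (fb 0) (R.trans (R.+-identityʳ _) (R.*-comm _ _))) (fb∈ 0))
    q∈ : q ∈ Coefficients ideal
    q∈ = coeff₀-nonZeroDivisor f nzd q λ k →
      +-cancelˡ (resp (fb (suc k)) (fb∈ (suc k))) (*-closedʳ (coeff f (suc k)) b∈)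

  shift-nonZeroDivisor : ∀ f → NonZeroDivisorMod R[X] (Coefficients ideal) f →
                         NonZeroDivisorMod R[X] (Coefficients ideal) (shift f)
  shift-nonZeroDivisor f nzd b fb∈ = nzd b λ k →
    resp (coeff-≈ shift-⊗ (suc k)) (fb∈ (suc k))
    where
    module P = CommutativeRing R[X]
    shift-⊗ : shift f ⊗ b ≋ shift (f ⊗ b)
    shift-⊗ = P.trans (P.*-congʳ {b} (P.sym (X⊗ f))) (P.trans (P.*-assoc X f b) (X⊗ (f ⊗ b)))

-- Evaluation homomorphisms and their uniqueness

module Evaluation {a ℓa b ℓb} (A : CommutativeRing a ℓa) (B : CommutativeRing b ℓb)
                  {f : CommutativeRing.Carrier A → CommutativeRing.Carrier B} (hom : Hom A B f)
                  (x : CommutativeRing.Carrier B) where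

  private
    module A = CommutativeRing A
    module B = CommutativeRing B
    module f = HomProperties A B hom
  open PolynomialProperties A
  open Polynomial A
  open SetoidReasoning B.setoid
  open SemiringSolver B.commutativeSemiring

  eval : List A.Carrier → B.Carrier
  eval []      = B.0#
  eval (a ∷ p) = f a B.+ x B.* eval p

  private
    eval-≋[] : ∀ p → p ≋ [] → eval p B.≈ B.0#
    eval-≋[] []      e = B.refl
    eval-≋[] (a ∷ p) e = begin
      f a B.+ x B.* eval p  ≈⟨ B.+-cong (f.cong (coeff-≈ e 0)) (B.*-congˡ (eval-≋[] p (tail-≋-[] e))) ⟩
      f A.0# B.+ x B.* B.0# ≈⟨ B.+-cong f.0#-homo (B.zeroʳ x) ⟩
      B.0# B.+ B.0#         ≈⟨ B.+-identityˡ _ ⟩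
      B.0#                  ∎

    eval-cong : ∀ p q → p ≋ q → eval p B.≈ eval q
    eval-cong []      q       e = B.sym (eval-≋[] q (CommutativeRing.sym R[X] e))
    eval-cong (a ∷ p) []      e = eval-≋[] (a ∷ p) e
    eval-cong (a ∷ p) (b ∷ q) e =
      B.+-cong (f.cong (coeff-≈ e 0)) (B.*-congˡ (eval-cong p q (tail-≋ e)))

    eval-⊕ : ∀ p q → eval (p ⊕ q) B.≈ eval p B.+ eval q
    eval-⊕ []      q       = B.sym (B.+-identityˡ _)
    eval-⊕ (a ∷ p) []      = B.sym (B.+-identityʳ _)
    eval-⊕ (a ∷ p) (b ∷ q) = begin
      f (a A.+ b) B.+ x B.* eval (p ⊕ q)
        ≈⟨ B.+-cong (f.+-homo a b) (B.*-congˡ (eval-⊕ p q)) ⟩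
      f a B.+ f b B.+ x B.* (eval p B.+ eval q)
        ≈⟨ solve 5 (λ a b x p q → a :+ b :+ x :* (p :+ q) := (a :+ x :* p) :+ (b :+ x :* q))
             B.refl (f a) (f b) x (eval p) (eval q) ⟩
      (f a B.+ x B.* eval p) B.+ (f b B.+ x B.* eval q) ∎

    eval-scale : ∀ a p → eval (scale a p) B.≈ f a B.* eval p
    eval-scale a []      = B.sym (B.zeroʳ _)
    eval-scale a (b ∷ p) = begin
      f (a A.* b) B.+ x B.* eval (scale a p)
        ≈⟨ B.+-cong (f.*-homo a b) (B.*-congˡ (eval-scale a p)) ⟩
      f a B.* f b B.+ x B.* (f a B.* eval p)
        ≈⟨ solve 4 (λ a b x p → a :* b :+ x :* (a :* p) := a :* (b :+ x :* p))
             B.refl (f a) (f b) x (eval p) ⟩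
      f a B.* (f b B.+ x B.* eval p) ∎

    eval-⊗ : ∀ p q → eval (p ⊗ q) B.≈ eval p B.* eval q
    eval-⊗ []      q = B.sym (B.zeroˡ _)
    eval-⊗ (a ∷ p) q = begin
      eval (scale a q ⊕ shift (p ⊗ q))
        ≈⟨ eval-⊕ (scale a q) (shift (p ⊗ q)) ⟩
      eval (scale a q) B.+ (f A.0# B.+ x B.* eval (p ⊗ q))
        ≈⟨ B.+-cong (eval-scale a q) (B.+-cong f.0#-homo (B.*-congˡ (eval-⊗ p q))) ⟩
      f a B.* eval q B.+ (B.0# B.+ x B.* (eval p B.* eval q))
        ≈⟨ solve 4 (λ a x p q → a :* q :+ (con 0 :+ x :* (p :* q)) := (a :+ x :* p) :* q)
             B.refl (f a) x (eval p) (eval q) ⟩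
      (f a B.+ x B.* eval p) B.* eval q ∎

  eval-C : ∀ a → eval (C a) B.≈ f a
  eval-C a = B.trans (B.+-congˡ (B.zeroʳ x)) (B.+-identityʳ _)

  eval-hom : Hom R[X] B eval
  eval-hom = mkHom R[X] B (eval-cong _ _) eval-⊕ B.refl eval-⊗
    (B.trans (eval-C A.1#) f.1#-homo)

  eval-X : eval X B.≈ x
  eval-X = begin
    f A.0# B.+ x B.* eval (C A.1#)  ≈⟨ B.+-cong f.0#-homo (B.*-congˡ (B.trans (eval-C A.1#) f.1#-homo)) ⟩
    B.0# B.+ x B.* B.1#             ≈⟨ B.trans (B.+-identityˡ _) (B.*-identityʳ _) ⟩
    x                               ∎

module MultiEvaluation {a ℓa b ℓb} (A : CommutativeRing a ℓa) (B : CommutativeRing b ℓb)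
                       {f : CommutativeRing.Carrier A → CommutativeRing.Carrier B}
                       (hom : Hom A B f) where

  private
    module B = CommutativeRing B
  open CommutativeRing using (Carrier)

  evaluate : ∀ n → Vector B.Carrier n → Carrier (polynomialRing A n) → B.Carrier
  evaluate-hom : ∀ n x → Hom (polynomialRing A n) B (evaluate n x)

  evaluate zero    x = f
  evaluate (suc n) x = Evaluation.eval (polynomialRing A n) B (evaluate-hom n (x ∘ suc)) (x zero)

  evaluate-hom zero    x = hom
  evaluate-hom (suc n) x = Evaluation.eval-hom (polynomialRing A n) B (evaluate-hom n (x ∘ suc)) (x zero)

  evaluate-constant : ∀ n x a → evaluate n x (constant A n a) B.≈ f a
  evaluate-constant zero    x a = B.refl
  evaluate-constant (suc n) x a =
    B.trans (Evaluation.eval-C (polynomialRing A n) B (evaluate-hom n (x ∘ suc)) (x zero) _) (evaluate-constant n (x ∘ suc) a)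

  evaluate-var : ∀ n x i → evaluate n x (var A n i) B.≈ x i
  evaluate-var (suc n) x zero    = Evaluation.eval-X (polynomialRing A n) B (evaluate-hom n (x ∘ suc)) (x zero)
  evaluate-var (suc n) x (suc i) =
    B.trans (Evaluation.eval-C (polynomialRing A n) B (evaluate-hom n (x ∘ suc)) (x zero) _) (evaluate-var n (x ∘ suc) i)

constant-hom : ∀ {a ℓ} (A : CommutativeRing a ℓ) n → Hom A (polynomialRing A n) (constant A n)
constant-hom A zero    = idHom A
constant-hom A (suc n) = compHom A (polynomialRing A n) (polynomialRing A (suc n)) (constant-hom A n)
  (PolynomialProperties.C-hom (polynomialRing A n))

-- `hom-unique` is needed for two relations: equality, to identify homomorphisms, and equality up to
-- a member of an ideal, to compare a substitution with the identity modulo that ideal.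
record IsCongruence {b ℓb r} (B : CommutativeRing b ℓb)
                    (_∼_ : Rel (CommutativeRing.Carrier B) r) : Set (b ⊔ ℓb ⊔ r) where
  open CommutativeRing B using (_≈_; _+_; _*_)
  field
    reflexive : ∀ {x y} → x ≈ y → x ∼ y
    trans     : ∀ {x y z} → x ∼ y → y ∼ z → x ∼ z
    +-cong    : ∀ {x y u v} → x ∼ y → u ∼ v → (x + u) ∼ (y + v)
    *-cong    : ∀ {x y u v} → x ∼ y → u ∼ v → (x * u) ∼ (y * v)

≈-isCongruence : ∀ {b ℓb} (B : CommutativeRing b ℓb) → IsCongruence B (CommutativeRing._≈_ B)
≈-isCongruence B = record { reflexive = λ e → e ; trans = trans ; +-cong = +-cong ; *-cong = *-cong }
  where open CommutativeRing B

module _ {a ℓa b ℓb r} (A : CommutativeRing a ℓa) (B : CommutativeRing b ℓb)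
         {_∼_ : Rel (CommutativeRing.Carrier B) r} (congruence : IsCongruence B _∼_) where

  private module B = CommutativeRing B
  open IsCongruence congruence

  hom-unique : ∀ n {f g} → Hom (polynomialRing A n) B f → Hom (polynomialRing A n) B g →
               (∀ a → f (constant A n a) ∼ g (constant A n a)) →
               (∀ i → f (var A n i) ∼ g (var A n i)) → ∀ p → f p ∼ g p
  hom-unique zero    f-hom g-hom f∼g-const f∼g-var p = f∼g-const p
  hom-unique (suc n) {f} {g} f-hom g-hom f∼g-const f∼g-var = go
    where
    open PolynomialProperties (polynomialRing A n)
    module f = HomProperties R[X] B f-hom
    module g = HomProperties R[X] B g-hom
    go : ∀ p → f p ∼ g p
    go []      = reflexive (B.trans f.0#-homo (B.sym g.0#-homo))
    go (a ∷ p) = trans (reflexive (split f-hom))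
      (trans (+-cong (hom-unique n (compHom (polynomialRing A n) R[X] B C-hom f-hom)
                          (compHom (polynomialRing A n) R[X] B C-hom g-hom) f∼g-const (λ i → f∼g-var (suc i)) a)
                       (*-cong (f∼g-var zero) (go p)))
        (reflexive (B.sym (split g-hom))))
      where
      split : ∀ {h} → Hom R[X] B h → h (a ∷ p) B.≈ h (C a) B.+ h X B.* h p
      split h-hom = B.trans (h.cong (∷≋C⊕X⊗ a p)) (B.trans (h.+-homo _ _) (B.+-congˡ (h.*-homo _ _)))
        where module h = HomProperties R[X] B h-hom

-- Coefficients in several variables and extended ideals

module MultiCoefficients {c ℓ} (R : CommutativeRing c ℓ) where

  private module R = CommutativeRing R
  open CommutativeRing using (Carrier)

  -- The exponent of the outermost variable comes first, so for the ring S[w][t] below the head of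
  -- the vector is the exponent of t.
  mcoeff : ∀ n → Vec ℕ n → Carrier (polynomialRing R n) → R.Carrier
  mcoeff zero    []      p = p
  mcoeff (suc n) (k ∷ e) p = mcoeff n e (Polynomial.coeff (polynomialRing R n) p k)

  mcoeff-cong : ∀ n e {p q} → CommutativeRing._≈_ (polynomialRing R n) p q →
                mcoeff n e p R.≈ mcoeff n e q
  mcoeff-cong zero    []      p≈q = p≈q
  mcoeff-cong (suc n) (k ∷ e) p≈q = mcoeff-cong n e (Polynomial.coeff-≈ p≈q k)

  mcoeff-+ : ∀ n e p q → mcoeff n e (CommutativeRing._+_ (polynomialRing R n) p q)
                         R.≈ mcoeff n e p R.+ mcoeff n e q
  mcoeff-+ zero    []      p q = R.refl
  mcoeff-+ (suc n) (k ∷ e) p q = R.trans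
    (mcoeff-cong n e (PolynomialProperties.coeff-⊕ (polynomialRing R n) p q k)) (mcoeff-+ n e _ _)

  mcoeff-constant* : ∀ n e a p → mcoeff n e (CommutativeRing._*_ (polynomialRing R n) (constant R n a) p)
                                 R.≈ a R.* mcoeff n e p
  mcoeff-constant* zero    []      a p = R.refl
  mcoeff-constant* (suc n) (k ∷ e) a p = R.trans
    (mcoeff-cong n e (PolynomialProperties.coeff-C⊗ (polynomialRing R n) (constant R n a) p k))
    (mcoeff-constant* n e a _)

  module _ {p} {I : Pred R.Carrier p} (ideal : IdealTheory.IsIdeal R I) where

    -- The extension of I to n variables. It is mutual with `extension-isIdeal` because
    -- `Coefficients` takes the proof that the previous stage is an ideal.
    Extension : ∀ n → Pred (Carrier (polynomialRing R n)) p
    extension-isIdeal : ∀ n → IdealTheory.IsIdeal (polynomialRing R n) (Extension n)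

    Extension zero    = I
    Extension (suc n) = PolynomialProperties.Coefficients (polynomialRing R n) (extension-isIdeal n)

    extension-isIdeal zero    = ideal
    extension-isIdeal (suc n) =
      PolynomialProperties.coefficients-isIdeal (polynomialRing R n) (extension-isIdeal n)

    mcoeff∈⇒∈Extension : ∀ n {p} → (∀ e → mcoeff n e p ∈ I) → p ∈ Extension n
    mcoeff∈⇒∈Extension zero    p∈ = p∈ []
    mcoeff∈⇒∈Extension (suc n) p∈ k = mcoeff∈⇒∈Extension n λ e → p∈ (k ∷ e)

    module _ {b ℓb q} {B : CommutativeRing b ℓb} {f : R.Carrier → Carrier B} (hom : Hom R B f)
             {J : Pred (Carrier B) q} (J-ideal : IdealTheory.IsIdeal B J)
             (f∈ : ∀ {a} → a ∈ I → f a ∈ J) where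

      open MultiEvaluation R B hom
      open IdealTheory.IsIdeal J-ideal

      evaluate∈ : ∀ n x p → p ∈ Extension n → evaluate n x p ∈ J
      evaluate∈ zero    x p       p∈ = f∈ p∈
      evaluate∈ (suc n) x []      p∈ = 0∈
      evaluate∈ (suc n) x (a ∷ p) p∈ = +-closed (evaluate∈ n (x ∘ suc) a (p∈ 0))
        (*-closed (x zero) (evaluate∈ (suc n) x p λ k → p∈ (suc k)))

module CoefficientMap {a ℓa b ℓb} (A : CommutativeRing a ℓa) (B : CommutativeRing b ℓb)
                      {f : CommutativeRing.Carrier A → CommutativeRing.Carrier B}
                      (hom : Hom A B f) where

  open CommutativeRing using (Carrier; _≈_; 0#)

  -- An evaluation at the variable instead of a `map` over the list, so that the homomorphism laws
  -- come from `eval-hom`; `mapCoeff-∷` recovers the description by coefficients.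
  mapCoeff : ∀ n → Carrier (polynomialRing A n) → Carrier (polynomialRing B n)
  mapCoeff-hom : ∀ n → Hom (polynomialRing A n) (polynomialRing B n) (mapCoeff n)

  private
    C∘mapCoeff-hom : ∀ n → Hom (polynomialRing A n) (polynomialRing B (suc n)) (λ p → mapCoeff n p ∷ [])

  mapCoeff zero    = f
  mapCoeff (suc n) = Evaluation.eval (polynomialRing A n) (polynomialRing B (suc n)) (C∘mapCoeff-hom n)
    (PolynomialProperties.X (polynomialRing B n))

  mapCoeff-hom zero    = hom
  mapCoeff-hom (suc n) = Evaluation.eval-hom (polynomialRing A n) (polynomialRing B (suc n)) (C∘mapCoeff-hom n)
    (PolynomialProperties.X (polynomialRing B n))

  C∘mapCoeff-hom n = compHom (polynomialRing A n) (polynomialRing B n) (polynomialRing B (suc n)) (mapCoeff-hom n)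
    (PolynomialProperties.C-hom (polynomialRing B n))

  mapCoeff-∷ : ∀ n a p → _≈_ (polynomialRing B (suc n)) (mapCoeff (suc n) (a ∷ p))
                             (mapCoeff n a ∷ mapCoeff (suc n) p)
  mapCoeff-∷ n a p = P.sym (∷≋C⊕X⊗ (mapCoeff n a) (mapCoeff (suc n) p))
    where
    open PolynomialProperties (polynomialRing B n)
    module P = CommutativeRing R[X]

  mapCoeff-constant : ∀ n a → _≈_ (polynomialRing B n) (mapCoeff n (constant A n a)) (constant B n (f a))
  mapCoeff-constant zero    a = CommutativeRing.refl B
  mapCoeff-constant (suc n) a = CommutativeRing.trans (polynomialRing B (suc n)) (mapCoeff-∷ n _ [])
    (∷-cong (mapCoeff-constant n a) (CommutativeRing.refl (polynomialRing B (suc n))))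
    where open PolynomialProperties (polynomialRing B n)

  mapCoeff-var : ∀ n i → _≈_ (polynomialRing B n) (mapCoeff n (var A n i)) (var B n i)
  mapCoeff-var (suc n) zero    = Evaluation.eval-X (polynomialRing A n) (polynomialRing B (suc n)) (C∘mapCoeff-hom n)
    (PolynomialProperties.X (polynomialRing B n))
  mapCoeff-var (suc n) (suc i) = CommutativeRing.trans (polynomialRing B (suc n)) (mapCoeff-∷ n _ [])
    (∷-cong (mapCoeff-var n i) (CommutativeRing.refl (polynomialRing B (suc n))))
    where open PolynomialProperties (polynomialRing B n)

  module _ {q} {I : Pred (Carrier B) q} (ideal : IdealTheory.IsIdeal B I)
           (decide : (P : Set ℓa) → Dec P)
           (f-nonZeroDivisor : ∀ a → ¬ (_≈_ A a (0# A)) → NonZeroDivisorMod B I (f a)) where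

    open MultiCoefficients B

    -- The lowest non-zero coefficient decides. If the constant term is non-zero, induction on the
    -- number of variables and `coeff₀-nonZeroDivisor` apply; if it is zero, the polynomial is the
    -- variable times its tail, and multiplying by the variable only shifts coefficients.
    mapCoeff-nonZeroDivisor : ∀ n p → ¬ (_≈_ (polynomialRing A n) p (0# (polynomialRing A n))) →
                              NonZeroDivisorMod (polynomialRing B n) (Extension ideal n) (mapCoeff n p)
    mapCoeff-nonZeroDivisor zero    p       p≉0 = f-nonZeroDivisor p p≉0
    mapCoeff-nonZeroDivisor (suc n) []      p≉0 =
      contradiction (CommutativeRing.refl (polynomialRing A (suc n)) {[]}) p≉0
    mapCoeff-nonZeroDivisor (suc n) (a ∷ p) p≉0 = resp-nzd (split (decide _))
      where
      open PolynomialProperties (polynomialRing B n)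
      module P = CommutativeRing R[X]
      module A[X] = PolynomialProperties (polynomialRing A n)
      module Iₙ = IdealTheory.IsIdeal (extension-isIdeal ideal (suc n))
      resp-nzd : NonZeroDivisorMod R[X] (Extension ideal (suc n)) (mapCoeff n a ∷ mapCoeff (suc n) p) →
                 NonZeroDivisorMod R[X] (Extension ideal (suc n)) (mapCoeff (suc n) (a ∷ p))
      resp-nzd nzd b ab∈ = nzd b (Iₙ.resp (P.*-congʳ {b} {mapCoeff (suc n) (a ∷ p)} (mapCoeff-∷ n a p)) ab∈)
      split : Dec (_≈_ (polynomialRing A n) a (0# (polynomialRing A n))) →
              NonZeroDivisorMod R[X] (Extension ideal (suc n)) (mapCoeff n a ∷ mapCoeff (suc n) p)
      split (no a≉0) = coeff₀-nonZeroDivisor (polynomialRing B n) (extension-isIdeal ideal n)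
        (mapCoeff n a ∷ mapCoeff (suc n) p) (mapCoeff-nonZeroDivisor n a a≉0)
      split (yes a≈0) b ab∈ = shift-nonZeroDivisor (polynomialRing B n) (extension-isIdeal ideal n)
        (mapCoeff (suc n) p)
        (mapCoeff-nonZeroDivisor (suc n) p λ p≈0 → p≉0 (A[X].∷-cong-[] a≈0 p≈0))
        b (Iₙ.resp (P.*-congʳ {b} {mapCoeff n a ∷ mapCoeff (suc n) p}
          (∷-cong (Bₙ.trans (m.cong a≈0) m.0#-homo) P.refl)) ab∈)
        where
        module Bₙ = CommutativeRing (polynomialRing B n)
        module m = HomProperties (polynomialRing A n) (polynomialRing B n) (mapCoeff-hom n)

-- Linear algebra

module FiniteSum {c ℓ} (R : CommutativeRing c ℓ) where

  open CommutativeRing R hiding (zero)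
  open Sum semiring

  δ : ∀ {n} → Fin n → Fin n → Carrier
  δ zero    zero    = 1#
  δ zero    (suc j) = 0#
  δ (suc i) zero    = 0#
  δ (suc i) (suc j) = δ i j

  δ-refl : ∀ {n} (i : Fin n) → δ i i ≈ 1#
  δ-refl zero    = refl
  δ-refl (suc i) = δ-refl i

  sum-cong : ∀ {n} (x y : Vector Carrier n) → (∀ i → x i ≈ y i) → sum x ≈ sum y
  sum-cong x y = sum-cong-≋ {x = x} {y}

  δ-sym : ∀ {n} (i j : Fin n) → δ i j ≈ δ j i
  δ-sym zero    zero    = refl
  δ-sym zero    (suc j) = refl
  δ-sym (suc i) zero    = refl
  δ-sym (suc i) (suc j) = δ-sym i j

  sum-zero : ∀ {n} (x : Vector Carrier n) → (∀ i → x i ≈ 0#) → sum x ≈ 0#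
  sum-zero {n} x x≈0 = trans (sum-cong x (λ _ → 0#) x≈0) (sum-replicate-zero n)

  sum-δ : ∀ {n} (a : Vector Carrier n) j → sum (λ i → a i * δ i j) ≈ a j
  sum-δ a zero    = trans (+-cong (*-identityʳ _) (sum-zero (λ i → a (suc i) * 0#) λ i → zeroʳ _))
    (+-identityʳ _)
  sum-δ a (suc j) = trans (+-cong (zeroʳ _) (sum-δ (tail a) j)) (+-identityˡ _)

module _ {a ℓa b ℓb} (A : CommutativeRing a ℓa) (B : CommutativeRing b ℓb) {f} (f-hom : Hom A B f) where

  private
    module A = FiniteSum A
    module B = FiniteSum B
    module f = HomProperties A B f-hom

  hom-δ : ∀ {n} (i j : Fin n) → CommutativeRing._≈_ B (f (A.δ i j)) (B.δ i j)
  hom-δ zero    zero    = f.1#-homo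
  hom-δ zero    (suc j) = f.0#-homo
  hom-δ (suc i) zero    = f.0#-homo
  hom-δ (suc i) (suc j) = hom-δ i j

module LinearCombination {a ℓa b ℓb} (A : CommutativeRing a ℓa) (B : CommutativeRing b ℓb)
                         {κ : CommutativeRing.Carrier A → CommutativeRing.Carrier B}
                         (κ-hom : Hom A B κ) where

  private
    module A = CommutativeRing A
    module B = CommutativeRing B
    module κ = HomProperties A B κ-hom
    module ΣA = Sum A.semiring
  open B hiding (zero)
  open Sum B.semiring
  open FiniteSum B using (sum-cong; sum-zero)
  open SetoidReasoning B.setoid

  -- Scalars and values lie in different rings joined by κ, so that the same rules serve the pairing
  -- `⟨ α , v ⟩`, the forms `linear α` and their images in extensions of S.
  combination : ∀ {n} → Vector A.Carrier n → Vector B.Carrier n → B.Carrier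
  combination α x = sum λ i → κ (α i) * x i

  combination-congˡ : ∀ {n} {α β : Vector A.Carrier n} x → (∀ i → α i A.≈ β i) →
                      combination α x ≈ combination β x
  combination-congˡ {α = α} {β} x e = sum-cong (λ i → κ (α i) * x i) (λ i → κ (β i) * x i) λ i → *-congʳ (κ.cong (e i))

  combination-congʳ : ∀ {n} (α : Vector A.Carrier n) {x y} → (∀ i → x i ≈ y i) →
                      combination α x ≈ combination α y
  combination-congʳ α {x} {y} e = sum-cong (λ i → κ (α i) * x i) (λ i → κ (α i) * y i) λ i → *-congˡ (e i)

  combination-+ʳ : ∀ {n} (α : Vector A.Carrier n) x y →
                   combination α (λ i → x i + y i) ≈ combination α x + combination α y
  combination-+ʳ α x y = trans
    (sum-cong (λ i → κ (α i) * (x i + y i)) (λ i → κ (α i) * x i + κ (α i) * y i)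
      λ i → distribˡ (κ (α i)) (x i) (y i))
    (∑-distrib-+ (λ i → κ (α i) * x i) (λ i → κ (α i) * y i))

  combination-*ʳ : ∀ {n} (α : Vector A.Carrier n) c x →
                   combination α (λ i → c * x i) ≈ c * combination α x
  combination-*ʳ α c x = trans
    (sum-cong (λ i → κ (α i) * (c * x i)) (λ i → c * (κ (α i) * x i))
      λ i → solve 3 (λ α c x → α :* (c :* x) := c :* (α :* x)) refl (κ (α i)) c (x i))
    (sym (*-distribˡ-sum c (λ i → κ (α i) * x i)))
    where open SemiringSolver commutativeSemiring

  combination-‿ʳ : ∀ {n} (α : Vector A.Carrier n) x →
                   combination α (λ i → - x i) ≈ - combination α x
  combination-‿ʳ α x = begin
    combination α (λ i → - x i)       ≈⟨ combination-congʳ α (λ i → sym (-1*x≈-x (x i))) ⟩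
    combination α (λ i → - 1# * x i)  ≈⟨ combination-*ʳ α (- 1#) x ⟩
    - 1# * combination α x            ≈⟨ -1*x≈-x _ ⟩
    - combination α x                 ∎
    where open RingProperties ring using (-1*x≈-x)

  combination-+ˡ : ∀ {n} (α β : Vector A.Carrier n) x →
                   combination (λ i → α i A.+ β i) x ≈ combination α x + combination β x
  combination-+ˡ α β x = trans
    (sum-cong (λ i → κ (α i A.+ β i) * x i) (λ i → κ (α i) * x i + κ (β i) * x i)
      λ i → trans (*-congʳ (κ.+-homo (α i) (β i))) (distribʳ (x i) (κ (α i)) (κ (β i))))
    (∑-distrib-+ (λ i → κ (α i) * x i) (λ i → κ (β i) * x i))

  combination-*ˡ : ∀ {n} c (α : Vector A.Carrier n) x →
                   combination (λ i → c A.* α i) x ≈ κ c * combination α x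
  combination-*ˡ c α x = trans
    (sum-cong (λ i → κ (c A.* α i) * x i) (λ i → κ c * (κ (α i) * x i))
      λ i → trans (*-congʳ (κ.*-homo c (α i))) (*-assoc (κ c) (κ (α i)) (x i)))
    (sym (*-distribˡ-sum (κ c) (λ i → κ (α i) * x i)))

  combination-0ˡ : ∀ {n} x → combination {n} (λ _ → A.0#) x ≈ 0#
  combination-0ˡ x = sum-zero (λ i → κ A.0# * x i) λ i → trans (*-congʳ κ.0#-homo) (zeroˡ (x i))

  combination-0ʳ : ∀ {n} (α : Vector A.Carrier n) → combination α (λ _ → 0#) ≈ 0#
  combination-0ʳ α = sum-zero (λ i → κ (α i) * 0#) λ i → zeroʳ (κ (α i))

  κ-sum : ∀ {n} (x : Vector A.Carrier n) → κ (ΣA.sum x) ≈ sum (κ ∘ x)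
  κ-sum {zero}  x = κ.0#-homo
  κ-sum {suc n} x = trans (κ.+-homo _ _) (+-congˡ (κ-sum (tail x)))

  -- Associativity α (N x) = (α N) x of matrix products, by exchanging the two sums.
  combination-combination : ∀ {m n} (α : Vector A.Carrier m) (N : Fin m → Vector A.Carrier n) x →
    combination α (λ i → combination (N i) x) ≈ combination (λ j → ΣA.sum λ i → α i A.* N i j) x
  combination-combination α N x = begin
    sum (λ i → κ (α i) * sum (λ j → κ (N i j) * x j))
      ≈⟨ sum-cong-≋ (λ i → *-distribˡ-sum (κ (α i)) (λ j → κ (N i j) * x j)) ⟩
    sum (λ i → sum (λ j → κ (α i) * (κ (N i j) * x j)))
      ≈⟨ ∑-comm (λ i j → κ (α i) * (κ (N i j) * x j)) ⟩
    sum (λ j → sum (λ i → κ (α i) * (κ (N i j) * x j)))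
      ≈⟨ sum-cong-≋ (λ j → sum-cong-≋ λ i →
           trans (sym (*-assoc _ _ _)) (*-congʳ (sym (κ.*-homo (α i) (N i j))))) ⟩
    sum (λ j → sum (λ i → κ (α i A.* N i j) * x j))
      ≈⟨ sum-cong-≋ (λ j → *-distribʳ-sum (x j) (λ i → κ (α i A.* N i j))) ⟨
    sum (λ j → sum (λ i → κ (α i A.* N i j)) * x j)
      ≈⟨ sum-cong-≋ (λ j → *-congʳ (κ-sum (λ i → α i A.* N i j))) ⟨
    sum (λ j → κ (ΣA.sum λ i → α i A.* N i j) * x j) ∎

module _ {a ℓa b ℓb c ℓc} (A : CommutativeRing a ℓa) (B : CommutativeRing b ℓb) (C : CommutativeRing c ℓc)
         {κ λ′ f} (κ-hom : Hom A B κ) (λ-hom : Hom A C λ′) (f-hom : Hom B C f) where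

  private
    module B = CommutativeRing B
    module C = CommutativeRing C
    module f = HomProperties B C f-hom
    module AB = LinearCombination A B κ-hom
    module AC = LinearCombination A C λ-hom
    module BC = LinearCombination B C f-hom

  hom-combination : (∀ s → f (κ s) C.≈ λ′ s) → ∀ {n} α (x : Vector _ n) →
                    f (AB.combination α x) C.≈ AC.combination α (f ∘ x)
  hom-combination fκ≈λ α x = C.trans (BC.κ-sum (λ i → κ (α i) B.* x i))
    (FiniteSum.sum-cong C (λ i → f (κ (α i) B.* x i)) (λ i → λ′ (α i) C.* f (x i))
      λ i → C.trans (f.*-homo (κ (α i)) (x i)) (C.*-congʳ (fκ≈λ (α i))))

HasInverses : ∀ {c ℓ} → CommutativeRing c ℓ → Set (c ⊔ ℓ)
HasInverses K = ∀ a → a ≈ 0# ⊎ (∃[ b ] b * a ≈ 1#)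
  where open CommutativeRing K

module LinearSubspaces {c ℓ} (K : CommutativeRing c ℓ) (decide : (P : Set (c ⊔ ℓ)) → Dec P)
                       (inverse : HasInverses K) where

  open CommutativeRing K hiding (zero)
  open Sum semiring
  open FiniteSum K
  open LinearCombination K K (idHom K)

  record IsLinearSubspace {n p} (W : Pred (Vector Carrier n) p) : Set (c ⊔ ℓ ⊔ p) where
    field
      resp     : ∀ {α β} → (∀ i → α i ≈ β i) → α ∈ W → β ∈ W
      0∈       : (λ _ → 0#) ∈ W
      +-closed : ∀ {α β} → α ∈ W → β ∈ W → (λ i → α i + β i) ∈ W
      *-closed : ∀ a {α} → α ∈ W → (λ i → a * α i) ∈ W

    sum∈ : ∀ {m} (a : Vector Carrier m) (N : Fin m → Vector Carrier n) → (∀ i → N i ∈ W) →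
           (λ j → sum λ i → a i * N i j) ∈ W
    sum∈ {zero}  a N N∈ = 0∈
    sum∈ {suc m} a N N∈ = +-closed (*-closed (a zero) (N∈ zero))
      (sum∈ (tail a) (λ i → N (suc i)) (λ i → N∈ (suc i)))

  -- A projection of the space of row vectors onto W, as a matrix acting from the right.
  record Projection {n p} (W : Pred (Vector Carrier n) p) : Set (c ⊔ ℓ ⊔ p) where
    field
      matrix : Fin n → Vector Carrier n
      row∈   : ∀ i → matrix i ∈ W
      fixes  : ∀ {α} → α ∈ W → ∀ j → sum (λ i → α i * matrix i j) ≈ α j

  -- Gaussian elimination on the first coordinate. W′ consists of the members of W that begin with
  -- 0. Either these are all of W, or some member can be scaled to begin with 1, and a correction of
  -- it becomes the first row above the matrix for W′.
  projection : ∀ n {W : Pred (Vector Carrier n) (c ⊔ ℓ)} → IsLinearSubspace W → Projection W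
  projection zero    {W} W-sub = record { matrix = λ () ; row∈ = λ () ; fixes = λ _ () }
  projection (suc n) {W} W-sub = extend (decide (∃[ u ] u ∈ W × ∃[ b ] b * u zero ≈ 1#))
    where
    module W = IsLinearSubspace W-sub
    W′ : Pred (Vector Carrier n) (c ⊔ ℓ)
    W′ v = (0# Vector.∷ v) ∈ W
    W′-sub : IsLinearSubspace W′
    W′-sub = record
      { resp     = λ e → W.resp λ { zero → refl ; (suc i) → e i }
      ; 0∈       = W.resp (λ { zero → refl ; (suc i) → refl }) W.0∈
      ; +-closed = λ v∈ w∈ → W.resp (λ { zero → +-identityˡ 0# ; (suc i) → refl }) (W.+-closed v∈ w∈)
      ; *-closed = λ a v∈ → W.resp (λ { zero → zeroʳ a ; (suc i) → refl }) (W.*-closed a v∈) }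
    module W′ = IsLinearSubspace W′-sub
    open Projection (projection n W′-sub) renaming (matrix to N′; row∈ to row′∈; fixes to fixes′)
    open SetoidReasoning setoid
    open SemiringSolver commutativeSemiring
    extend : Dec (∃[ u ] u ∈ W × ∃[ b ] b * u zero ≈ 1#) → Projection W
    extend (no ¬u) = record
      { matrix = (λ _ → 0#) Vector.∷ λ i → 0# Vector.∷ N′ i
      ; row∈   = λ { zero → W.0∈ ; (suc i) → row′∈ i }
      ; fixes  = fixes }
      where
      head≈0 : ∀ {α} → α ∈ W → α zero ≈ 0#
      head≈0 {α} α∈ with inverse (α zero)
      ... | inj₁ α₀≈0 = α₀≈0
      ... | inj₂ inv  = contradiction (α , α∈ , inv) ¬u
      fixes : ∀ {α} → α ∈ W → ∀ j → sum (λ i → α i * ((λ _ → 0#) Vector.∷ λ i → 0# Vector.∷ N′ i) i j) ≈ α j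
      fixes {α} α∈ zero    = trans (+-cong (zeroʳ _) (sum-zero (λ i → α (suc i) * 0#) λ i → zeroʳ _))
        (trans (+-identityˡ 0#) (sym (head≈0 α∈)))
      fixes {α} α∈ (suc j) = trans (+-congʳ (zeroʳ _)) (trans (+-identityˡ _)
        (fixes′ (W.resp (λ { zero → head≈0 α∈ ; (suc i) → refl }) α∈) j))
    extend (yes (u₀ , u₀∈ , b , bu₀≈1)) = record
      { matrix = (1# Vector.∷ u′) Vector.∷ λ i → 0# Vector.∷ N′ i
      ; row∈   = λ { zero → u′∈ ; (suc i) → row′∈ i }
      ; fixes  = fixes }
      where
      u uN u′ : Vector Carrier n
      u  j = b * u₀ (suc j)
      uN j = sum λ i → u i * N′ i j
      -- With this correction a u′ + w N′ = a u + (w - a u) N′ for every a ∷ w in W. As w - a u lies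
      -- in W′, it is fixed by N′ and the sum is w.
      u′ j = u j + - 1# * uN j
      1∷u∈ : (1# Vector.∷ u) ∈ W
      1∷u∈ = W.resp (λ { zero → bu₀≈1 ; (suc j) → refl }) (W.*-closed b u₀∈)
      u′∈ : (1# Vector.∷ u′) ∈ W
      u′∈ = W.resp (λ { zero → trans (+-congˡ (zeroʳ _)) (+-identityʳ 1#) ; (suc j) → refl })
        (W.+-closed 1∷u∈ (W.*-closed (- 1#) (W′.sum∈ u N′ row′∈)))
      fixes : ∀ {α} → α ∈ W → ∀ j → sum (λ i → α i * ((1# Vector.∷ u′) Vector.∷ λ i → 0# Vector.∷ N′ i) i j) ≈ α j
      fixes {α} α∈ zero = trans
        (+-cong (*-identityʳ _) (sum-zero (λ i → α (suc i) * 0#) λ i → zeroʳ _)) (+-identityʳ _)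
      fixes {α} α∈ (suc j) = begin
        a * (u j + - 1# * uN j) + wN j
          ≈⟨ solve 5 (λ a m u v w → a :* (u :+ m :* v) :+ w := a :* u :+ (w :+ (m :* a) :* v))
               refl a (- 1#) (u j) (uN j) (wN j) ⟩
        a * u j + (wN j + - 1# * a * uN j)
          ≈⟨ +-congˡ reduced ⟩
        a * u j + (w j + - 1# * a * u j)
          ≈⟨ solve 4 (λ a m u w → a :* u :+ (w :+ m :* a :* u) := (con 1 :+ m) :* a :* u :+ w)
               refl a (- 1#) (u j) (w j) ⟩
        (1# + - 1#) * a * u j + w j
          ≈⟨ +-congʳ (*-congʳ (*-congʳ (-‿inverseʳ 1#))) ⟩
        0# * a * u j + w j
          ≈⟨ trans (+-congʳ (trans (*-congʳ (zeroˡ a)) (zeroˡ _))) (+-identityˡ _) ⟩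
        w j ∎
        where
        a = α zero
        w wN : Vector Carrier n
        w    = tail α
        wN j = sum λ i → w i * N′ i j
        w-au∈ : (λ i → w i + - 1# * a * u i) ∈ W′
        w-au∈ = W.resp (λ { zero → trans (+-congˡ (trans (*-identityʳ _) (-1*x≈-x a))) (-‿inverseʳ a)
                          ; (suc i) → refl })
          (W.+-closed α∈ (W.*-closed (- 1# * a) 1∷u∈))
          where open RingProperties ring using (-1*x≈-x)
        reduced : wN j + - 1# * a * uN j ≈ w j + - 1# * a * u j
        reduced = begin
          wN j + - 1# * a * uN j
            ≈⟨ +-congˡ (combination-*ˡ (- 1# * a) u (λ i → N′ i j)) ⟨
          wN j + sum (λ i → - 1# * a * u i * N′ i j)
            ≈⟨ combination-+ˡ w (λ i → - 1# * a * u i) (λ i → N′ i j) ⟨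
          sum (λ i → (w i + - 1# * a * u i) * N′ i j)
            ≈⟨ fixes′ w-au∈ j ⟩
          w j + - 1# * a * u j ∎

  -- For a projection matrix N onto W the columns of 1 - N are annihilated by W, hence by γ. So γ =
  -- γ N is a combination of rows of N, all of which lie in W.
  double-annihilator : ∀ {n} {W : Pred (Vector Carrier n) (c ⊔ ℓ)} → IsLinearSubspace W → ∀ γ →
    (∀ v → (∀ {α} → α ∈ W → sum (λ i → α i * v i) ≈ 0#) → sum (λ i → γ i * v i) ≈ 0#) → γ ∈ W
  double-annihilator {n} {W} W-sub γ γ⊥ = W.resp γN≈γ (W.sum∈ γ matrix row∈)
    where
    module W = IsLinearSubspace W-sub
    open Projection (projection n W-sub)
    open RingProperties ring using (x∙y⁻¹≈ε⇒x≈y)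
    column : Fin n → Vector Carrier n
    column j i = δ i j - matrix i j
    ⟨_,column⟩ : ∀ α j → sum (λ i → α i * column j i) ≈ α j - sum (λ i → α i * matrix i j)
    ⟨ α ,column⟩ j = trans (combination-+ʳ α (λ i → δ i j) (λ i → - matrix i j))
      (+-cong (sum-δ α j) (combination-‿ʳ α (λ i → matrix i j)))
    γN≈γ : ∀ j → sum (λ i → γ i * matrix i j) ≈ γ j
    γN≈γ j = sym (x∙y⁻¹≈ε⇒x≈y _ _ (trans (sym (⟨ γ ,column⟩ j)) (γ⊥ (column j) λ {α} α∈ →
      trans (⟨ α ,column⟩ j) (trans (+-congˡ (-‿cong (fixes α∈ j))) (-‿inverseʳ _)))))

-- Hilbert's basis theorem and associated primes

-- The Noetherian property as existence of maximal members of families of ideals. This is the form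
-- that produces associated primes, and it passes to R[X] without choosing generators or chains.
MaximumCondition : ∀ {c ℓ} → CommutativeRing c ℓ → Set _
MaximumCondition {c} {ℓ} R =
  ∀ {Ix : Set (c ⊔ ℓ)} (F : Ix → Pred Carrier (c ⊔ ℓ)) → (∀ j → IsIdeal (F j)) → Ix →
  ∃[ j ] (∀ k → F j ⊆ F k → F k ⊆ F j)
  where
  open CommutativeRing R using (Carrier)
  open IdealTheory R using (IsIdeal)

module _ {c ℓ} (R : CommutativeRing c ℓ) (max : MaximumCondition R) where

  open CommutativeRing R
  open Polynomial R
  open PolynomialProperties R
  private module P = CommutativeRing R[X]
  open IdealTheory using (IsIdeal)
  open RingProperties ring using (-1*x≈-x)

  -- The degree is only bounded by k, so a may be 0; this makes the coefficients an ideal.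
  Leading : ℕ → Pred P.Carrier (c ⊔ ℓ) → Pred Carrier (c ⊔ ℓ)
  Leading k I a = ∃[ f ] f ∈ I × (∀ m → k < m → coeff f m ≈ 0#) × coeff f k ≈ a

  leading-isIdeal : ∀ k {I} → IsIdeal R[X] I → IsIdeal R (Leading k I)
  leading-isIdeal k ideal = record
    { resp     = λ { a≈b (f , f∈ , deg , e) → f , f∈ , deg , trans e a≈b }
    ; 0∈       = [] , I.0∈ , (λ _ _ → refl) , refl
    ; +-closed = λ { (f , f∈ , deg , e) (g , g∈ , deg′ , e′) → f ⊕ g , I.+-closed f∈ g∈
      , (λ m k<m → trans (coeff-⊕ f g m) (trans (+-cong (deg m k<m) (deg′ m k<m)) (+-identityˡ 0#)))
      , trans (coeff-⊕ f g k) (+-cong e e′) }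
    ; *-closed = λ { r (f , f∈ , deg , e) → C r ⊗ f , I.*-closed (C r) f∈
      , (λ m k<m → trans (coeff-C⊗ r f m) (trans (*-congˡ (deg m k<m)) (zeroʳ r)))
      , trans (coeff-C⊗ r f k) (*-congˡ e) } }
    where
    module I = IdealTheory.IsIdeal ideal

  leading-mono : ∀ k {I J} → I ⊆ J → Leading k I ⊆ Leading k J
  leading-mono k I⊆J (f , f∈ , rest) = f , I⊆J f∈ , rest

  leading-suc : ∀ k {I} → IsIdeal R[X] I → Leading k I ⊆ Leading (suc k) I
  leading-suc k ideal (f , f∈ , deg , e) = X ⊗ f , I.*-closed X f∈
    , (λ { (suc m) (s≤s k<m) → trans (coeff-≈ (X⊗ f) (suc m)) (deg m k<m) })
    , trans (coeff-≈ (X⊗ f) (suc k)) e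
    where module I = IdealTheory.IsIdeal ideal

  leading-≤ : ∀ {k m I} → IsIdeal R[X] I → k ≤ m → Leading k I ⊆ Leading m I
  leading-≤ {k} {m} ideal k≤m = go (ℕ.≤⇒≤′ k≤m)
    where
    go : ∀ {m} → k ≤′ m → Leading k _ ⊆ Leading m _
    go ≤′-refl           a∈ = a∈
    go (≤′-step {m} k≤m) a∈ = leading-suc m ideal (go k≤m a∈)

  -- Induction on a degree bound: subtracting a member of I with the same top coefficient from f
  -- leaves a polynomial of smaller degree, which still lies in J because I ⊆ J.
  leading-determines : ∀ {I J} → IsIdeal R[X] I → IsIdeal R[X] J → I ⊆ J →
                       (∀ k → Leading k J ⊆ Leading k I) → J ⊆ I
  leading-determines {I} {J} I-ideal J-ideal I⊆J lead {f} f∈J =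
    go (length f) f (λ m → overflow f) f∈J
    where
    module I = IdealTheory.IsIdeal I-ideal
    module J = IdealTheory.IsIdeal J-ideal
    overflow : ∀ f {m} → length f ≤ m → coeff f m ≈ 0#
    overflow []      _           = refl
    overflow (a ∷ f) (s≤s len≤m) = overflow f len≤m
    go : ∀ d f → (∀ m → d ≤ m → coeff f m ≈ 0#) → f ∈ J → f ∈ I
    go zero    f deg f∈J = I.resp (coeffs λ m → sym (deg m z≤n)) I.0∈
    go (suc d) f deg f∈J with lead d (f , f∈J , deg , refl)
    ... | g , g∈I , g-deg , g-lead = I.resp f-g+g≋f (I.+-closed (go d h h-deg h∈J) g∈I)
      where
      h = f ⊕ C (- 1#) ⊗ g
      h-coeff : ∀ m → coeff h m ≈ coeff f m - coeff g m
      h-coeff m = trans (coeff-⊕ f _ m) (+-congˡ (trans (coeff-C⊗ (- 1#) g m) (-1*x≈-x _)))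
      h-deg : ∀ m → d ≤ m → coeff h m ≈ 0#
      h-deg m d≤m with ℕ.m≤n⇒m<n∨m≡n d≤m
      ... | inj₂ ≡.refl = trans (h-coeff d) (trans (+-congˡ (-‿cong g-lead)) (-‿inverseʳ _))
      ... | inj₁ d<m  = trans (h-coeff m)
        (trans (+-cong (deg m d<m) (-‿cong (g-deg m d<m))) (-‿inverseʳ 0#))
      h∈J : h ∈ J
      h∈J = J.+-closed f∈J (J.*-closed (C (- 1#)) (I⊆J g∈I))
      f-g+g≋f : h ⊕ g ≋ f
      f-g+g≋f = coeffs λ m → begin
        coeff (h ⊕ g) m                        ≈⟨ coeff-⊕ h g m ⟩
        coeff h m + coeff g m                  ≈⟨ +-congʳ (h-coeff m) ⟩
        (coeff f m - coeff g m) + coeff g m    ≈⟨ +-assoc _ _ _ ⟩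
        coeff f m + (- coeff g m + coeff g m)  ≈⟨ +-congˡ (-‿inverseˡ _) ⟩
        coeff f m + 0#                         ≈⟨ +-identityʳ _ ⟩
        coeff f m                              ∎
        where open SetoidReasoning setoid

  private
    -- The ideals of leading coefficients in degrees below k are maximised one after the
    -- other, each time within the subfamily that is optimal in the higher degrees.
    maximal-below : ∀ k {Ix : Set (c ⊔ ℓ)} (F : Ix → Pred P.Carrier (c ⊔ ℓ)) →
                    (∀ j → IsIdeal R[X] (F j)) → Ix →
                    ∃[ i ] (∀ j → F i ⊆ F j → ∀ m → m < k → Leading m (F j) ⊆ Leading m (F i))
    maximal-below zero    F ideal i₀ = i₀ , λ _ _ _ ()
    maximal-below (suc k) F ideal i₀
      with max (λ j → Leading k (F j)) (λ j → leading-isIdeal k (ideal j)) i₀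
    ... | i₁ , i₁-max
      with maximal-below k {Ix = ∃[ j ] Leading k (F i₁) ⊆ Leading k (F j)}
             (λ j → F (proj₁ j)) (λ j → ideal (proj₁ j)) (i₁ , λ a∈ → a∈)
    ... | (i , Fi₁⊆Fi) , i-max = i , optimal
      where
      optimal : ∀ j → F i ⊆ F j → ∀ m → m < suc k → Leading m (F j) ⊆ Leading m (F i)
      optimal j Fi⊆Fj m (s≤s m≤k) with ℕ.m≤n⇒m<n∨m≡n m≤k
      ... | inj₁ m<k  = i-max (j , λ a∈ → leading-mono k Fi⊆Fj (Fi₁⊆Fi a∈)) Fi⊆Fj m m<k
      ... | inj₂ ≡.refl = λ a∈ →
        Fi₁⊆Fi (i₁-max j (λ b∈ → leading-mono k Fi⊆Fj (Fi₁⊆Fi b∈)) a∈)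

  -- A pair of member and degree k with maximal ideal of leading coefficients settles all degrees
  -- from k on. The finitely many degrees below k are settled by `maximal-below` among the members
  -- that attain this maximum, and `leading-determines` concludes.
  hilbert-basis : MaximumCondition R[X]
  hilbert-basis {Ix} F ideal i₀
    with max {Ix = Ix × ℕ} (λ (j , k) → Leading k (F j)) (λ (j , k) → leading-isIdeal k (ideal j)) (i₀ , 0)
  ... | (i₁ , k) , i₁-max
    with maximal-below k {Ix = ∃[ j ] Leading k (F i₁) ⊆ Leading k (F j)}
           (λ j → F (proj₁ j)) (λ j → ideal (proj₁ j)) (i₁ , λ a∈ → a∈)
  ... | (i , Fi₁⊆Fi) , i-max = i , λ j Fi⊆Fj → leading-determines (ideal i) (ideal j) Fi⊆Fj (optimal j Fi⊆Fj)
    where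
    optimal : ∀ j → F i ⊆ F j → ∀ m → Leading m (F j) ⊆ Leading m (F i)
    optimal j Fi⊆Fj m with ℕ.<-≤-connex m k
    ... | inj₁ m<k = i-max (j , λ a∈ → leading-mono k Fi⊆Fj (Fi₁⊆Fi a∈)) Fi⊆Fj m m<k
    -- Maximality of (i₁ , k) is tested against the pair (j , m): the leading ideal of F j in degree
    -- m lies in that of F i₁ in degree k, hence in that of F i in degree k and then in degree m.
    ... | inj₂ k≤m = λ a∈ → leading-≤ (ideal i) k≤m (Fi₁⊆Fi
      (i₁-max (j , m) (λ b∈ → leading-≤ (ideal j) k≤m (leading-mono k Fi⊆Fj (Fi₁⊆Fi b∈))) a∈))

hilbert-basis-multi : ∀ {c ℓ} (R : CommutativeRing c ℓ) → MaximumCondition R →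
                      ∀ n → MaximumCondition (polynomialRing R n)
hilbert-basis-multi R max zero    = max
hilbert-basis-multi R max (suc n) = hilbert-basis (polynomialRing R n) (hilbert-basis-multi R max n)

field-maximumCondition : ∀ {c ℓ} (R : CommutativeRing c ℓ) →
                         ((P : Set (c ⊔ ℓ)) → Dec P) → HasInverses R → MaximumCondition R
field-maximumCondition R decide inverse {Ix} F ideal i₀ with decide (∃[ j ] F j (CommutativeRing.1# R))
... | yes (j , 1∈) = j , λ k _ _ → j.resp (*-identityʳ _) (j.*-closed _ 1∈)
  where
  open CommutativeRing R
  module j = IdealTheory.IsIdeal (ideal j)
... | no ¬1∈ = i₀ , λ k _ {a} a∈ → zero-or-unit k a a∈ (inverse a)
  where
  open CommutativeRing R
  module i₀ = IdealTheory.IsIdeal (ideal i₀)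
  zero-or-unit : ∀ k a → a ∈ F k → (a ≈ 0#) ⊎ (∃[ b ] b * a ≈ 1#) → a ∈ F i₀
  zero-or-unit k a a∈ (inj₁ a≈0)        = i₀.resp (sym a≈0) i₀.0∈
  zero-or-unit k a a∈ (inj₂ (b , ba≈1)) =
    contradiction (k , IdealTheory.IsIdeal.resp (ideal k) ba≈1 (IdealTheory.IsIdeal.*-closed (ideal k) b a∈)) ¬1∈

≈⇒≈ₐ : ∀ {c ℓ} (R : CommutativeRing c ℓ) a {x y} →
       CommutativeRing._≈_ R x y → Quotient._≈ₐ_ R a x y
≈⇒≈ₐ R a x≈y = Quotient.congruent
  (0# RawMagmaDefinitions., trans (zeroˡ a) (sym (trans (+-congʳ x≈y) (-‿inverseʳ _))))
  where open CommutativeRing R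

isIdeal-quotient : ∀ {c ℓ p} (R : CommutativeRing c ℓ) (a : CommutativeRing.Carrier R)
                   {I : Pred (CommutativeRing.Carrier R) p} →
                   IdealTheory.IsIdeal (Quotient.quotientRing R a) I → IdealTheory.IsIdeal R I
isIdeal-quotient R a ideal = record
  { resp = λ x≈y → I.resp (≈⇒≈ₐ R a x≈y) ; 0∈ = I.0∈ ; +-closed = I.+-closed ; *-closed = I.*-closed }
  where module I = IdealTheory.IsIdeal ideal

-- The quotient has the carrier of R, so its ideals are ideals of R with unchanged inclusions.
maximumCondition-quotient : ∀ {c ℓ} (R : CommutativeRing c ℓ) (a : CommutativeRing.Carrier R) →
                            MaximumCondition R → MaximumCondition (Quotient.quotientRing R a)
maximumCondition-quotient R a max F ideal = max F (λ j → isIdeal-quotient R a (ideal j))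

module _ {c ℓ} (R : CommutativeRing c ℓ) (max : MaximumCondition R)
         (decide : (P : Set (c ⊔ ℓ)) → Dec P) where

  open CommutativeRing R
  open IdealTheory R
  open SemiringExp semiring using (_^_; ^-homo-*)

  colon-isIdeal : ∀ {p} {I : Pred Carrier p} → IsIdeal I → ∀ f → IsIdeal (I ∶ f)
  colon-isIdeal ideal f = record
    { resp     = λ x≈y x∈ → I.resp (*-congʳ x≈y) x∈
    ; 0∈       = I.resp (sym (zeroˡ f)) I.0∈
    ; +-closed = λ x∈ y∈ → I.resp (sym (distribʳ f _ _)) (I.+-closed x∈ y∈)
    ; *-closed = λ r x∈ → I.resp (sym (*-assoc r _ f)) (I.*-closed r x∈) }
    where module I = IsIdeal ideal

  -- A colon ideal I ∶ h that is maximal among those with h g^k ∉ I for all k is prime.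
  associated-prime-avoiding : ∀ {I : Pred Carrier (c ⊔ ℓ)} → IsIdeal I → ∀ f g →
                              (∀ k → f * g ^ k ∉ I) →
                              ∃[ h ] (IsPrime (I ∶ (h * f)) × g ∉ (I ∶ (h * f)))
  associated-prime-avoiding {I} ideal f g fgᵏ∉I = h , isPrime , g∉
    where
    module I = IsIdeal ideal
    Avoiding : Set (c ⊔ ℓ)
    Avoiding = ∃[ h ] (∀ k → (h * f) * g ^ k ∉ I)
    open SemiringSolver commutativeSemiring
    start : Avoiding
    start = 1# , λ k 1fgᵏ∈ → fgᵏ∉I k (I.resp (*-congʳ (*-identityˡ f)) 1fgᵏ∈)
    maximal = max (λ (h : Avoiding) → I ∶ (proj₁ h * f)) (λ h → colon-isIdeal ideal _) start
    h = proj₁ (proj₁ maximal)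
    hfgᵏ∉I = proj₂ (proj₁ maximal)
    -- Replacing h by g ^ k * h stays within the family and can only enlarge the colon ideal, so by
    -- maximality the factor g ^ k can be cancelled.
    absorb : ∀ k {x} → x * ((h * f) * g ^ k) ∈ I → x * (h * f) ∈ I
    absorb k {x} xhfgᵏ∈ = proj₂ maximal (g ^ k * h , multiples) larger (I.resp
      (solve 4 (λ x h f y → x :* ((h :* f) :* y) := x :* ((y :* h) :* f)) refl x h f (g ^ k)) xhfgᵏ∈)
      where
      multiples : ∀ m → ((g ^ k * h) * f) * g ^ m ∉ I
      multiples m e = hfgᵏ∉I (k +ᴺ m) (I.resp (trans
        (solve 4 (λ y z h f → ((y :* h) :* f) :* z := (h :* f) :* (y :* z)) refl (g ^ k) (g ^ m) h f)
        (*-congˡ (sym (^-homo-* g k m)))) e)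
      larger : (I ∶ (h * f)) ⊆ (I ∶ ((g ^ k * h) * f))
      larger {z} z∈ = I.resp
        (solve 4 (λ y z h f → y :* (z :* (h :* f)) := z :* ((y :* h) :* f)) refl (g ^ k) z h f)
        (I.*-closed (g ^ k) z∈)
    g∉ : g ∉ (I ∶ (h * f))
    g∉ g∈ = hfgᵏ∉I 1 (I.resp (trans (*-comm g _) (*-congˡ (sym (*-identityʳ g)))) g∈)
    isPrime : IsPrime (I ∶ (h * f))
    isPrime = record
      { isIdeal = colon-isIdeal ideal _
      ; proper  = λ 1∈ → hfgᵏ∉I 0 (I.resp (*-comm 1# _) 1∈)
      ; prime   = λ {x} {y} xy∈ → prime x y xy∈ (decide (∃[ k ] x * ((h * f) * g ^ k) ∈ I)) }
      where
      prime : ∀ x y → (x * y) * (h * f) ∈ I → Dec (∃[ k ] x * ((h * f) * g ^ k) ∈ I) →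
              x ∈ (I ∶ (h * f)) ⊎ y ∈ (I ∶ (h * f))
      prime x y xy∈ (yes (k , x∈)) = inj₁ (absorb k x∈)
      -- Now x * h belongs to the family as well. Its colon ideal contains that of h, and it
      -- contains y, so maximality returns y to the smaller one.
      prime x y xy∈ (no x∉) = inj₂ (proj₂ maximal
        (x * h , λ k xhfgᵏ∈ → x∉ (k , I.resp
          (solve 4 (λ x h f y → ((x :* h) :* f) :* y := x :* ((h :* f) :* y)) refl x h f (g ^ k)) xhfgᵏ∈))
        (λ {z} z∈ → I.resp (solve 4 (λ x z h f → x :* (z :* (h :* f)) := z :* ((x :* h) :* f)) refl x z h f)
          (I.*-closed x z∈))
        (I.resp (solve 4 (λ x y h f → (x :* y) :* (h :* f) := y :* ((x :* h) :* f)) refl x y h f) xy∈))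

-- Non-zero-divisors modulo homogeneous extended ideals

-- In coordinates adapted to the subspace X that is cut out by the rows of N, the point
-- y(t, w) has the coordinates of x transverse to X scaled by t and those along X replaced
-- by the coordinates of w.
module Degeneration
  {k ℓk s ℓs t ℓt} (K : CommutativeRing k ℓk) (S : CommutativeRing s ℓs) (T : CommutativeRing t ℓt)
  {κ C} (κ-hom : Hom K S κ) (C-hom : Hom S T C) {n}
  (N : Fin n → Vector (CommutativeRing.Carrier K) n) (x : Vector (CommutativeRing.Carrier S) n)
  (t : CommutativeRing.Carrier T) (w : Vector (CommutativeRing.Carrier T) n) where

  private
    module K = CommutativeRing K
    module S = LinearCombination K S κ-hom
    κᵀ-hom = compHom K S T κ-hom C-hom
    module T = LinearCombination K T κᵀ-hom
    module C = HomProperties S T C-hom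
  open CommutativeRing T
  open SetoidReasoning setoid

  y : Vector Carrier n
  y i = t * C (S.combination (N i) x) + (w i - T.combination (N i) w)

  -- From α N = α follow α (N x) = α x and α (w - N w) = 0: a form vanishing on X sees only the
  -- transverse part, which carries the factor t.
  combination-y : ∀ α → (∀ j → Sum.sum K.semiring (λ i → α i K.* N i j) K.≈ α j) →
                  T.combination α y ≈ t * C (S.combination α x)
  combination-y α αN≈α = begin
    T.combination α y
      ≈⟨ T.combination-+ʳ α (λ i → t * C (S.combination (N i) x)) (λ i → w i - T.combination (N i) w) ⟩
    T.combination α (λ i → t * C (S.combination (N i) x)) + T.combination α (λ i → w i - T.combination (N i) w)
      ≈⟨ +-cong transverse along ⟩
    t * C (S.combination α x) + 0#
      ≈⟨ +-identityʳ _ ⟩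
    t * C (S.combination α x) ∎
    where
    C-combination : ∀ α → C (S.combination α x) ≈ T.combination α (C ∘ x)
    C-combination α = hom-combination K S T κ-hom κᵀ-hom C-hom (λ _ → refl) α x
    N-combination : ∀ z → T.combination α (λ i → T.combination (N i) z) ≈ T.combination α z
    N-combination z = trans (T.combination-combination α N z) (T.combination-congˡ z αN≈α)
    transverse : T.combination α (λ i → t * C (S.combination (N i) x)) ≈ t * C (S.combination α x)
    transverse = begin
      T.combination α (λ i → t * C (S.combination (N i) x))
        ≈⟨ T.combination-*ʳ α t (λ i → C (S.combination (N i) x)) ⟩
      t * T.combination α (λ i → C (S.combination (N i) x))
        ≈⟨ *-congˡ (T.combination-congʳ α (λ i → C-combination (N i))) ⟩
      t * T.combination α (λ i → T.combination (N i) (C ∘ x))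
        ≈⟨ *-congˡ (N-combination (C ∘ x)) ⟩
      t * T.combination α (C ∘ x)
        ≈⟨ *-congˡ (C-combination α) ⟨
      t * C (S.combination α x) ∎
    along : T.combination α (λ i → w i - T.combination (N i) w) ≈ 0#
    along = begin
      T.combination α (λ i → w i - T.combination (N i) w)
        ≈⟨ T.combination-+ʳ α w (λ i → - T.combination (N i) w) ⟩
      T.combination α w + T.combination α (λ i → - T.combination (N i) w)
        ≈⟨ +-congˡ (T.combination-‿ʳ α (λ i → T.combination (N i) w)) ⟩
      T.combination α w - T.combination α (λ i → T.combination (N i) w)
        ≈⟨ +-congˡ (-‿cong (N-combination w)) ⟩
      T.combination α w - T.combination α w
        ≈⟨ -‿inverseʳ _ ⟩
      0# ∎

  module _ {b ℓb} (B : CommutativeRing b ℓb) {f ι} (f-hom : Hom T B f) (ι-hom : Hom K B ι) where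

    private
      module B where
        open CommutativeRing B public
        open LinearCombination K B ι-hom public
      module f = HomProperties T B f-hom

    -- The map f is kept general because two specialisations are computed from it: the constant term
    -- in t, and t = 1 with w = x.
    hom-y : (∀ a → f (C (κ a)) B.≈ ι a) → ∀ i →
            f (y i) B.≈ f t B.* f (C (S.combination (N i) x)) B.+ (f (w i) B.- B.combination (N i) (f ∘ w))
    hom-y fCκ≈ι i = B.trans (f.+-homo _ _) (B.+-cong (f.*-homo _ _)
      (B.trans (f.+-homo _ _) (B.+-congˡ (B.trans (f.-‿homo _)
        (B.-‿cong (hom-combination K T B κᵀ-hom ι-hom f-hom fCκ≈ι (N i) w))))))

module GradedSaturation
  {c ℓ} (K : CommutativeRing c ℓ) (decide : (P : Set ℓ) → Dec P) (inverse : HasInverses K) (n : ℕ)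
  (N : Fin n → Vector (CommutativeRing.Carrier K) n) where

  private
    module K = CommutativeRing K

  -- Variable `zero` of T is t and the variables `suc i` are the w. Since `zero` is the outermost
  -- variable, `coeff` of a member of T refers to powers of t.
  S T : CommutativeRing c ℓ
  S = polynomialRing K n
  T = polynomialRing S (suc n)

  private
    module S = CommutativeRing S
    module T = CommutativeRing T
    κ-hom = constant-hom K n
    C-hom = constant-hom S (suc n)
    κᵀ-hom = compHom K S T κ-hom C-hom
    module SC = LinearCombination K S κ-hom
    module D = Degeneration K S T κ-hom C-hom N (var K n) (var S (suc n) zero) (λ i → var S (suc n) (suc i))

  linearForm : Vector K.Carrier n → S.Carrier
  linearForm α = SC.combination α (var K n)

  Φ : S.Carrier → T.Carrier
  Φ = MultiEvaluation.evaluate K T κᵀ-hom n D.y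

  Φ-hom : Hom S T Φ
  Φ-hom = MultiEvaluation.evaluate-hom K T κᵀ-hom n D.y

  private
    module Φ = HomProperties S T Φ-hom

  Φ-constant : ∀ a → Φ (constant K n a) T.≈ constant S (suc n) (constant K n a)
  Φ-constant = MultiEvaluation.evaluate-constant K T κᵀ-hom n D.y

  Φ-var : ∀ i → Φ (var K n i) T.≈ D.y i
  Φ-var = MultiEvaluation.evaluate-var K T κᵀ-hom n D.y

  Φ-linearForm : ∀ α → (∀ j → Sum.sum K.semiring (λ i → α i K.* N i j) K.≈ α j) →
                 Φ (linearForm α) T.≈ var S (suc n) zero T.* constant S (suc n) (linearForm α)
  Φ-linearForm α αN≈α = T.trans
    (hom-combination K S T κ-hom κᵀ-hom Φ-hom Φ-constant α (var K n))
    (T.trans (TC.combination-congʳ α Φ-var) (D.combination-y α αN≈α))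
    where module TC = LinearCombination K T κᵀ-hom

  -- Restriction to X along the projection I − N.
  σ : S.Carrier → S.Carrier
  σ = MultiEvaluation.evaluate K S κ-hom n (λ i → var K n i S.- linearForm (N i))

  private
    σ-hom : Hom S S σ
    σ-hom = MultiEvaluation.evaluate-hom K S κ-hom n (λ i → var K n i S.- linearForm (N i))

    σ-constant : ∀ a → σ (constant K n a) S.≈ constant K n a
    σ-constant = MultiEvaluation.evaluate-constant K S κ-hom n (λ i → var K n i S.- linearForm (N i))

    σ-var : ∀ i → σ (var K n i) S.≈ var K n i S.- linearForm (N i)
    σ-var = MultiEvaluation.evaluate-var K S κ-hom n (λ i → var K n i S.- linearForm (N i))

  module _ {p} {P : Pred S.Carrier p} (P-ideal : IdealTheory.IsIdeal S P)
           (N∈P : ∀ i → linearForm (N i) ∈ P) where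

    private
      module P = IdealTheory.IsIdeal P-ideal
      _∼_ : S.Carrier → S.Carrier → Set _
      x ∼ y = ∃[ u ] u ∈ P × x S.≈ y S.+ u
      open SemiringSolver S.commutativeSemiring using (solve; _:=_; _:+_; _:*_)
      ∼-isCongruence : IsCongruence S _∼_
      ∼-isCongruence = record
        { reflexive = λ x≈y → S.0# , P.0∈ , S.trans x≈y (S.sym (S.+-identityʳ _))
        ; trans     = λ {x} {y} {z} (u , u∈ , e) (v , v∈ , f) → v S.+ u , P.+-closed v∈ u∈ ,
            S.trans e (S.trans (S.+-congʳ f) (S.+-assoc z v u))
        ; +-cong    = λ {x} {y} {z} {w} (u , u∈ , e) (v , v∈ , f) → u S.+ v , P.+-closed u∈ v∈ ,
            S.trans (S.+-cong e f)
              (solve 4 (λ y w u v → (y :+ u) :+ (w :+ v) := (y :+ w) :+ (u :+ v)) S.refl y w u v)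
        ; *-cong    = λ {x} {y} {z} {w} (u , u∈ , e) (v , v∈ , f) →
            (y S.+ u) S.* v S.+ w S.* u , P.+-closed (P.*-closed _ v∈) (P.*-closed w u∈) ,
            S.trans (S.*-cong e f)
              (solve 4 (λ y w u v → (y :+ u) :* (w :+ v) := y :* w :+ ((y :+ u) :* v :+ w :* u)) S.refl y w u v) }

    -- Each variable differs from its image under σ by the form of a row of N, which lies in P.
    -- Hence s and σ s agree modulo P for all s.
    σ≈0⇒∈ : ∀ s → σ s S.≈ S.0# → s ∈ P
    σ≈0⇒∈ s σs≈0 with hom-unique K S ∼-isCongruence n (idHom S) σ-hom
                        (λ a → IsCongruence.reflexive ∼-isCongruence (S.sym (σ-constant a)))
                        (λ i → linearForm (N i) , N∈P i , var∼ i) s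
      where
      var∼ : ∀ i → var K n i S.≈ σ (var K n i) S.+ linearForm (N i)
      var∼ i = S.sym (S.trans (S.+-congʳ (σ-var i)) (S.trans (S.+-assoc _ _ _)
        (S.trans (S.+-congˡ (S.-‿inverseˡ _)) (S.+-identityʳ _))))
    ... | u , u∈ , s≈ = P.resp (S.sym (S.trans s≈ (S.trans (S.+-congʳ σs≈0) (S.+-identityˡ u)))) u∈

  private
    Sₙ : CommutativeRing c ℓ
    Sₙ = polynomialRing S n
    module Sₙ = CommutativeRing Sₙ
    module PP = PolynomialProperties Sₙ
    open Polynomial Sₙ using (coeff)
    open CoefficientMap K S κ-hom
    ι-hom : Hom K Sₙ (λ a → constant S n (constant K n a))
    ι-hom = compHom K S Sₙ κ-hom (constant-hom S n)
    module SₙC = LinearCombination K Sₙ ι-hom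

    -- At t = 0 the point y becomes w - N w, so the constant term is σ s written in w. Its
    -- coefficients come from K, and the non-zero ones are therefore units.
    coeff₀-Φ : ∀ s → coeff (Φ s) 0 Sₙ.≈ mapCoeff n (σ s)
    coeff₀-Φ = hom-unique K Sₙ (≈-isCongruence Sₙ) n
      (compHom S T Sₙ Φ-hom PP.coeff₀-hom) (compHom S S Sₙ σ-hom (mapCoeff-hom n))
      (λ a → Sₙ.trans (h.cong (Φ-constant a))
        (Sₙ.sym (Sₙ.trans (m.cong (σ-constant a)) (mapCoeff-constant n a))))
      vars
      where
      module h = HomProperties T Sₙ PP.coeff₀-hom
      module m = HomProperties S Sₙ (mapCoeff-hom n)
      open SetoidReasoning Sₙ.setoid
      vars : ∀ i → coeff (Φ (var K n i)) 0 Sₙ.≈ mapCoeff n (σ (var K n i))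
      vars i = begin
        coeff (Φ (var K n i)) 0
          ≈⟨ h.cong (Φ-var i) ⟩
        coeff (D.y i) 0
          ≈⟨ D.hom-y Sₙ PP.coeff₀-hom ι-hom (λ _ → Sₙ.refl) i ⟩
        Sₙ.0# Sₙ.* _ Sₙ.+ (var S n i Sₙ.- SₙC.combination (N i) (var S n))
          ≈⟨ Sₙ.trans (Sₙ.+-congʳ (Sₙ.zeroˡ _)) (Sₙ.+-identityˡ _) ⟩
        var S n i Sₙ.- SₙC.combination (N i) (var S n)
          ≈⟨ Sₙ.+-cong (mapCoeff-var n i) (Sₙ.-‿cong (SₙC.combination-congʳ (N i) (mapCoeff-var n))) ⟨
        mapCoeff n (var K n i) Sₙ.- SₙC.combination (N i) (mapCoeff n ∘ var K n)
          ≈⟨ Sₙ.+-congˡ (Sₙ.-‿cong (hom-combination K S Sₙ κ-hom ι-hom (mapCoeff-hom n)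
               (mapCoeff-constant n) (N i) (var K n))) ⟨
        mapCoeff n (var K n i) Sₙ.- mapCoeff n (linearForm (N i))
          ≈⟨ Sₙ.+-congˡ (m.-‿homo (linearForm (N i))) ⟨
        mapCoeff n (var K n i) Sₙ.+ mapCoeff n (S.- linearForm (N i))
          ≈⟨ m.+-homo _ _ ⟨
        mapCoeff n (var K n i S.- linearForm (N i))
          ≈⟨ m.cong (σ-var i) ⟨
        mapCoeff n (σ (var K n i)) ∎

    -- The specialisation t = 1, w = x. It takes y to N x + (x - N x) = x and so undoes Φ.
    ε : T.Carrier → S.Carrier
    ε = MultiEvaluation.evaluate S S (idHom S) (suc n) (S.1# Vector.∷ var K n)

    ε-hom : Hom T S ε
    ε-hom = MultiEvaluation.evaluate-hom S S (idHom S) (suc n) (S.1# Vector.∷ var K n)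

    ε-constant : ∀ a → ε (constant S (suc n) a) S.≈ a
    ε-constant = MultiEvaluation.evaluate-constant S S (idHom S) (suc n) (S.1# Vector.∷ var K n)

    ε-var : ∀ i → ε (var S (suc n) i) S.≈ (S.1# Vector.∷ var K n) i
    ε-var = MultiEvaluation.evaluate-var S S (idHom S) (suc n) (S.1# Vector.∷ var K n)

    ε-Φ : ∀ s → ε (Φ s) S.≈ s
    ε-Φ = hom-unique K S (≈-isCongruence S) n (compHom S T S Φ-hom ε-hom) (idHom S)
      (λ a → S.trans (ε.cong (Φ-constant a)) (ε-constant (constant K n a)))
      vars
      where
      module ε = HomProperties T S ε-hom
      open SetoidReasoning S.setoid
      vars : ∀ i → ε (Φ (var K n i)) S.≈ var K n i
      vars i = begin
        ε (Φ (var K n i))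
          ≈⟨ ε.cong (Φ-var i) ⟩
        ε (D.y i)
          ≈⟨ D.hom-y S ε-hom κ-hom (λ a → ε-constant (constant K n a)) i ⟩
        ε (var S (suc n) zero) S.* ε (constant S (suc n) (linearForm (N i)))
          S.+ (ε (var S (suc n) (suc i)) S.- SC.combination (N i) (λ j → ε (var S (suc n) (suc j))))
          ≈⟨ S.+-cong (S.*-cong (ε-var zero) (ε-constant (linearForm (N i))))
               (S.+-cong (ε-var (suc i)) (S.-‿cong (SC.combination-congʳ (N i) λ j → ε-var (suc j)))) ⟩
        S.1# S.* linearForm (N i) S.+ (var K n i S.- linearForm (N i))
          ≈⟨ S.+-cong (S.*-identityˡ _) (S.+-comm _ _) ⟩
        linearForm (N i) S.+ (S.- linearForm (N i) S.+ var K n i)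
          ≈⟨ S.+-assoc _ _ _ ⟨
        (linearForm (N i) S.- linearForm (N i)) S.+ var K n i
          ≈⟨ S.trans (S.+-congʳ (S.-‿inverseʳ _)) (S.+-identityˡ _) ⟩
        var K n i ∎

  -- The hypothesis on the coefficients says that I is homogeneous in the forms vanishing
  -- on X and is extended from the ring generated by these forms.
  module _ {q} {I : Pred S.Carrier q} (ideal : IdealTheory.IsIdeal S I)
           (closed : ∀ {g} → g ∈ I → ∀ e → MultiCoefficients.mcoeff S (suc n) e (Φ g) ∈ I) where

    private
      open MultiCoefficients S
      module I = IdealTheory.IsIdeal ideal
      module Iᵀ = IdealTheory.IsIdeal (extension-isIdeal ideal (suc n))

      constant-nonZeroDivisor : ∀ a → ¬ (a K.≈ K.0#) → NonZeroDivisorMod S I (constant K n a)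
      constant-nonZeroDivisor a a≉0 b ab∈ with inverse a
      ... | inj₁ a≈0          = contradiction a≈0 a≉0
      ... | inj₂ (a⁻¹ , a⁻¹a≈1) = I.resp
        (S.trans (S.sym (S.*-assoc _ _ _)) (S.trans (S.*-congʳ
          (S.trans (S.sym (κ.*-homo a⁻¹ a)) (S.trans (κ.cong a⁻¹a≈1) κ.1#-homo))) (S.*-identityˡ b)))
        (I.*-closed (constant K n a⁻¹) ab∈)
        where module κ = HomProperties K S κ-hom

    -- By `closed`, Φ carries s * b into the extension of I to T. There Φ s can be cancelled,
    -- because its constant term in t is a non-zero polynomial in w over K, and ε brings Φ b back to
    -- b.
    nonZeroDivisor : ∀ s → ¬ (σ s S.≈ S.0#) → NonZeroDivisorMod S I s
    nonZeroDivisor s σs≉0 b sb∈ = I.resp (ε-Φ b)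
      (evaluate∈ ideal (idHom S) ideal (λ a∈ → a∈) (suc n) (S.1# Vector.∷ var K n) (Φ b)
        (coeff₀-nonZeroDivisor Sₙ (extension-isIdeal ideal n) (Φ s) coeff₀-nzd (Φ b)
          (Iᵀ.resp (Φ.*-homo s b) (mcoeff∈⇒∈Extension ideal (suc n) (closed sb∈)))))
      where
      module Iₙ = IdealTheory.IsIdeal (extension-isIdeal ideal n)
      coeff₀-nzd : NonZeroDivisorMod Sₙ (Extension ideal n) (coeff (Φ s) 0)
      coeff₀-nzd b ab∈ = mapCoeff-nonZeroDivisor ideal decide constant-nonZeroDivisor n (σ s) σs≉0 b
        (Iₙ.resp (Sₙ.*-congʳ (coeff₀-Φ s)) ab∈)

-- Logarithmic forms and residues

module Subtraction {c ℓ} (R : CommutativeRing c ℓ) where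

  open CommutativeRing R
  open SetoidReasoning setoid

  x-y+y≈x : ∀ x y → x - y + y ≈ x
  x-y+y≈x x y = begin
    x - y + y      ≈⟨ +-assoc x (- y) y ⟩
    x + (- y + y)  ≈⟨ +-congˡ (-‿inverseˡ y) ⟩
    x + 0#         ≈⟨ +-identityʳ x ⟩
    x              ∎

  x≈y+z⇒x-y≈z : ∀ {x y z} → x ≈ y + z → x - y ≈ z
  x≈y+z⇒x-y≈z {x} {y} {z} e = begin
    x - y          ≈⟨ +-congʳ (trans e (+-comm y z)) ⟩
    z + y - y      ≈⟨ +-assoc z y (- y) ⟩
    z + (y - y)    ≈⟨ +-congˡ (-‿inverseʳ y) ⟩
    z + 0#         ≈⟨ +-identityʳ z ⟩
    z              ∎

  x-y≈z⇒x≈y+z : ∀ {x y z} → x - y ≈ z → x ≈ y + z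
  x-y≈z⇒x≈y+z {x} {y} {z} e = begin
    x          ≈⟨ x-y+y≈x x y ⟨
    x - y + y  ≈⟨ +-comm _ y ⟩
    y + (x - y) ≈⟨ +-congˡ e ⟩
    y + z      ∎

-- The basis of row vectors obtained from the standard one by putting α in place of the
-- j₀-th member.
module ExchangeBasis {c ℓ} (K : CommutativeRing c ℓ) {n} (α : Vector (CommutativeRing.Carrier K) n)
                     (j₀ : Fin n) (b : CommutativeRing.Carrier K)
                     (bα≈1 : CommutativeRing._≈_ K (CommutativeRing._*_ K b (α j₀)) (CommutativeRing.1# K))
                     where

  private
    module K = CommutativeRing K
    module δᴷ = FiniteSum K
  open δᴷ using (δ; δ-refl)

  m : Vector K.Carrier n
  m j = α j K.- δ j₀ j

  β : Fin n → Vector K.Carrier n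
  β i j = δ i j K.+ δ i j₀ K.* m j

  β-j₀ : ∀ j → β j₀ j K.≈ α j
  β-j₀ j = begin
    δ j₀ j K.+ δ j₀ j₀ K.* m j  ≈⟨ K.+-congˡ (K.trans (K.*-congʳ (δ-refl j₀)) (K.*-identityˡ _)) ⟩
    δ j₀ j K.+ m j              ≈⟨ K.+-comm _ _ ⟩
    m j K.+ δ j₀ j              ≈⟨ Subtraction.x-y+y≈x K _ _ ⟩
    α j                         ∎
    where open SetoidReasoning K.setoid

  module _ {e ℓe} (B : CommutativeRing e ℓe) {κ} (κ-hom : Hom K B κ) where

    private
      module κ = HomProperties K B κ-hom
      module δᴮ = FiniteSum B
    open CommutativeRing B hiding (zero)
    open Sum semiring
    open SetoidReasoning setoid

    sum-κδ : ∀ {n} (x : Vector Carrier n) j → sum (λ i → x i * κ (δ i j)) ≈ x j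
    sum-κδ x j = trans
      (δᴮ.sum-cong (λ i → x i * κ (δ i j)) (λ i → x i * δᴮ.δ i j) λ i → *-congˡ (hom-δ K B κ-hom i j))
      (δᴮ.sum-δ x j)

    sum-β : ∀ (x : Vector Carrier n) j → sum (λ i → x i * κ (β i j)) ≈ x j + x j₀ * κ (m j)
    sum-β x j = begin
      sum (λ i → x i * κ (β i j))
        ≈⟨ δᴮ.sum-cong (λ i → x i * κ (β i j)) (λ i → x i * κ (δ i j) + x i * κ (δ i j₀) * κ (m j)) split ⟩
      sum (λ i → x i * κ (δ i j) + x i * κ (δ i j₀) * κ (m j))
        ≈⟨ ∑-distrib-+ (λ i → x i * κ (δ i j)) (λ i → x i * κ (δ i j₀) * κ (m j)) ⟩
      sum (λ i → x i * κ (δ i j)) + sum (λ i → x i * κ (δ i j₀) * κ (m j))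
        ≈⟨ +-cong (sum-κδ x j) (sym (*-distribʳ-sum (κ (m j)) (λ i → x i * κ (δ i j₀)))) ⟩
      x j + sum (λ i → x i * κ (δ i j₀)) * κ (m j)
        ≈⟨ +-congˡ (*-congʳ (sum-κδ x j₀)) ⟩
      x j + x j₀ * κ (m j) ∎
      where
      split : ∀ i → x i * κ (β i j) ≈ x i * κ (δ i j) + x i * κ (δ i j₀) * κ (m j)
      split i = trans (*-congˡ (trans (κ.+-homo _ _) (+-congˡ (κ.*-homo _ _))))
        (trans (distribˡ _ _ _) (+-congˡ (sym (*-assoc _ _ _))))

    -- The coefficient of α has to be b x_{j₀}, and the others x_i - b x_{j₀} α_i. One formula
    -- covers both, since m agrees with α except at j₀, where it is smaller by 1.
    coordinates : Vector Carrier n → Vector Carrier n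
    coordinates x i = x i - (κ b * x j₀) * κ (m i)

    coordinates-j₀ : ∀ x → coordinates x j₀ ≈ κ b * x j₀
    coordinates-j₀ x = Subtraction.x≈y+z⇒x-y≈z B (sym (begin
      (κ b * x j₀) * κ (m j₀) + κ b * x j₀
        ≈⟨ solve 3 (λ b x m → (b :* x) :* m :+ b :* x := (b :* (m :+ con 1)) :* x) refl (κ b) (x j₀) (κ (m j₀)) ⟩
      (κ b * (κ (m j₀) + 1#)) * x j₀
        ≈⟨ *-congʳ (*-congˡ (trans (+-congˡ (sym κ.1#-homo)) (sym (κ.+-homo _ _)))) ⟩
      (κ b * κ (m j₀ K.+ K.1#)) * x j₀
        ≈⟨ *-congʳ (trans (sym (κ.*-homo _ _)) (trans (κ.cong bm+b≈1) κ.1#-homo)) ⟩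
      1# * x j₀
        ≈⟨ *-identityˡ _ ⟩
      x j₀ ∎))
      where
      open SemiringSolver commutativeSemiring
      bm+b≈1 : b K.* (m j₀ K.+ K.1#) K.≈ K.1#
      bm+b≈1 = K.trans (K.*-congˡ (K.trans (K.+-congˡ (K.sym (δ-refl j₀))) (Subtraction.x-y+y≈x K _ _))) bα≈1

    sum-coordinates : ∀ x j → x j ≈ sum (λ i → coordinates x i * κ (β i j))
    sum-coordinates x j = sym (begin
      sum (λ i → coordinates x i * κ (β i j))       ≈⟨ sum-β (coordinates x) j ⟩
      coordinates x j + coordinates x j₀ * κ (m j)  ≈⟨ +-congˡ (*-congʳ (coordinates-j₀ x)) ⟩
      coordinates x j + (κ b * x j₀) * κ (m j)      ≈⟨ Subtraction.x-y+y≈x B _ _ ⟩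
      x j                                           ∎)

  independent : ∀ (a : Vector K.Carrier n) →
                (∀ j → Sum.sum K.semiring (λ i → a i K.* β i j) K.≈ K.0#) → ∀ i → a i K.≈ K.0#
  independent a aβ≈0 i = begin
    a i                    ≈⟨ K.+-identityʳ _ ⟨
    a i K.+ K.0#           ≈⟨ K.+-congˡ (K.trans (K.*-congʳ a₀≈0) (K.zeroˡ _)) ⟨
    a i K.+ a j₀ K.* m i   ≈⟨ relation i ⟩
    K.0#                   ∎
    where
    open SetoidReasoning K.setoid
    open SemiringSolver K.commutativeSemiring
    relation : ∀ j → a j K.+ a j₀ K.* m j K.≈ K.0#
    relation j = K.trans (K.sym (sum-β K (idHom K) a j)) (aβ≈0 j)
    a₀≈0 : a j₀ K.≈ K.0#
    a₀≈0 = begin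
      a j₀                            ≈⟨ K.trans (K.*-congʳ bα≈1) (K.*-identityˡ _) ⟨
      b K.* α j₀ K.* a j₀             ≈⟨ K.*-congʳ (K.*-congˡ (β-j₀ j₀)) ⟨
      b K.* β j₀ j₀ K.* a j₀          ≈⟨ K.*-congʳ (K.*-congˡ (K.+-cong (δ-refl j₀) (K.*-congʳ (δ-refl j₀)))) ⟩
      b K.* (K.1# K.+ K.1# K.* m j₀) K.* a j₀
        ≈⟨ solve 3 (λ b m a → b :* (con 1 :+ con 1 :* m) :* a := b :* (a :+ a :* m)) K.refl b (m j₀) (a j₀) ⟩
      b K.* (a j₀ K.+ a j₀ K.* m j₀)  ≈⟨ K.trans (K.*-congˡ (relation j₀)) (K.zeroʳ b) ⟩
      K.0#                            ∎

module Residues {c ℓ₁ ℓ₂ : Level} (em : ExcludedMiddle (lsuc (c ⊔ ℓ₁)))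
                (K : HeytingField c ℓ₁ ℓ₂) (n : ℕ) where

  open Arrangements em K n
  private module F = HeytingField K

  inverse : HasInverses Kᴿ
  inverse a with decide (∃[ b ] b K.* a K.≈ K.1#)
  ... | yes inv = inj₂ inv
  ... | no ¬inv = inj₁ (proj₁ (F.tight a K.0#) λ a#0 → ¬inv (invert (F.#⇒invertible a#0)))
    where
    a-0≈a : a K.- K.0# K.≈ a
    a-0≈a = K.trans (K.+-congˡ (RingProperties.-0#≈0# K.ring)) (K.+-identityʳ a)
    invert : ∃[ b ] (b K.* (a K.- K.0#) K.≈ K.1# × (a K.- K.0#) K.* b K.≈ K.1#) → ∃[ b ] b K.* a K.≈ K.1#
    invert (b , ba≈1 , _) = b , K.trans (K.*-congˡ (K.sym a-0≈a)) ba≈1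

  invertible-coordinate : ∀ (α : V*) → ¬ (∀ i → α i K.≈ K.0#) → ∃[ j ] ∃[ b ] b K.* α j K.≈ K.1#
  invertible-coordinate α α≉0 with decide (∃[ j ] ∃[ b ] b K.* α j K.≈ K.1#)
  ... | yes found = found
  ... | no ¬found = contradiction (λ i → zero? i (inverse (α i))) α≉0
    where
    zero? : ∀ i → α i K.≈ K.0# ⊎ (∃[ b ] b K.* α i K.≈ K.1#) → α i K.≈ K.0#
    zero? i (inj₁ αᵢ≈0) = αᵢ≈0
    zero? i (inj₂ inv)  = contradiction (i , inv) ¬found

  -- Spanning gives a matrix A with A β = 1. Then (β A - 1) β = 0, so independence yields β A = 1,
  -- and column i₀ of A is the required vector.
  dual-vector : ∀ {β} → IsBasis β → ∀ i₀ →
                Σ V λ v → ∀ i → ⟨ v , β i ⟩ K.≈ FiniteSum.δ Kᴿ i i₀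
  dual-vector {β} basis i₀ = (λ j → A j i₀) , λ i → begin
    ⟨ (λ j → A j i₀) , β i ⟩   ≈⟨ sum-cong (λ j → A j i₀ K.* β i j) (λ j → β i j K.* A j i₀) (λ j → K.*-comm _ _) ⟩
    BA i i₀                    ≈⟨ BA≈I i i₀ ⟩
    δ i i₀                     ∎
    where
    open IsBasis basis
    open FiniteSum Kᴿ
    open LinearCombination Kᴿ Kᴿ (idHom Kᴿ)
    open SetoidReasoning K.setoid
    A : Fin n → V
    A j = proj₁ (spanning (δ j))
    BA : Fin n → Fin n → K.Carrier
    BA i m = sumᴷ λ j → β i j K.* A j m
    BA≈I : ∀ i m → BA i m K.≈ δ i m
    BA≈I i m = RingProperties.x∙y⁻¹≈ε⇒x≈y K.ring _ _ (independent (λ m → BA i m K.- δ i m) difference m)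
      where
      difference : ∀ k → combination (λ m → BA i m K.- δ i m) (λ m → β m k) K.≈ K.0#
      difference k = begin
        combination (λ m → BA i m K.- δ i m) (λ m → β m k)
          ≈⟨ combination-+ˡ (BA i) (λ m → K.- δ i m) (λ m → β m k) ⟩
        combination (BA i) (λ m → β m k) K.+ combination (λ m → K.- δ i m) (λ m → β m k)
          ≈⟨ K.+-cong (K.sym (combination-combination (β i) A (λ m → β m k))) (K.trans
               (sum-cong (λ m → K.- δ i m K.* β m k) (λ m → β m k K.* K.- δ i m) (λ m → K.*-comm _ _))
               (combination-‿ʳ (λ m → β m k) (δ i))) ⟩
        combination (β i) (λ j → combination (A j) (λ m → β m k)) K.- combination (λ m → β m k) (δ i)
          ≈⟨ K.+-cong (K.trans (combination-congʳ (β i) λ j → K.sym (proj₂ (spanning (δ j)) k)) (sum-δ (β i) k))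
               (K.-‿cong (K.trans (sum-cong (λ m → β m k K.* δ i m) (λ m → β m k K.* δ m i)
                 (λ m → K.*-congˡ (δ-sym i m))) (sum-δ (λ m → β m k) i))) ⟩
        β i k K.- β i k
          ≈⟨ K.-‿inverseʳ _ ⟩
        K.0# ∎

  κ-hom : Hom Kᴿ S (constant Kᴿ n)
  κ-hom = constant-hom Kᴿ n
  module κ = HomProperties Kᴿ S κ-hom

  -- Congruence of η with ψ dα modulo α. Unlike the wedge condition it names the factor ψ that
  -- carries the residue; it is also linear in η and ψ and is checked in each coordinate, so it
  -- survives taking coefficients.
  Proportional : V* → Ω¹ → S.Carrier → Set (c ⊔ ℓ₁)
  Proportional α η ψ = ∀ j → ∃[ r ] η j S.≈ ψ S.* d α j S.+ linear α S.* r

  open SemiringSolver S.commutativeSemiring using (solve; _:=_; _:+_; _:*_; con)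
  open SetoidReasoning S.setoid

  proportional-+ : ∀ {α η θ φ ψ} → Proportional α η φ → Proportional α θ ψ →
                   Proportional α (λ j → η j S.+ θ j) (φ S.+ ψ)
  proportional-+ {α} {η} {θ} {φ} {ψ} p q j with p j | q j
  ... | r , e | s , f = r S.+ s , S.trans (S.+-cong e f)
    (solve 6 (λ φ ψ a l r s → (φ :* a :+ l :* r) :+ (ψ :* a :+ l :* s) := (φ :+ ψ) :* a :+ l :* (r :+ s))
      S.refl φ ψ (d α j) (linear α) r s)

  proportional-* : ∀ {α η ψ} s → Proportional α η ψ → Proportional α (λ j → s S.* η j) (s S.* ψ)
  proportional-* {α} {η} {ψ} s p j with p j
  ... | r , e = s S.* r , S.trans (S.*-congˡ e)
    (solve 5 (λ s ψ a l r → s :* (ψ :* a :+ l :* r) := (s :* ψ) :* a :+ l :* (s :* r))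
      S.refl s ψ (d α j) (linear α) r)

  proportional-0 : ∀ {α} (η : Ω¹) → Proportional α (λ j → linear α S.* η j) S.0#
  proportional-0 {α} η j = η j , S.sym (S.trans (S.+-congʳ (S.zeroˡ _)) (S.+-identityˡ _))

  proportional-resp : ∀ {α η θ ψ} → (∀ j → η j S.≈ θ j) → Proportional α η ψ → Proportional α θ ψ
  proportional-resp η≈θ p j = proj₁ (p j) , S.trans (S.sym (η≈θ j)) (proj₂ (p j))

  proportional-cong : ∀ {α η φ ψ} u → φ S.≈ ψ S.+ linear α S.* u → Proportional α η φ → Proportional α η ψ
  proportional-cong {α} {η} {φ} {ψ} u φ≈ p j with p j
  ... | r , e = r S.+ u S.* d α j , S.trans e (S.trans (S.+-congʳ (S.*-congʳ φ≈))
    (solve 5 (λ ψ a l r u → (ψ :+ l :* u) :* a :+ l :* r := ψ :* a :+ l :* (r :+ u :* a))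
      S.refl ψ (d α j) (linear α) r u))

  -- The coordinates of the wedge product that involve an index j₀ with α j₀ invertible say that η_j
  -- α_{j₀} and η_{j₀} α_j agree modulo α. Division by α_{j₀} gives the factor b η_{j₀}.
  ∧⇒proportional : ∀ {α η} → ¬ (∀ i → α i K.≈ K.0#) → (η ∧ d α) ∈ linear α ·Ω² → ∃[ ψ ] Proportional α η ψ
  ∧⇒proportional {α} {η} α≉0 (θ , η∧dα≈) with invertible-coordinate α α≉0
  ... | j₀ , b , bα≈1 = constant Kᴿ n b S.* η j₀ , λ j → normalise j (swap j)
    where
    swap : ∀ j → ∃[ r ] η j S.* d α j₀ S.≈ η j₀ S.* d α j S.+ linear α S.* r
    swap j with Fin.<-cmp j j₀
    ... | tri< j<j₀ _ _   = θ j j₀ j<j₀ , Subtraction.x-y≈z⇒x≈y+z S (η∧dα≈ j j₀ j<j₀)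
    ... | tri≈ _ ≡.refl _ = S.0# , S.sym (S.trans (S.+-congˡ (S.zeroʳ _)) (S.+-identityʳ _))
    ... | tri> _ _ j₀<j   = S.- θ j₀ j j₀<j , S.sym (begin
      η j₀ S.* d α j S.+ linear α S.* (S.- θ j₀ j j₀<j)
        ≈⟨ S.+-cong (Subtraction.x-y≈z⇒x≈y+z S (η∧dα≈ j₀ j j₀<j))
             (S.sym (RingProperties.-‿distribʳ-* S.ring (linear α) (θ j₀ j j₀<j))) ⟩
      (η j S.* d α j₀ S.+ linear α S.* θ j₀ j j₀<j) S.- linear α S.* θ j₀ j j₀<j
        ≈⟨ Subtraction.x≈y+z⇒x-y≈z S (S.+-comm _ _) ⟩
      η j S.* d α j₀ ∎)
    normalise : ∀ j → (∃[ r ] η j S.* d α j₀ S.≈ η j₀ S.* d α j S.+ linear α S.* r) →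
                ∃[ r ] η j S.≈ (constant Kᴿ n b S.* η j₀) S.* d α j S.+ linear α S.* r
    normalise j (r , e) = constant Kᴿ n b S.* r , (begin
      η j
        ≈⟨ S.*-identityˡ _ ⟨
      S.1# S.* η j
        ≈⟨ S.*-congʳ (S.trans (S.sym (κ.*-homo b (α j₀))) (S.trans (κ.cong bα≈1) κ.1#-homo)) ⟨
      constant Kᴿ n b S.* d α j₀ S.* η j
        ≈⟨ solve 3 (λ b a x → b :* a :* x := b :* (x :* a)) S.refl (constant Kᴿ n b) (d α j₀) (η j) ⟩
      constant Kᴿ n b S.* (η j S.* d α j₀)
        ≈⟨ S.*-congˡ e ⟩
      constant Kᴿ n b S.* (η j₀ S.* d α j S.+ linear α S.* r)
        ≈⟨ solve 5 (λ b x a l r → b :* (x :* a :+ l :* r) := (b :* x) :* a :+ l :* (b :* r))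
             S.refl (constant Kᴿ n b) (η j₀) (d α j) (linear α) r ⟩
      (constant Kᴿ n b S.* η j₀) S.* d α j S.+ linear α S.* (constant Kᴿ n b S.* r) ∎)

  -- As dα ∧ dα = 0, only the part α r of η contributes, and the quotient by α is r ∧ dα.
  proportional⇒∧ : ∀ {α η ψ} → Proportional α η ψ → (η ∧ d α) ∈ linear α ·Ω²
  proportional⇒∧ {α} {η} {ψ} p = (λ i j _ → r i S.* d α j S.- r j S.* d α i) , λ i j _ →
    Subtraction.x≈y+z⇒x-y≈z S (begin
      η i S.* d α j
        ≈⟨ S.*-congʳ (η≈ i) ⟩
      (ψ S.* d α i S.+ linear α S.* r i) S.* d α j
        ≈⟨ solve 5 (λ ψ a b l r → (ψ :* a :+ l :* r) :* b := ψ :* b :* a :+ (l :* (r :* b) :+ l :* con 0))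
             S.refl ψ (d α i) (d α j) (linear α) (r i) ⟩
      ψ S.* d α j S.* d α i S.+ (linear α S.* (r i S.* d α j) S.+ linear α S.* S.0#)
        ≈⟨ S.+-congˡ (S.+-congˡ (S.*-congˡ (S.-‿inverseʳ (r j S.* d α i)))) ⟨
      ψ S.* d α j S.* d α i S.+ (linear α S.* (r i S.* d α j) S.+ linear α S.* (r j S.* d α i S.- r j S.* d α i))
        ≈⟨ solve 7 (λ ψ a b l r s m → ψ :* b :* a :+ (l :* (r :* b) :+ l :* (s :* a :+ m))
                                      := (ψ :* b :+ l :* s) :* a :+ l :* (r :* b :+ m))
             S.refl ψ (d α i) (d α j) (linear α) (r i) (r j) (S.- (r j S.* d α i)) ⟩
      (ψ S.* d α j S.+ linear α S.* r j) S.* d α i S.+ linear α S.* (r i S.* d α j S.- r j S.* d α i)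
        ≈⟨ S.+-congʳ (S.*-congʳ (η≈ j)) ⟨
      η j S.* d α i S.+ linear α S.* (r i S.* d α j S.- r j S.* d α i) ∎)
    where
    r : Fin n → S.Carrier
    r j = proj₁ (p j)
    η≈ : ∀ j → η j S.≈ ψ S.* d α j S.+ linear α S.* r j
    η≈ j = proj₂ (p j)

  module ResidueAt (αᴴ : V*) where

    open AtHyperplane αᴴ

    ≈̄⇒ : ∀ {x y} → x S̄.≈ y → ∃[ r ] x S.≈ y S.+ linear αᴴ S.* r
    ≈̄⇒ (Quotient.congruent (q RawMagmaDefinitions., e)) =
      q , Subtraction.x-y≈z⇒x≈y+z S (S.trans (S.sym e) (S.*-comm _ _))

    ⇒≈̄ : ∀ {x y} r → x S.≈ y S.+ linear αᴴ S.* r → x S̄.≈ y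
    ⇒≈̄ r e = Quotient.congruent (r RawMagmaDefinitions.,
      S.trans (S.*-comm _ _) (S.sym (Subtraction.x≈y+z⇒x-y≈z S e)))

    ≈⇒≈̄ : ∀ {x y} → x S.≈ y → x S̄.≈ y
    ≈⇒≈̄ = ≈⇒≈ₐ S (linear αᴴ)

    -- For `forms 𝒜` this unfolds to the same list as `restriction 𝒜`; taking a bare list makes it
    -- applicable to filtered lists without their proofs.
    restrictionForms : List V* → List V*
    restrictionForms L = deduplicate (λ α β → decide ((Ker αᴴ ∩ Ker α) ≐ (Ker αᴴ ∩ Ker β)))
      (filter (λ α → decide (¬ (Ker α ≐ Ker αᴴ))) L)

    -- A logarithmic form is proportional to dαᴴ modulo αᴴ, and the factor determines the
    -- residue, so that no basis of V* is needed.
    Residue : List V* → Pred S̄.Carrier (c ⊔ ℓ₁)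
    Residue L g = ∃[ η ] All (λ α → ∃[ ψ ] Proportional α η ψ) L ×
                         Proportional αᴴ η (Q (restrictionForms L) S.* g)

    proportional-cong-≈̄ : ∀ {η φ ψ} → φ S̄.≈ ψ → Proportional αᴴ η φ → Proportional αᴴ η ψ
    proportional-cong-≈̄ φ≈ψ = proportional-cong (proj₁ (≈̄⇒ φ≈ψ)) (proj₂ (≈̄⇒ φ≈ψ))

    residue-isIdeal : ∀ L → IsIdeal (Residue L)
    residue-isIdeal L = record
      { resp     = λ { x≈y (η , logs , res) → η , logs , proportional-cong-≈̄ (S̄.*-congˡ x≈y) res }
      ; 0∈       = (λ _ → S.0#) , All.universal (λ α → S.0# , zero-proportional α) L
                 , proportional-cong-≈̄ (≈⇒≈̄ (S.sym (S.zeroʳ _))) (zero-proportional αᴴ)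
      ; +-closed = λ { (η , logs , res) (θ , logs′ , res′) → (λ j → η j S.+ θ j)
                 , All.zipWith (λ { ((φ , p) , (ψ , q)) → φ S.+ ψ , proportional-+ p q }) (logs , logs′)
                 , proportional-cong-≈̄ (≈⇒≈̄ (S.sym (S.distribˡ _ _ _))) (proportional-+ res res′) }
      ; *-closed = λ { r (η , logs , res) → (λ j → r S.* η j)
                 , All.map (λ { (ψ , p) → r S.* ψ , proportional-* r p }) logs
                 , proportional-cong-≈̄ (≈⇒≈̄ (solve 3 (λ r q g → r :* (q :* g) := q :* (r :* g)) S.refl r _ _))
                     (proportional-* r res) } }
      where
      zero-proportional : ∀ α → Proportional α (λ _ → S.0#) S.0#
      zero-proportional α j = S.0# , S.sym (S.trans (S.+-cong (S.zeroˡ _) (S.zeroʳ _)) (S.+-identityˡ _))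

    -- Pairing η with the vector dual to the basis member αᴴ gives φ i₀ by the expansion in the
    -- basis, and ψ modulo αᴴ by proportionality, so the two factors agree in the quotient.
    J⊆residue : ∀ 𝒜 → αᴴ ∈ˡ forms 𝒜 → J 𝒜 ⊆ Residue (forms 𝒜)
    J⊆residue 𝒜 αᴴ∈𝒜 {g} (η , η∈ , β , i₀ , φ , basis , βi₀≈αᴴ , η≈ , φ≈̄) =
      η , logs , proportional-cong-≈̄ (S̄.trans ψ≈̄φ φ≈̄) η-ψ
      where
      logs : All (λ α → ∃[ ψ ] Proportional α η ψ) (forms 𝒜)
      logs = All.zipWith (λ { (α≉0 , η∧dα) → ∧⇒proportional α≉0 η∧dα }) (nonzero 𝒜 , η∈)
      ψ : S.Carrier
      ψ = proj₁ (All.lookup logs αᴴ∈𝒜)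
      η-ψ : Proportional αᴴ η ψ
      η-ψ = proj₂ (All.lookup logs αᴴ∈𝒜)
      r : Fin n → S.Carrier
      r j = proj₁ (η-ψ j)
      v : V
      v = proj₁ (dual-vector basis i₀)
      ⟨v,β⟩ : ∀ i → ⟨ v , β i ⟩ K.≈ FiniteSum.δ Kᴿ i i₀
      ⟨v,β⟩ = proj₂ (dual-vector basis i₀)
      open LinearCombination Kᴿ S κ-hom
      open FiniteSum Kᴿ using (δ)
      module δˢ = FiniteSum S
      v·η≈φ : combination v η S.≈ φ i₀
      v·η≈φ = begin
        combination v η
          ≈⟨ combination-congʳ v (λ j → S.trans (η≈ j)
               (δˢ.sum-cong (λ i → φ i S.* d (β i) j) (λ i → d (β i) j S.* φ i) λ i → S.*-comm _ _)) ⟩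
        combination v (λ j → combination (λ i → β i j) φ)
          ≈⟨ combination-combination v (λ j i → β i j) φ ⟩
        combination (λ i → ⟨ v , β i ⟩) φ
          ≈⟨ combination-congˡ φ ⟨v,β⟩ ⟩
        combination (λ i → δ i i₀) φ
          ≈⟨ δˢ.sum-cong (λ i → constant Kᴿ n (δ i i₀) S.* φ i) (λ i → φ i S.* δˢ.δ i i₀)
               (λ i → S.trans (S.*-comm _ _) (S.*-congˡ (hom-δ Kᴿ S κ-hom i i₀))) ⟩
        Sum.sum S.semiring (λ i → φ i S.* δˢ.δ i i₀)
          ≈⟨ δˢ.sum-δ φ i₀ ⟩
        φ i₀ ∎
      v·η≈ψ : combination v η S.≈ ψ S.+ linear αᴴ S.* combination v r
      v·η≈ψ = begin
        combination v η
          ≈⟨ combination-congʳ v (λ j → proj₂ (η-ψ j)) ⟩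
        combination v (λ j → ψ S.* d αᴴ j S.+ linear αᴴ S.* r j)
          ≈⟨ combination-+ʳ v (λ j → ψ S.* d αᴴ j) (λ j → linear αᴴ S.* r j) ⟩
        combination v (λ j → ψ S.* d αᴴ j) S.+ combination v (λ j → linear αᴴ S.* r j)
          ≈⟨ S.+-cong (combination-*ʳ v ψ (d αᴴ)) (combination-*ʳ v (linear αᴴ) r) ⟩
        ψ S.* combination v (d αᴴ) S.+ linear αᴴ S.* combination v r
          ≈⟨ S.+-congʳ (S.*-congˡ v·αᴴ≈1) ⟩
        ψ S.* S.1# S.+ linear αᴴ S.* combination v r
          ≈⟨ S.+-congʳ (S.*-identityʳ ψ) ⟩
        ψ S.+ linear αᴴ S.* combination v r ∎
        where
        v·αᴴ≈1 : combination v (d αᴴ) S.≈ S.1#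
        v·αᴴ≈1 = begin
          combination v (d αᴴ)
            ≈⟨ δˢ.sum-cong (λ j → constant Kᴿ n (v j) S.* d αᴴ j) (λ j → constant Kᴿ n (v j K.* αᴴ j))
                 (λ j → S.sym (κ.*-homo (v j) (αᴴ j))) ⟩
          Sum.sum S.semiring (λ j → constant Kᴿ n (v j K.* αᴴ j))
            ≈⟨ κ-sum (λ j → v j K.* αᴴ j) ⟨
          constant Kᴿ n ⟨ v , αᴴ ⟩
            ≈⟨ κ.cong (K.trans (K.sym (FiniteSum.sum-cong Kᴿ (λ j → v j K.* β i₀ j) (λ j → v j K.* αᴴ j)
                 λ j → K.*-congˡ (βi₀≈αᴴ j))) (K.trans (⟨v,β⟩ i₀) (FiniteSum.δ-refl Kᴿ i₀))) ⟩
          constant Kᴿ n K.1#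
            ≈⟨ κ.1#-homo ⟩
          S.1# ∎
      ψ≈̄φ : ψ S̄.≈ φ i₀
      ψ≈̄φ = S̄.sym (⇒≈̄ (combination v r) (S.trans (S.sym v·η≈φ) v·η≈ψ))

    -- In the basis obtained by exchanging one coordinate form for αᴴ, the coefficient of dαᴴ is b
    -- η_{j₀}. This is congruent to b α_{j₀} times the given factor, and b α_{j₀} = 1.
    residue⊆J : ∀ 𝒜 → ¬ (∀ i → αᴴ i K.≈ K.0#) → Residue (forms 𝒜) ⊆ J 𝒜
    residue⊆J 𝒜 αᴴ≉0 {g} (η , logs , res) with invertible-coordinate αᴴ αᴴ≉0
    ... | j₀ , b , bα≈1 = η , All.map (λ { (ψ , p) → proportional⇒∧ p }) logs
        , β , j₀ , coordinates S κ-hom η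
        , record { independent = independent
                 ; spanning = λ α → coordinates Kᴿ (idHom Kᴿ) α , sum-coordinates Kᴿ (idHom Kᴿ) α }
        , β-j₀ , sum-coordinates S κ-hom η
        , ⇒≈̄ (constant Kᴿ n b S.* proj₁ (res j₀)) φ≈
      where
      open ExchangeBasis Kᴿ αᴴ j₀ b bα≈1
      φ≈ : coordinates S κ-hom η j₀ S.≈ Q (restrictionForms (forms 𝒜)) S.* g
                                        S.+ linear αᴴ S.* (constant Kᴿ n b S.* proj₁ (res j₀))
      φ≈ = begin
        coordinates S κ-hom η j₀
          ≈⟨ coordinates-j₀ S κ-hom η ⟩
        constant Kᴿ n b S.* η j₀
          ≈⟨ S.*-congˡ (proj₂ (res j₀)) ⟩
        constant Kᴿ n b S.* (ψ S.* d αᴴ j₀ S.+ linear αᴴ S.* proj₁ (res j₀))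
          ≈⟨ solve 5 (λ b ψ a l r → b :* (ψ :* a :+ l :* r) := (b :* a) :* ψ :+ l :* (b :* r))
               S.refl (constant Kᴿ n b) ψ (d αᴴ j₀) (linear αᴴ) (proj₁ (res j₀)) ⟩
        (constant Kᴿ n b S.* d αᴴ j₀) S.* ψ S.+ linear αᴴ S.* (constant Kᴿ n b S.* proj₁ (res j₀))
          ≈⟨ S.+-congʳ (S.trans (S.*-congʳ (S.trans (S.sym (κ.*-homo b (αᴴ j₀)))
               (S.trans (κ.cong bα≈1) κ.1#-homo))) (S.*-identityˡ ψ)) ⟩
        ψ S.+ linear αᴴ S.* (constant Kᴿ n b S.* proj₁ (res j₀)) ∎
        where
        ψ = Q (restrictionForms (forms 𝒜)) S.* g

-- Localization of arrangements

module _ {a p} {A : Set a} {P : Pred A p} (P? : Decidable P) where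

  filter-comm : ∀ {q} {Q : Pred A q} (Q? : Decidable Q) xs →
                filter P? (filter Q? xs) ≡ filter Q? (filter P? xs)
  filter-comm Q? []       = ≡.refl
  filter-comm Q? (x ∷ xs) with P? x in Px | Q? x in Qx
  ... | no _  | no _  = filter-comm Q? xs
  ... | no _  | yes _ rewrite Px = filter-comm Q? xs
  ... | yes _ | no _  rewrite Qx = filter-comm Q? xs
  ... | yes _ | yes _ rewrite Px | Qx = ≡.cong (x ∷_) (filter-comm Q? xs)

  filter-absorb : ∀ {q} {Q : Pred A q} (Q? : Decidable Q) → (∀ {x} → P x → Q x) → ∀ xs →
                  filter P? (filter Q? xs) ≡ filter P? xs
  filter-absorb Q? P⇒Q []       = ≡.refl
  filter-absorb Q? P⇒Q (x ∷ xs) with P? x in Px | Q? x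
  ... | no _   | no _  = filter-absorb Q? P⇒Q xs
  ... | no _   | yes _ rewrite Px = filter-absorb Q? P⇒Q xs
  ... | yes px | no ¬q = contradiction (P⇒Q px) ¬q
  ... | yes _  | yes _ rewrite Px = ≡.cong (x ∷_) (filter-absorb Q? P⇒Q xs)

  -- An entry that x would remove as a duplicate satisfies P only if x does. So a discarded x has
  -- hidden nothing that the filter on the right would keep.
  filter-deduplicate : ∀ {r} {R : Rel A r} (R? : Binary.Decidable R) → (∀ {x y} → R x y → P y → P x) → ∀ xs →
                       filter P? (deduplicate R? xs) ≡ deduplicate R? (filter P? xs)
  filter-deduplicate R? resp []       = ≡.refl
  filter-deduplicate R? resp (x ∷ xs) with P? x
  ... | yes _  = ≡.cong (x ∷_) (≡.trans
    (filter-comm (λ y → ¬? (R? x y)) (deduplicate R? xs))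
    (≡.cong (filter (λ y → ¬? (R? x y))) (filter-deduplicate R? resp xs)))
  ... | no ¬px = ≡.trans
    (filter-absorb (λ y → ¬? (R? x y)) (λ py rxy → ¬px (resp rxy py)) (deduplicate R? xs))
    (filter-deduplicate R? resp xs)

module _ {a b} {A : Set a} {I : Set (lsuc b)} (em : ExcludedMiddle (lsuc b)) {P : I → Pred A b}
         (P? : ∀ i → Decidable (P i)) where

  -- Only finitely many sublists of xs arise, so a finite set of indices suffices.
  finite-filters : ∀ (xs : List A) (C : Pred I (lsuc b)) →
    Σ (List I) λ js → ∀ i → i ∈ C → Any (λ j → j ∈ C × filter (P? i) xs ≡ filter (P? j) xs) js
  finite-filters []       C with em {∃[ i ] i ∈ C}
  ... | yes (i , i∈) = (i ∷ []) , λ _ _ → here (i∈ , ≡.refl)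
  ... | no ¬C        = [] , λ i i∈ → contradiction (i , i∈) ¬C
  finite-filters (x ∷ xs) C
    -- C is split according to whether an index accepts x. Within each half the head is treated
    -- alike, so a cover for xs is a cover for x ∷ xs.
    with finite-filters xs (λ i → i ∈ C × P i x) | finite-filters xs (λ i → i ∈ C × ¬ P i x)
  ... | js , cover | ks , cover′ = js ++ ks , λ i i∈ → found i i∈ (P? i x)
    where
    found : ∀ i → i ∈ C → Dec (P i x) →
            Any (λ j → j ∈ C × filter (P? i) (x ∷ xs) ≡ filter (P? j) (x ∷ xs)) (js ++ ks)
    found i i∈ (yes pᵢ) = Any.++⁺ˡ (Any.map
      (λ { ((j∈ , pⱼ) , eq) → j∈ , ≡.trans (filter-accept (P? i) pᵢ)
        (≡.trans (≡.cong (x ∷_) eq) (≡.sym (filter-accept (P? _) pⱼ))) }) (cover i (i∈ , pᵢ)))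
    found i i∈ (no ¬pᵢ) = Any.++⁺ʳ js (Any.map
      (λ { ((j∈ , ¬pⱼ) , eq) → j∈ , ≡.trans (filter-reject (P? i) ¬pᵢ)
        (≡.trans eq (≡.sym (filter-reject (P? _) ¬pⱼ))) }) (cover′ i (i∈ , ¬pᵢ)))

-- Comparison of the residue ideals of 𝒜 and 𝒜_X

module Localization {c ℓ₁ ℓ₂ : Level} (em : ExcludedMiddle (lsuc (c ⊔ ℓ₁)))
                     (K : HeytingField c ℓ₁ ℓ₂) (n : ℕ) where

  open Arrangements em K n
  open Residues em K n
  open LinearSubspaces Kᴿ decide inverse

  module _ {p} {P : Pred V* p} (P? : Decidable P) where

    Q-filter : ∀ L → Q L S.≈ Q (filter P? L) S.* Q (filter (λ α → ¬? (P? α)) L)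
    Q-filter []      = S.sym (S.*-identityˡ _)
    Q-filter (α ∷ L) with P? α
    ... | yes _ = S.trans (S.*-congˡ (Q-filter L)) (S.sym (S.*-assoc _ _ _))
    ... | no _  = S.trans (S.*-congˡ (Q-filter L))
      (solve 3 (λ a p q → a :* (p :* q) := p :* (a :* q)) S.refl (linear α) _ _)
      where open SemiringSolver S.commutativeSemiring

  linear∣Q : ∀ {α L} → α ∈ˡ L → ∃[ q ] Q L S.≈ linear α S.* q
  linear∣Q {L = β ∷ L} (here ≡.refl) = Q L , S.refl
  linear∣Q {α} {β ∷ L} (there α∈) with linear∣Q α∈
  ... | q , e = linear β S.* q , S.trans (S.*-congˡ e)
    (solve 3 (λ a b q → b :* (a :* q) := a :* (b :* q)) S.refl (linear α) (linear β) q)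
    where open SemiringSolver S.commutativeSemiring

  module _ (v : V) where

    evaluateAt : S.Carrier → K.Carrier
    evaluateAt = MultiEvaluation.evaluate Kᴿ Kᴿ (idHom Kᴿ) n v

    private
      at-hom : Hom S Kᴿ evaluateAt
      at-hom = MultiEvaluation.evaluate-hom Kᴿ Kᴿ (idHom Kᴿ) n v

    open HomProperties S Kᴿ at-hom

    evaluateAt-linear : ∀ α → evaluateAt (linear α) K.≈ ⟨ α , v ⟩
    evaluateAt-linear α = K.trans
      (hom-combination Kᴿ S Kᴿ κ-hom (idHom Kᴿ) at-hom
        (MultiEvaluation.evaluate-constant Kᴿ Kᴿ (idHom Kᴿ) n v) α (var Kᴿ n))
      (LinearCombination.combination-congʳ Kᴿ Kᴿ (idHom Kᴿ) α
        (MultiEvaluation.evaluate-var Kᴿ Kᴿ (idHom Kᴿ) n v))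

    module _ (αᴴ : V*) (v∈H : v ∈ Ker αᴴ) where

      open AtHyperplane αᴴ
      open ResidueAt αᴴ

      evaluateAt-cong : ∀ {x y} → x S̄.≈ y → evaluateAt x K.≈ evaluateAt y
      evaluateAt-cong {x} {y} x≈y with ≈̄⇒ x≈y
      ... | r , e = begin
        evaluateAt x
          ≈⟨ cong e ⟩
        evaluateAt (y S.+ linear αᴴ S.* r)
          ≈⟨ +-homo y _ ⟩
        evaluateAt y K.+ evaluateAt (linear αᴴ S.* r)
          ≈⟨ K.+-congˡ (*-homo (linear αᴴ) r) ⟩
        evaluateAt y K.+ evaluateAt (linear αᴴ) K.* evaluateAt r
          ≈⟨ K.+-congˡ (K.*-congʳ (K.trans (evaluateAt-linear αᴴ) v∈H)) ⟩
        evaluateAt y K.+ K.0# K.* evaluateAt r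
          ≈⟨ K.trans (K.+-congˡ (K.zeroˡ _)) (K.+-identityʳ _) ⟩
        evaluateAt y ∎
        where open SetoidReasoning K.setoid

      evaluateAt-P : ∀ X {g} → v ∈ ∣ X ∣ → g ∈ P[ X ] → evaluateAt g K.≈ K.0#
      evaluateAt-P X v∈X (generator (α , X⊆α , g≈α)) =
        K.trans (evaluateAt-cong g≈α) (K.trans (evaluateAt-linear α) (X⊆α v∈X))
      evaluateAt-P X v∈X (resp x≈y x∈)    = K.trans (K.sym (evaluateAt-cong x≈y)) (evaluateAt-P X v∈X x∈)
      evaluateAt-P X v∈X 0∈               = 0#-homo
      evaluateAt-P X v∈X (+-closed x∈ y∈) = K.trans (+-homo _ _)
        (K.trans (K.+-cong (evaluateAt-P X v∈X x∈) (evaluateAt-P X v∈X y∈)) (K.+-identityˡ _))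
      evaluateAt-P X v∈X (*-closed r x∈)  = K.trans (*-homo r _)
        (K.trans (K.*-congˡ (evaluateAt-P X v∈X x∈)) (K.zeroʳ _))

  module LocalizationAt (αᴴ : V*) where

    open AtHyperplane αᴴ
    open ResidueAt αᴴ

    generated-isIdeal : ∀ {p} {G : Pred S̄.Carrier p} → IsIdeal (Generated G)
    generated-isIdeal = record { resp = resp ; 0∈ = 0∈ ; +-closed = +-closed ; *-closed = *-closed }

    isIdealˢ : ∀ {p} {I : Pred S̄.Carrier p} → IsIdeal I → IdealTheory.IsIdeal S I
    isIdealˢ = isIdeal-quotient S (linear αᴴ)

    -- Every member of P_X vanishes at the points of X, over any field; the converse, which may fail
    -- over a finite field, is not at issue.
    linear∈⇒vanishes : ∀ {X α} → ∣ X ∣ ⊆ Ker αᴴ → linear α ∈ P[ X ] → ∣ X ∣ ⊆ Ker α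
    linear∈⇒vanishes {X} {α} X⊆H α∈ {v} v∈X =
      K.trans (K.sym (evaluateAt-linear v α)) (evaluateAt-P v αᴴ (X⊆H v∈X) X v∈X α∈)

    contains? : (X : Subspace) → Decidable (λ α → ∣ X ∣ ⊆ Ker α)
    contains? X α = decide (∣ X ∣ ⊆ Ker α)

    within outside : Subspace → List V* → List V*
    within X  = filter (contains? X)
    outside X = filter (λ α → ¬? (contains? X α))

    module Along (X : Subspace) (X⊆H : ∣ X ∣ ⊆ Ker αᴴ) where

      W : Pred V* (c ⊔ ℓ₁)
      W α = ∣ X ∣ ⊆ Ker α

      W-isLinearSubspace : IsLinearSubspace W
      W-isLinearSubspace = record
        { resp     = λ α≈β α⊥ {v} v∈ → K.trans (combination-congˡ v (λ i → K.sym (α≈β i))) (α⊥ v∈)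
        ; 0∈       = λ {v} _ → combination-0ˡ v
        ; +-closed = λ {α} {β} α⊥ β⊥ {v} v∈ → K.trans (combination-+ˡ α β v)
            (K.trans (K.+-cong (α⊥ v∈) (β⊥ v∈)) (K.+-identityˡ _))
        ; *-closed = λ a {α} α⊥ {v} v∈ → K.trans (combination-*ˡ a α v)
            (K.trans (K.*-congˡ (α⊥ v∈)) (K.zeroʳ a)) }
        where open LinearCombination Kᴿ Kᴿ (idHom Kᴿ)

      open Projection (projection n W-isLinearSubspace)
      open GradedSaturation Kᴿ (λ P → map′ lower lift (decide (Lift c P))) inverse n matrix
        using (T; Φ; Φ-hom; Φ-linearForm; Φ-constant; σ; σ≈0⇒∈) renaming (nonZeroDivisor to nzd)

      private
        module T = CommutativeRing T
        module Φ = HomProperties S T Φ-hom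
        open MultiCoefficients S
        Cᵀ : S.Carrier → T.Carrier
        Cᵀ = constant S (suc n)
        t : T.Carrier
        t = var S (suc n) zero

        Φ-linear : ∀ {α} → α ∈ W → Φ (linear α) T.≈ t T.* Cᵀ (linear α)
        Φ-linear {α} α∈ = Φ-linearForm α (fixes α∈)

        -- Each form in W acquires a factor t and is otherwise unchanged, so Φ (Q L) is Q L times
        -- the power of t with exponent `length L`.
        mcoeff-Q : ∀ {L} → All W L → ∀ k e x →
                   mcoeff (suc n) ((length L +ᴺ k) Vec.∷ e) (Φ (Q L) T.* x) S.≈ Q L S.* mcoeff (suc n) (k Vec.∷ e) x
        mcoeff-Q [] k e x = S.trans
          (mcoeff-cong (suc n) (k Vec.∷ e) {Φ S.1# T.* x} {x}
            (T.trans (T.*-congʳ {x} {Φ S.1#} {T.1#} Φ.1#-homo) (T.*-identityˡ x)))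
          (S.sym (S.*-identityˡ _))
        mcoeff-Q {α ∷ L} (α∈ ∷ L⊆W) k e x = begin
          mcoeff (suc n) (suc (length L +ᴺ k) Vec.∷ e) (Φ (linear α S.* Q L) T.* x)
            ≈⟨ mcoeff-cong (suc n) (suc (length L +ᴺ k) Vec.∷ e)
                 {Φ (linear α S.* Q L) T.* x} {t T.* (Cᵀ (linear α) T.* (Φ (Q L) T.* x))} factor ⟩
          mcoeff (suc n) (suc (length L +ᴺ k) Vec.∷ e) (t T.* (Cᵀ (linear α) T.* (Φ (Q L) T.* x)))
            ≈⟨ mcoeff-cong n e (Polynomial.coeff-≈ (PolynomialProperties.X⊗ (polynomialRing S n)
                 (Cᵀ (linear α) T.* (Φ (Q L) T.* x))) (suc (length L +ᴺ k))) ⟩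
          mcoeff (suc n) ((length L +ᴺ k) Vec.∷ e) (Cᵀ (linear α) T.* (Φ (Q L) T.* x))
            ≈⟨ mcoeff-constant* (suc n) ((length L +ᴺ k) Vec.∷ e) (linear α) (Φ (Q L) T.* x) ⟩
          linear α S.* mcoeff (suc n) ((length L +ᴺ k) Vec.∷ e) (Φ (Q L) T.* x)
            ≈⟨ S.*-congˡ (mcoeff-Q L⊆W k e x) ⟩
          linear α S.* (Q L S.* mcoeff (suc n) (k Vec.∷ e) x)
            ≈⟨ S.*-assoc _ _ _ ⟨
          linear α S.* Q L S.* mcoeff (suc n) (k Vec.∷ e) x ∎
          where
          open SetoidReasoning S.setoid
          factor : Φ (linear α S.* Q L) T.* x T.≈ t T.* (Cᵀ (linear α) T.* (Φ (Q L) T.* x))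
          factor = T.trans (T.*-congʳ {x} {Φ (linear α S.* Q L)} {(t T.* Cᵀ (linear α)) T.* Φ (Q L)}
              (T.trans (Φ.*-homo (linear α) (Q L))
                (T.*-congʳ {Φ (Q L)} {Φ (linear α)} {t T.* Cᵀ (linear α)} (Φ-linear α∈))))
            (T.trans (T.*-assoc (t T.* Cᵀ (linear α)) (Φ (Q L)) x)
              (T.*-assoc t (Cᵀ (linear α)) (Φ (Q L) T.* x)))

        -- Φ fixes the constants of dα and sends α to t α. The extra t joins the remainder, so the
        -- congruence modulo α holds in each coefficient.
        mcoeff-proportional : ∀ {α η ψ} → α ∈ W → Proportional α η ψ → ∀ e →
                              Proportional α (λ j → mcoeff (suc n) e (Φ (η j))) (mcoeff (suc n) e (Φ ψ))
        mcoeff-proportional {α} {η} {ψ} α∈ p e j with p j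
        ... | r , η≈ = mcoeff (suc n) e (t T.* Φ r) , (begin
          mcoeff (suc n) e (Φ (η j))
            ≈⟨ mcoeff-cong (suc n) e {Φ (η j)} {Cᵀ (d α j) T.* Φ ψ T.+ Cᵀ (linear α) T.* (t T.* Φ r)} expand ⟩
          mcoeff (suc n) e (Cᵀ (d α j) T.* Φ ψ T.+ Cᵀ (linear α) T.* (t T.* Φ r))
            ≈⟨ mcoeff-+ (suc n) e (Cᵀ (d α j) T.* Φ ψ) (Cᵀ (linear α) T.* (t T.* Φ r)) ⟩
          mcoeff (suc n) e (Cᵀ (d α j) T.* Φ ψ) S.+ mcoeff (suc n) e (Cᵀ (linear α) T.* (t T.* Φ r))
            ≈⟨ S.+-cong (mcoeff-constant* (suc n) e (d α j) (Φ ψ)) (mcoeff-constant* (suc n) e (linear α) (t T.* Φ r)) ⟩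
          d α j S.* mcoeff (suc n) e (Φ ψ) S.+ linear α S.* mcoeff (suc n) e (t T.* Φ r)
            ≈⟨ S.+-congʳ (S.*-comm _ _) ⟩
          mcoeff (suc n) e (Φ ψ) S.* d α j S.+ linear α S.* mcoeff (suc n) e (t T.* Φ r) ∎)
          where
          open SetoidReasoning S.setoid
          expand : Φ (η j) T.≈ Cᵀ (d α j) T.* Φ ψ T.+ Cᵀ (linear α) T.* (t T.* Φ r)
          expand = T.trans (Φ.cong η≈) (T.trans (Φ.+-homo (ψ S.* d α j) (linear α S.* r))
            (T.+-cong {Φ (ψ S.* d α j)} {Cᵀ (d α j) T.* Φ ψ} {Φ (linear α S.* r)} {Cᵀ (linear α) T.* (t T.* Φ r)}
              (T.trans (Φ.*-homo ψ (d α j)) (T.trans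
                (T.*-congˡ {Φ ψ} {Φ (d α j)} {Cᵀ (d α j)} (Φ-constant (α j))) (T.*-comm (Φ ψ) (Cᵀ (d α j)))))
              (T.trans (Φ.*-homo (linear α) r) (T.trans
                (T.*-congʳ {Φ r} {Φ (linear α)} {Cᵀ (linear α) T.* t}
                  (T.trans (Φ-linear α∈) (T.*-comm t (Cᵀ (linear α)))))
                (T.*-assoc (Cᵀ (linear α)) t (Φ r))))))

        restriction⊆ : ∀ {L} → All W L → All W (restrictionForms L)
        restriction⊆ {L} L⊆W = All.deduplicate⁺ _ (All.filter⁺ _ L⊆W)

        -- The coefficients of Φ η are again logarithmic forms. The one for g at t-exponent k is
        -- taken at `length R +ᴺ k`, because the factor Q R in the residue condition contributes
        -- that many powers of t.
        mcoeff-residue : ∀ {L} → All W L → ∀ {g} → g ∈ Residue L → ∀ e → mcoeff (suc n) e (Φ g) ∈ Residue L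
        mcoeff-residue {L} L⊆W {g} (η , logs , res) (k Vec.∷ e) =
          (λ j → mcoeff (suc n) e⁺ (Φ (η j))) ,
          All.zipWith (λ { (α∈ , (ψ , p)) → mcoeff (suc n) e⁺ (Φ ψ) , mcoeff-proportional α∈ p e⁺ }) (L⊆W , logs) ,
          proportional-cong-≈̄ (≈⇒≈̄ (S.trans
            (mcoeff-cong (suc n) e⁺ {Φ (Q R S.* g)} {Φ (Q R) T.* Φ g} (Φ.*-homo (Q R) g))
            (mcoeff-Q (restriction⊆ L⊆W) k e (Φ g))))
            (mcoeff-proportional X⊆H res e⁺)
          where
          R : List V*
          R = restrictionForms L
          e⁺ : Vec ℕ (suc n)
          e⁺ = (length R +ᴺ k) Vec.∷ e

      nonZeroDivisor : ∀ {L} → All W L → ∀ {s} → s ∉ P[ X ] → NonZeroDivisorMod S (Residue L) s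
      nonZeroDivisor {L} L⊆W {s} s∉P = nzd (isIdealˢ (residue-isIdeal L)) (mcoeff-residue L⊆W) s
        λ σs≈0 → s∉P (σ≈0⇒∈ (isIdealˢ generated-isIdeal)
          (λ i → generator (matrix i , (λ {x} → row∈ i {x}) , S̄.refl)) s σs≈0)

      -- (𝒜ᴴ)_X and (𝒜_X)ᴴ are the same list: since X ⊆ H, forms with equal trace on H either all
      -- vanish on X or all do not, so choosing representatives commutes with localization.
      restriction-within : ∀ L → within X (restrictionForms L) ≡ restrictionForms (within X L)
      restriction-within L = ≡.trans
        (filter-deduplicate (contains? X) (λ α β → decide _)
          (λ { (α⊆β , β⊆α) X⊆β x∈ → proj₂ (β⊆α (X⊆H x∈ , X⊆β x∈)) })
          (filter (λ α → decide _) L))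
        (≡.cong (deduplicate (λ α β → decide _)) (filter-comm (contains? X) (λ α → decide _) L))

      -- The two factors by which the residues of 𝒜 and of 𝒜_X differ.
      u v : List V* → S.Carrier
      u L = Q (outside X (restrictionForms L))
      v L = Q (outside X L)

      Q-restriction : ∀ L → Q (restrictionForms L) S.≈ Q (restrictionForms (within X L)) S.* u L
      Q-restriction L = ≡.subst (λ R → Q (restrictionForms L) S.≈ Q R S.* u L) (restriction-within L)
        (Q-filter (contains? X) (restrictionForms L))

      u*∈within : ∀ L {g} → g ∈ Residue L → u L S.* g ∈ Residue (within X L)
      u*∈within L (η , logs , res) = η , All.filter⁺ (contains? X) logs ,
        proportional-cong-≈̄ (≈⇒≈̄ (S.trans (S.*-congʳ (Q-restriction L)) (S.*-assoc _ _ _))) res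

      -- The form is u v η. The factor v makes it a multiple of every α that does not vanish on X,
      -- and u makes up for the larger denominator Q(𝒜ᴴ).
      v*∈ : ∀ L {g} → g ∈ Residue (within X L) → v L S.* g ∈ Residue L
      v*∈ L {g} (η , logs , res) = (λ j → (u L S.* v L) S.* η j) ,
        All.tabulate (λ {α} α∈L → proportional α∈L (contains? X α)) ,
        proportional-cong-≈̄ (≈⇒≈̄ (S.trans
          (solve 4 (λ u v q g → (u :* v) :* (q :* g) := (q :* u) :* (v :* g)) S.refl (u L) (v L) _ g)
          (S.*-congʳ (S.sym (Q-restriction L))))) (proportional-* (u L S.* v L) res)
        where
        open SemiringSolver S.commutativeSemiring
        proportional : ∀ {α} → α ∈ˡ L → Dec (∣ X ∣ ⊆ Ker α) →
                       ∃[ ψ ] Proportional α (λ j → (u L S.* v L) S.* η j) ψ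
        proportional {α} α∈L (yes X⊆α) with All.lookup logs (∈-filter⁺ (contains? X) α∈L X⊆α)
        ... | ψ , p = (u L S.* v L) S.* ψ , proportional-* (u L S.* v L) p
        proportional {α} α∈L (no X⊈α)
          with linear∣Q (∈-filter⁺ (λ α → ¬? (contains? X α)) α∈L X⊈α)
        ... | q , v≈ = S.0# , proportional-resp
          (λ j → S.sym (S.trans (S.*-congʳ (S.*-congˡ v≈))
            (solve 4 (λ u l q x → (u :* (l :* q)) :* x := l :* (u :* q :* x)) S.refl (u L) (linear α) q (η j))))
          (proportional-0 (λ j → u L S.* q S.* η j))

      within⊆W : ∀ L → All W (within X L)
      within⊆W L = All.all-filter (contains? X) L

      u-nonZeroDivisor : ∀ L → NonZeroDivisorMod S (Residue (within X L)) (u L)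
      u-nonZeroDivisor L = product (outside X (restrictionForms L))
        (All.all-filter (λ α → ¬? (contains? X α)) (restrictionForms L))
        where
        open IdealTheory.IsIdeal (isIdealˢ (residue-isIdeal (within X L))) renaming (resp to resp-≈)
        product : ∀ R → All (λ α → ¬ (∣ X ∣ ⊆ Ker α)) R → NonZeroDivisorMod S (Residue (within X L)) (Q R)
        product []      []          g g∈ = resp-≈ (S.*-identityˡ g) g∈
        product (α ∷ R) (X⊈α ∷ R⊈) g g∈ = product R R⊈ g
          (nonZeroDivisor (within⊆W L) (λ α∈ → X⊈α (linear∈⇒vanishes {X} {α} X⊆H α∈)) (Q R S.* g)
            (resp-≈ (S.*-assoc _ _ _) g∈))

      -- A form for g with respect to L yields only u g in the localized ideal, because the
      -- denominators differ by u; saturation removes this factor.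
      residue⊆within : ∀ L → Residue L ⊆ Residue (within X L)
      residue⊆within L g∈ = u-nonZeroDivisor L _ (u*∈within L g∈)

      v∉prime : ∀ {p} {P : Pred S̄.Carrier p} L → IsPrime P →
                (∀ {α} → α ∈ˡ L → linear α ∈ P → ∣ X ∣ ⊆ Ker α) → v L ∉ P
      v∉prime {P = P} L isPrime vanishes = product (outside X L) λ α∈ α∈P →
        proj₂ (∈-filter⁻ (λ α → ¬? (contains? X α)) {xs = L} α∈)
          (vanishes (proj₁ (∈-filter⁻ (λ α → ¬? (contains? X α)) {xs = L} α∈)) α∈P)
        where
        open IsPrime isPrime
        product : ∀ R → (∀ {α} → α ∈ˡ R → linear α ∉ P) → Q R ∉ P
        product []      R∉ 1∈ = proper 1∈
        product (α ∷ R) R∉ e with prime e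
        ... | inj₁ α∈ = R∉ (here ≡.refl) α∈
        ... | inj₂ e′ = product R (λ β∈ → R∉ (there β∈)) e′

-- Associated primes and the decomposition

module Decomposition {c ℓ₁ ℓ₂ : Level} (em : ExcludedMiddle (lsuc (c ⊔ ℓ₁)))
                    (K : HeytingField c ℓ₁ ℓ₂) (n : ℕ) where

  open Arrangements em K n
  open Residues em K n
  open Localization em K n
  open LinearSubspaces Kᴿ decide inverse

  module _ (𝒜 : Arrangement) (αᴴ : V*) (αᴴ∈𝒜 : αᴴ ∈ˡ forms 𝒜) where

    open AtHyperplane αᴴ
    open ResidueAt αᴴ
    open LocalizationAt αᴴ
    open SemiringExp S̄.semiring using (_^_)

    J[_] : Subspace → Pred S̄.Carrier (c ⊔ ℓ₁)
    J[ X ] = J (localization 𝒜 X)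

    residue≐J : ∀ ℬ → αᴴ ∈ˡ forms ℬ → J ℬ ≐ Residue (forms ℬ)
    residue≐J ℬ αᴴ∈ = J⊆residue ℬ αᴴ∈ , residue⊆J ℬ (All.lookup (nonzero 𝒜) αᴴ∈𝒜)

    residue≐J[_] : ∀ X → ∣ X ∣ ⊆ Ker αᴴ → J[ X ] ≐ Residue (within X (forms 𝒜))
    residue≐J[ X ] X⊆H = residue≐J (localization 𝒜 X) (∈-filter⁺ (contains? X) αᴴ∈𝒜 X⊆H)

    isIdeal-resp : ∀ {p} {I I′ : Pred S̄.Carrier p} → I ≐ I′ → IsIdeal I → IsIdeal I′
    isIdeal-resp (I⊆ , ⊆I) ideal = record
      { resp     = λ x≈y x∈ → I⊆ (I.resp x≈y (⊆I x∈))
      ; 0∈       = I⊆ I.0∈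
      ; +-closed = λ x∈ y∈ → I⊆ (I.+-closed (⊆I x∈) (⊆I y∈))
      ; *-closed = λ r x∈ → I⊆ (I.*-closed r (⊆I x∈)) }
      where module I = IsIdeal ideal

    isPrime-resp : ∀ {p} {P P′ : Pred S̄.Carrier p} → P ≐ P′ → IsPrime P → IsPrime P′
    isPrime-resp P≐P′@(P⊆ , ⊆P) isPrime = record
      { isIdeal = isIdeal-resp P≐P′ (IsPrime.isIdeal isPrime)
      ; proper  = λ 1∈ → IsPrime.proper isPrime (⊆P 1∈)
      ; prime   = λ xy∈ → ⊎.map P⊆ P⊆ (IsPrime.prime isPrime (⊆P xy∈)) }

    J-isIdeal : IsIdeal (J 𝒜)
    J-isIdeal = isIdeal-resp (proj₂ J≐R , proj₁ J≐R) (residue-isIdeal (forms 𝒜))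
      where J≐R = residue≐J 𝒜 αᴴ∈𝒜

    -- Kept abstract so that the proof of the basis theorem is not normalised below.
    abstract
      prime-avoiding : ∀ {I : Pred S̄.Carrier (c ⊔ ℓ₁)} → IsIdeal I → ∀ f g → (∀ k → f S̄.* g ^ k ∉ I) →
                       ∃[ h ] (IsPrime (I ∶ (h S̄.* f)) × g ∉ (I ∶ (h S̄.* f)))
      prime-avoiding = associated-prime-avoiding S̄ (maximumCondition-quotient S (linear αᴴ)
        (hilbert-basis-multi Kᴿ (field-maximumCondition Kᴿ decide inverse) n)) decide

    module _ (X : Subspace) (X⊆H : ∣ X ∣ ⊆ Ker αᴴ) where

      private module X = Along X X⊆H

      J[]-isIdeal : IsIdeal J[ X ]
      J[]-isIdeal = isIdeal-resp (proj₂ J≐R , proj₁ J≐R) (residue-isIdeal _)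
        where J≐R = residue≐J[ X ] X⊆H

      J[]-saturated : ∀ {s g} → s ∉ P[ X ] → s S̄.* g ∈ J[ X ] → g ∈ J[ X ]
      J[]-saturated s∉ sg∈ = proj₂ J≐R (X.nonZeroDivisor (X.within⊆W (forms 𝒜)) s∉ _ (proj₁ J≐R sg∈))
        where J≐R = residue≐J[ X ] X⊆H

      J⊆J[] : J 𝒜 ⊆ J[ X ]
      J⊆J[] g∈ = proj₂ (residue≐J[ X ] X⊆H) (X.residue⊆within (forms 𝒜) (proj₁ (residue≐J 𝒜 αᴴ∈𝒜) g∈))

      1∈J[]-of-power : ∀ {x} → x ∉ P[ X ] → ∀ k → x ^ k ∈ J[ X ] → S̄.1# ∈ J[ X ]
      1∈J[]-of-power x∉ zero    1∈   = 1∈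
      1∈J[]-of-power x∉ (suc k) xᵏ∈ = 1∈J[]-of-power x∉ k (J[]-saturated x∉ xᵏ∈)

      -- Otherwise v f ∈ J, so v would lie in the prime J ∶ f, although v is a product of forms
      -- outside it.
      f∉J[] : ∀ {f} → IsPrime (J 𝒜 ∶ f) → (∀ {α} → α ∈ˡ forms 𝒜 → linear α ∈ (J 𝒜 ∶ f) → ∣ X ∣ ⊆ Ker α) →
              f ∉ J[ X ]
      f∉J[] isPrime vanishes f∈ = X.v∉prime (forms 𝒜) isPrime vanishes
        (proj₂ (residue≐J 𝒜 αᴴ∈𝒜) (X.v*∈ (forms 𝒜) (proj₁ (residue≐J[ X ] X⊆H) f∈)))

      1∈⇒U : S̄.1# ∈ J[ X ] → J[ X ] ≐ U
      1∈⇒U 1∈ = (λ _ → tt) , λ {x} _ → IsIdeal.resp J[]-isIdeal (S̄.*-identityʳ x) (IsIdeal.*-closed J[]-isIdeal x 1∈)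

    -- The subspace belonging to an associated prime P is the intersection of H with the
    -- hyperplanes of 𝒜 whose forms lie in P.
    associated⇒P : ∀ (P : Pred S̄.Carrier (c ⊔ ℓ₁)) → P ∈ Ass (J 𝒜) → ∃[ X ] X ∈ Ξ 𝒜 × P ≐ P[ X ]
    associated⇒P P (P-prime , f , P≐J∶f) =
      X , (((βs , All.tabulate (λ β∈ → proj₁ (∈-filter⁻ inP? {xs = restriction 𝒜} β∈)) , (λ x∈ → x∈) , λ x∈ → x∈)
          , λ J[X]≐U → f∉J[X] (proj₂ J[X]≐U tt)))
        -- For s ∈ P the product s f lies in J ⊆ J[ X ]. If s were outside P[ X ] it could be
        -- cancelled, putting f into J[ X ].
        , (λ {s} s∈ → decidable-stable (decide (s ∈ P[ X ])) λ s∉ →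
             f∉J[X] (J[]-saturated X X⊆H s∉ (J⊆J[] X X⊆H (proj₁ P≐J∶f s∈))))
        , P[X]⊆P
      where
      module P = IsPrime P-prime
      module PI = IsIdeal P.isIdeal
      open LinearCombination Kᴿ Kᴿ (idHom Kᴿ)
      inP? : Decidable (λ β → linear β ∈ P)
      inP? β = decide (linear β ∈ P)
      βs : List V*
      βs = filter inP? (restriction 𝒜)

      Ker-+ : ∀ {α x y} → x ∈ Ker α → y ∈ Ker α → (λ i → x i K.+ y i) ∈ Ker α
      Ker-+ {α} {x} {y} x∈ y∈ = K.trans (combination-+ʳ α x y) (K.trans (K.+-cong x∈ y∈) (K.+-identityˡ _))
      Ker-* : ∀ {α x} a → x ∈ Ker α → (λ i → a K.* x i) ∈ Ker α
      Ker-* {α} {x} a x∈ = K.trans (combination-*ʳ α a x) (K.trans (K.*-congˡ x∈) (K.zeroʳ a))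
      Ker-resp : ∀ {α x y} → (∀ i → x i K.≈ y i) → x ∈ Ker α → y ∈ Ker α
      Ker-resp {α} x≈y x∈ = K.trans (combination-congʳ α (λ i → K.sym (x≈y i))) x∈

      X : Subspace
      X = record
        { ∣_∣      = Ker αᴴ ∩ λ v → All (λ β → v ∈ Ker β) βs
        ; resp     = λ { u≈v (u∈ , us) → Ker-resp {αᴴ} u≈v u∈ , All.map (λ {β} → Ker-resp {β} u≈v) us }
        ; 0∈       = combination-0ʳ αᴴ , All.universal combination-0ʳ βs
        ; +-closed = λ { (u∈ , us) (v∈ , vs) → Ker-+ {αᴴ} u∈ v∈
                   , All.zipWith (λ { {β} (p , q) → Ker-+ {β} p q }) (us , vs) }
        ; *-closed = λ { a (v∈ , vs) → Ker-* {αᴴ} a v∈ , All.map (λ {β} → Ker-* {β} a) vs } }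
      X⊆H : ∣ X ∣ ⊆ Ker αᴴ
      X⊆H = proj₁

      W : Pred V* (c ⊔ ℓ₁)
      W α = linear α ∈ P
      module LS = LinearCombination Kᴿ S κ-hom
      W-isLinearSubspace : IsLinearSubspace W
      W-isLinearSubspace = record
        { resp     = λ α≈β → PI.resp (≈⇒≈̄ (LS.combination-congˡ (var Kᴿ n) α≈β))
        ; 0∈       = PI.resp (≈⇒≈̄ (S.sym (LS.combination-0ˡ (var Kᴿ n)))) PI.0∈
        ; +-closed = λ {α} {β} α∈ β∈ → PI.resp (≈⇒≈̄ (S.sym (LS.combination-+ˡ α β (var Kᴿ n)))) (PI.+-closed α∈ β∈)
        ; *-closed = λ a {α} α∈ → PI.resp (≈⇒≈̄ (S.sym (LS.combination-*ˡ a α (var Kᴿ n)))) (PI.*-closed (constant Kᴿ n a) α∈) }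
      αᴴ∈W : αᴴ ∈ W
      αᴴ∈W = PI.resp (S̄.sym (⇒≈̄ S.1# (S.sym (S.trans (S.+-identityˡ _) (S.*-identityʳ _))))) PI.0∈

      -- The restriction may list another form β with the same trace on H in place of α. Such a β
      -- vanishes wherever αᴴ and α do, so by duality it is in the span of forms in P and hence
      -- among the βs.
      vanishes : ∀ {α} → α ∈ˡ forms 𝒜 → linear α ∈ P → ∣ X ∣ ⊆ Ker α
      vanishes {α} α∈𝒜 α∈P with decide (Ker α ≐ Ker αᴴ)
      ... | yes (_ , H⊆α) = λ x∈ → H⊆α (X⊆H x∈)
      ... | no α≢H = λ x∈ → same-trace x∈ (Any.deduplicate⁺ _ {P = SameTrace}
          (λ { (x⊆y , y⊆x) (p , q) → (λ e → p (x⊆y e)) , (λ e → y⊆x (q e)) })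
          (lose {P = SameTrace} (∈-filter⁺ (λ α → decide (¬ (Ker α ≐ Ker αᴴ))) α∈𝒜 α≢H) ((λ e → e) , λ e → e)))
        where
        SameTrace : Pred V* (c ⊔ ℓ₁)
        SameTrace β = (Ker αᴴ ∩ Ker β) ≐ (Ker αᴴ ∩ Ker α)
        same-trace : ∀ {x} → x ∈ ∣ X ∣ → Any SameTrace (restriction 𝒜) → x ∈ Ker α
        same-trace {x} (x∈H , x∈βs) found with find found
        ... | β , β∈ , (β⊆α , α⊆β) = proj₂ (β⊆α (x∈H , All.lookup x∈βs (∈-filter⁺ inP? β∈ β∈P)))
          where
          β∈P : linear β ∈ P
          β∈P = double-annihilator W-isLinearSubspace β λ v v⊥W → proj₂ (α⊆β (v⊥W αᴴ∈W , v⊥W α∈P))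

      P[X]⊆P : P[ X ] ⊆ P
      P[X]⊆P (generator {g} (γ , X⊆γ , g≈γ)) = PI.resp (S̄.sym g≈γ)
        -- A vector killed by every form in P is killed by αᴴ and all βs, so it lies in X and γ
        -- kills it.
        (double-annihilator W-isLinearSubspace γ λ v v⊥W → X⊆γ (v⊥W αᴴ∈W , All.tabulate λ {β} β∈ →
          v⊥W (proj₂ (∈-filter⁻ inP? {xs = restriction 𝒜} β∈))))
      P[X]⊆P (resp x≈y x∈)    = PI.resp x≈y (P[X]⊆P x∈)
      P[X]⊆P 0∈               = PI.0∈
      P[X]⊆P (+-closed x∈ y∈) = PI.+-closed (P[X]⊆P x∈) (P[X]⊆P y∈)
      P[X]⊆P (*-closed r x∈)  = PI.*-closed r (P[X]⊆P x∈)

      f∉J[X] : f ∉ J[ X ]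
      f∉J[X] = f∉J[] X X⊆H (isPrime-resp P≐J∶f P-prime) λ α∈ α∈J∶f → vanishes α∈ (proj₂ P≐J∶f α∈J∶f)

    associated-subspace : ∀ {h} → IsPrime (J 𝒜 ∶ h) → ∃[ X ] X ∈ Ξ 𝒜 × (J 𝒜 ∶ h) ≐ P[ X ]
    associated-subspace {h} h-prime = associated⇒P (J 𝒜 ∶ h) (h-prime , h , (λ x∈ → x∈) , λ x∈ → x∈)

    Ξ⇒⊆H : ∀ X → X ∈ Ξ 𝒜 → ∣ X ∣ ⊆ Ker αᴴ
    Ξ⇒⊆H _ ((_ , _ , X⊆ , _) , _) x∈ = proj₁ (X⊆ x∈)

    -- If x ∉ P[ X ], then x can be cancelled from a power in J[ X ] until 1 is left, against X ∈ Ξ.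
    -- Conversely, if no power of x lies in J, some associated prime avoids x, and it is one of the
    -- P[ X ].
    √J≐⋂P : √ (J 𝒜) ≐ ⋂ (∃ (Ξ 𝒜)) (λ X → P[ proj₁ X ])
    √J≐⋂P = (λ x∈ (X , X∈Ξ) → √J⊆ x∈ X X∈Ξ) , λ {x} x∈⋂ →
        decidable-stable (decide (x ∈ √ (J 𝒜))) λ x∉√ → avoided x∈⋂ x∉√
          (prime-avoiding J-isIdeal S̄.1# x λ k 1xᵏ∈ → x∉√ (k , IsIdeal.resp J-isIdeal (S̄.*-identityˡ _) 1xᵏ∈))
      where
      √J⊆ : ∀ {x} → x ∈ √ (J 𝒜) → ∀ X → X ∈ Ξ 𝒜 → x ∈ P[ X ]
      √J⊆ {x} (k , xᵏ∈) X X∈Ξ = decidable-stable (decide (x ∈ P[ X ])) λ x∉ →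
        proj₂ X∈Ξ (1∈⇒U X (Ξ⇒⊆H X X∈Ξ)
          (1∈J[]-of-power X (Ξ⇒⊆H X X∈Ξ) x∉ k (J⊆J[] X (Ξ⇒⊆H X X∈Ξ) xᵏ∈)))
      avoided : ∀ {x} → x ∈ ⋂ (∃ (Ξ 𝒜)) (λ X → P[ proj₁ X ]) → x ∉ √ (J 𝒜) →
                ¬ (∃[ h ] (IsPrime (J 𝒜 ∶ (h S̄.* S̄.1#)) × x ∉ (J 𝒜 ∶ (h S̄.* S̄.1#))))
      avoided {x} x∈⋂ x∉√ (h , h-prime , x∉) = outside-X (associated-subspace h-prime)
        where
        outside-X : ¬ (∃[ X ] X ∈ Ξ 𝒜 × (J 𝒜 ∶ (h S̄.* S̄.1#)) ≐ P[ X ])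
        outside-X (X , X∈Ξ , (_ , P[X]⊆)) = x∉ (P[X]⊆ (x∈⋂ (X , X∈Ξ)))

    -- For g ∉ J some colon ideal J ∶ (h g) is prime, hence equal to a P[ X ]. Then `f∉J[]` keeps h
    -- g out of J[ X ], although g belongs to it.
    J≐⋂J[] : J 𝒜 ≐ ⋂ (AssociatedSubspace 𝒜) (λ X → J[ proj₁ X ])
    J≐⋂J[] = (λ g∈ (X , X⊆H , _) → J⊆J[] X X⊆H g∈) , λ {g} g∈⋂ →
        decidable-stable (decide (g ∈ J 𝒜)) λ g∉ → absurd g∈⋂
          -- Only the existence of the prime matters, so the element to be avoided is 1.
          (prime-avoiding J-isIdeal g S̄.1# λ k g1ᵏ∈ →
            g∉ (IsIdeal.resp J-isIdeal (S̄.trans (S̄.*-congˡ (1^k≈1 k)) (S̄.*-identityʳ g)) g1ᵏ∈))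
      where
      1^k≈1 : ∀ k → S̄.1# ^ k S̄.≈ S̄.1#
      1^k≈1 zero    = S̄.refl
      1^k≈1 (suc k) = S̄.trans (S̄.*-identityˡ _) (1^k≈1 k)
      absurd : ∀ {g} → g ∈ ⋂ (AssociatedSubspace 𝒜) (λ X → J[ proj₁ X ]) →
               ¬ (∃[ h ] (IsPrime (J 𝒜 ∶ (h S̄.* g)) × S̄.1# ∉ (J 𝒜 ∶ (h S̄.* g))))
      absurd {g} g∈⋂ (h , h-prime , _) = outside-X (associated-subspace h-prime)
        where
        outside-X : ¬ (∃[ X ] X ∈ Ξ 𝒜 × (J 𝒜 ∶ (h S̄.* g)) ≐ P[ X ])
        outside-X (X , X∈Ξ , P≐) = f∉J[] X X⊆H h-prime
          (λ {α} _ α∈ → linear∈⇒vanishes {X} {α} X⊆H (proj₁ P≐ α∈))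
          (IsIdeal.*-closed (J[]-isIdeal X X⊆H) h
            (g∈⋂ (X , X⊆H , isPrime-resp P≐ h-prime , h S̄.* g , proj₂ P≐ , proj₁ P≐)))
          where
          X⊆H : ∣ X ∣ ⊆ Ker αᴴ
          X⊆H = Ξ⇒⊆H X X∈Ξ

    module _ (no-embedded : ∀ (P : Pred S̄.Carrier (c ⊔ ℓ₁)) → ¬ IsEmbeddedPrime (J 𝒜) P) where

      -- If no power of y lies in J[ X ], a prime J[ X ] ∶ h avoids y. It contains J, and it lies
      -- inside P[ X ] because elements outside P[ X ] cancel modulo J[ X ]. So P[ X ] would not be
      -- minimal over J, that is, it would be embedded.
      P[]⊆√J[] : ∀ X → ∣ X ∣ ⊆ Ker αᴴ → P[ X ] ∈ Ass (J 𝒜) → P[ X ] ⊆ √ J[ X ]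
      P[]⊆√J[] X X⊆H P∈Ass {y} y∈P = decidable-stable (decide (y ∈ √ J[ X ])) λ y∉√ →
        no-embedded P[ X ] (P∈Ass , λ minimal → not-minimal minimal
          (prime-avoiding (J[]-isIdeal X X⊆H) S̄.1# y λ k 1yᵏ∈ →
            y∉√ (k , I.resp (S̄.*-identityˡ _) 1yᵏ∈)))
        where
        module I = IsIdeal (J[]-isIdeal X X⊆H)
        not-minimal : IsMinimalPrimeOver (J 𝒜) P[ X ] →
                      ¬ (∃[ h ] (IsPrime (J[ X ] ∶ (h S̄.* S̄.1#)) × y ∉ (J[ X ] ∶ (h S̄.* S̄.1#))))
        not-minimal (_ , _ , minimal) (h , h-prime , y∉) =
          y∉ (minimal (J[ X ] ∶ (h S̄.* S̄.1#)) h-prime J⊆ ⊆P y∈P)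
          where
          J⊆ : J 𝒜 ⊆ (J[ X ] ∶ (h S̄.* S̄.1#))
          J⊆ {x} x∈ = I.resp (S̄.*-comm _ x) (I.*-closed (h S̄.* S̄.1#) (J⊆J[] X X⊆H x∈))
          ⊆P : (J[ X ] ∶ (h S̄.* S̄.1#)) ⊆ P[ X ]
          ⊆P {z} z∈ = decidable-stable (decide (z ∈ P[ X ])) λ z∉ →
            IsPrime.proper h-prime (I.*-closed S̄.1# (J[]-saturated X X⊆H z∉ z∈))

      J[]-isPrimary : ∀ X → ∣ X ∣ ⊆ Ker αᴴ → P[ X ] ∈ Ass (J 𝒜) → IsPrimary J[ X ]
      J[]-isPrimary X X⊆H P∈Ass@(P-prime , f , P≐J∶f) = record
        { isIdeal = J[]-isIdeal X X⊆H
        ; proper  = λ 1∈ → f∉ (I.resp (S̄.*-identityʳ f) (I.*-closed f 1∈))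
        ; primary = λ {x} {y} xy∈ → primary x y xy∈ (decide (y ∈ P[ X ])) }
        where
        module I = IsIdeal (J[]-isIdeal X X⊆H)
        f∉ : f ∉ J[ X ]
        f∉ = f∉J[] X X⊆H (isPrime-resp P≐J∶f P-prime)
          λ {α} _ α∈ → linear∈⇒vanishes {X} {α} X⊆H (proj₂ P≐J∶f α∈)
        primary : ∀ x y → x S̄.* y ∈ J[ X ] → Dec (y ∈ P[ X ]) → x ∈ J[ X ] ⊎ y ∈ √ J[ X ]
        primary x y xy∈ (yes y∈) = inj₂ (P[]⊆√J[] X X⊆H P∈Ass y∈)
        primary x y xy∈ (no y∉)  = inj₁ (J[]-saturated X X⊆H y∉ (I.resp (S̄.*-comm x y) xy∈))

      isPrimaryDecomposition : IsPrimaryDecomposition (J 𝒜) {AssociatedSubspace 𝒜} (λ X → J[ proj₁ X ])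
      isPrimaryDecomposition = record
        { primary      = λ { (X , X⊆H , P∈Ass) → J[]-isPrimary X X⊆H P∈Ass }
        ; finite       = proj₁ cover , λ X → Any.map (λ { {X′} (_ , eq) → J[]≐ X X′ eq }) (proj₂ cover X _)
        ; intersection = J≐⋂J[] }
        where
        cover : Σ (List (AssociatedSubspace 𝒜)) λ js → ∀ X → X ∈ (λ _ → Lift (lsuc (c ⊔ ℓ₁)) ⊤) →
                Any (λ X′ → Lift (lsuc (c ⊔ ℓ₁)) ⊤ × within (proj₁ X) (forms 𝒜) ≡ within (proj₁ X′) (forms 𝒜)) js
        cover = finite-filters em (λ X → contains? (proj₁ X)) (forms 𝒜) (λ _ → Lift (lsuc (c ⊔ ℓ₁)) ⊤)
        -- The comparison passes through `Residue`, which depends on the list of forms alone,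
        -- whereas a localization also carries proofs.
        J[]≐ : ∀ (X X′ : AssociatedSubspace 𝒜) → within (proj₁ X) (forms 𝒜) ≡ within (proj₁ X′) (forms 𝒜) →
               J[ proj₁ X ] ≐ J[ proj₁ X′ ]
        J[]≐ (X , X⊆H , _) (X′ , X′⊆H , _) eq =
          (λ g∈ → proj₂ J≐R′ (≡.subst (λ L → _ ∈ Residue L) eq (proj₁ J≐R g∈))) ,
          (λ g∈ → proj₂ J≐R (≡.subst (λ L → _ ∈ Residue L) (≡.sym eq) (proj₁ J≐R′ g∈)))
          where
          J≐R  = residue≐J[ X ] X⊆H
          J≐R′ = residue≐J[ X′ ] X′⊆H

theorem1p2 : ∀ {c ℓ₁ ℓ₂ : Level} (em : ExcludedMiddle (lsuc (c ⊔ ℓ₁)))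
    (K : HeytingField c ℓ₁ ℓ₂) (n : ℕ) →
    let open Arrangements em K n in
    (𝒜 : Arrangement) (αᴴ : V*) → αᴴ ∈ˡ forms 𝒜 →
    let open AtHyperplane αᴴ in
    √ (J 𝒜) ≐ ⋂ (∃ (Ξ 𝒜)) (λ X → P[ proj₁ X ])
    ×
    (∀ (P : Pred S̄.Carrier (c ⊔ ℓ₁)) → P ∈ Ass (J 𝒜) → ∃[ X ] X ∈ Ξ 𝒜 × P ≐ P[ X ])
    ×
    J 𝒜 ≐ ⋂ (AssociatedSubspace 𝒜) (λ X → J (localization 𝒜 (proj₁ X)))
    ×
    ((∀ (P : Pred S̄.Carrier (c ⊔ ℓ₁)) → ¬ IsEmbeddedPrime (J 𝒜) P) →
    IsPrimaryDecomposition (J 𝒜) {AssociatedSubspace 𝒜}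
    (λ X → J (localization 𝒜 (proj₁ X))))
theorem1p2 em K n 𝒜 αᴴ αᴴ∈ =
  √J≐⋂P 𝒜 αᴴ αᴴ∈ , associated⇒P 𝒜 αᴴ αᴴ∈ , J≐⋂J[] 𝒜 αᴴ αᴴ∈ , isPrimaryDecomposition 𝒜 αᴴ αᴴ∈
  where open Decomposition em K n
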